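{- Let $k\ge0$ and $\ell\ge0$ be fixed integers. For all $n\ge2$ large enough that $\mathfrak{b}_n\ge\max(k,\ell)$, $$q_n(k,\ell)=\frac{\mathbb{E}\left[\binom{\alpha-1}{k}\binom{\beta-1}{\ell}\right]}{\binom{\mathfrak{b}_n}{k}\binom{\mathfrak{b}_n}{\ell}},$$ where $\alpha=\alpha(\rho)$, $\beta=\beta(\rho)$ for $\rho\in\mathfrak{B}_n$ uniformly random; and as $n\to\infty$, $$q_n(k,\ell)\sim\frac{2\cdot3^{k+\ell}}{(k+\ell+1)\binom{3(k+\ell)+2}{3k+1}(2k+1)\binom{2k}{k}(2\ell+1)\binom{2\ell}{\ell}}.$$
   Context: $\mathfrak{S}_n$ is the set of permutations of $[n]=\{1,\dots,n\}$, in one-line notation. A reduction of $\omega\in\mathfrak{S}_n$ interchanges $\omega(i)$ and $\omega(j)$ for some $i<j$ with $\omega(i)>\omega(j)$. Bruhat order: $\pi\le\sigma$ if $\pi$ is obtained from $\sigma$ by a (possibly empty) sequence of reductions. $\mathfrak{B}_n\subseteq\mathfrak{S}_n$ is the set of bigrassmannian permutations, i.e. those $\omega$ such that both $\omega$ and $\omega^{ -1}$ have exactly one descent; equivalently $\omega=1\cdots a\,(b+1)\cdots c\,(a+1)\cdots b\,(c+1)\cdots n$ for some $0\le a<b<c\le n$. $\mathfrak{b}_n=|\mathfrak{B}_n|=\binom{n+1}{3}$. For $\omega\in\mathfrak{B}_n$, $\beta(\omega)$ is the number of $\pi\in\mathfrak{B}_n$ with $\pi\le\omega$, and $\alpha(\omega)$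 is the number of $\tau\in\mathfrak{B}_n$ with $\omega\le\tau$. A $(k,\ell)$-star is a triple $(\Pi,\{\rho\},\Sigma)$ of subsets of $\mathfrak{B}_n$ with $|\Pi|=k$, $|\Sigma|=\ell$ and $\pi>\rho>\sigma$ for all $\pi\in\Pi$, $\sigma\in\Sigma$ (with $\Pi$ or $\Sigma$ empty if $k=0$ or $\ell=0$). Writing $\binom{\mathfrak{B}_n}{k}$ for the collection of $k$-element subsets of $\mathfrak{B}_n$, $q_n(k,\ell)$ is the probability that a uniformly random element of $\binom{\mathfrak{B}_n}{k}\times\binom{\mathfrak{B}_n}{1}\times\binom{\mathfrak{B}_n}{\ell}$ is a $(k,\ell)$-star. $f(n)\sim g(n)$ means $f(n)/g(n)\to1$. -}

module Defs where

open import Data.Nat as ℕ using (ℕ; zero; suc; _∸_)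
import Data.Nat.Properties as ℕ
open import Data.Fin as Fin using (Fin; zero; suc; toℕ)
import Data.Fin.Properties as Fin
import Data.Fin.Induction as Fin
open import Data.Vec.Base as Vec using (Vec; []; _∷_; lookup; _[_]≔_)
import Data.Vec.Properties as Vec
open import Data.Vec.Relation.Binary.Lex.Strict as Lex using (this; next)
open import Data.List.Base
  using (List; []; _∷_; [_]; map; _++_; filter; length; allFin;
         cartesianProduct; cartesianProductWith)
open import Data.Nat.ListAction using (sum)
open import Data.List.Membership.Propositional using (_∈_; find; lose)
open import Data.List.Membership.Propositional.Properties
  using (∈-cartesianProductWith⁺; ∈-allFin; ∈-filter⁺)
open import Data.List.Relation.Unary.All using (All; all?)
open import Data.List.Relation.Unary.Any using (here; any?)
open import Data.List.Relation.Unary.AllPairs using ([]; _∷_)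
open import Data.List.Relation.Unary.All using ([])
open import Data.List.Relation.Unary.Unique.Propositional using (Unique)
import Data.List.Relation.Unary.Unique.Propositional.Properties as Unique
open import Data.Integer.Base using (+_)
open import Data.Rational as ℚ using (ℚ; 0ℚ; 1ℚ; _÷_; _-_; ∣_∣)
open import Data.Product using (Σ; ∃; ∃₂; ∃!; Σ-syntax; _×_; _,_)
open import Function.Definitions using (Inverseᵇ)
open import Induction.WellFounded using (WellFounded; Acc; acc)
open import Relation.Binary.Construct.Closure.ReflexiveTransitive using (Star; ε; _◅_)
open import Relation.Binary.PropositionalEquality
  using (_≡_; _≢_; refl; sym; trans; cong; isEquivalence; resp₂)
open import Relation.Nullary using (Dec; yes; no; ¬?; _×-dec_; _→-dec_)
open import Relation.Nullary.Decidable using (map′)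
open import Relation.Unary using (Decidable)

-- One-line notation, with Fin n in place of {1,…,n}.  A word is a permutation
-- exactly when it has an inverse word, which Bigrassmannian below requires.
Word : ℕ → Set
Word n = Vec (Fin n) n

------------------------------------------------------------------------
-- Bruhat order

interchange : ∀ {n} → Word n → Fin n → Fin n → Word n
interchange ω i j = (ω [ i ]≔ lookup ω j) [ j ]≔ lookup ω i

-- ω ⟶ ω′ : ω′ is a reduction of ω.
_⟶_ : ∀ {n} → Word n → Word n → Set
ω ⟶ ω′ = ∃₂ λ i j → i Fin.< j × lookup ω j Fin.< lookup ω i × ω′ ≡ interchange ω i j

infix 4 _⟶_ _≤ᴮ_ _<ᴮ_ _≤ᴮ?_ _<ᴮ?_ _≟ᵂ_

_≤ᴮ_ : ∀ {n} → Word n → Word n → Set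
π ≤ᴮ σ = Star _⟶_ σ π

_<ᴮ_ : ∀ {n} → Word n → Word n → Set
π <ᴮ σ = π ≤ᴮ σ × π ≢ σ

_≟ᵂ_ : ∀ {n} (π σ : Word n) → Dec (π ≡ σ)
_≟ᵂ_ = Vec.≡-dec Fin._≟_

-- Reductions strictly decrease the one-line notation lexicographically, so the
-- search for a sequence of reductions terminates.
private
  _<ₗ_ : ∀ {n m} → Vec (Fin n) m → Vec (Fin n) m → Set
  _<ₗ_ = Lex.Lex-< _≡_ Fin._<_

  <ₗ-wellFounded : ∀ {n m} → WellFounded (_<ₗ_ {n} {m})
  <ₗ-wellFounded = Lex.<-wellFounded trans (λ { refl x<y → x<y }) Fin.<-wellFounded

  update-<ₗ : ∀ {n m} (v : Vec (Fin n) m) i j → i Fin.< j → ∀ {x y} →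
              x Fin.< lookup v i → ((v [ i ]≔ x) [ j ]≔ y) <ₗ v
  update-<ₗ (_ ∷ v) zero    (suc j) _   x< = this x< refl
  update-<ₗ (_ ∷ v) (suc i) (suc j) i<j x< = next refl (update-<ₗ v i j (ℕ.s≤s⁻¹ i<j) x<)

  reachable? : ∀ {n} (π σ : Word n) → Acc _<ₗ_ σ → Dec (π ≤ᴮ σ)
  reachable? π σ (acc rs) with π ≟ᵂ σ
  ... | yes refl = yes ε
  ... | no π≢σ = map′ to from (Fin.any? λ i → Fin.any? λ j → step? i j)
    where
    Step : Fin _ → Fin _ → Set
    Step i j = Σ (i Fin.< j × lookup σ j Fin.< lookup σ i) λ _ → π ≤ᴮ interchange σ i j

    step? : ∀ i j → Dec (Step i j)
    step? i j with (i Fin.<? j) ×-dec (lookup σ j Fin.<? lookup σ i)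
    ... | no ¬p = no λ { (p , _) → ¬p p }
    ... | yes (i<j , inv) =
      map′ (λ r → (i<j , inv) , r) (λ { (_ , r) → r })
        (reachable? π (interchange σ i j) (rs (update-<ₗ σ i j i<j inv)))

    to : ∃₂ Step → π ≤ᴮ σ
    to (i , j , (i<j , inv) , r) = (i , j , i<j , inv , refl) ◅ r

    from : π ≤ᴮ σ → ∃₂ Step
    from ε with () ← π≢σ refl
    from ((i , j , i<j , inv , refl) ◅ r) = i , j , (i<j , inv) , r

_≤ᴮ?_ : ∀ {n} (π σ : Word n) → Dec (π ≤ᴮ σ)
π ≤ᴮ? σ = reachable? π σ (<ₗ-wellFounded σ)

_<ᴮ?_ : ∀ {n} (π σ : Word n) → Dec (π <ᴮ σ)
π <ᴮ? σ = (π ≤ᴮ? σ) ×-dec ¬? (π ≟ᵂ σ)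

------------------------------------------------------------------------
-- Bigrassmannian permutations

Descent : ∀ {n} → Word n → Fin n → Set
Descent ω i = ∃ λ j → toℕ j ≡ suc (toℕ i) × lookup ω j Fin.< lookup ω i

ExactlyOneDescent : ∀ {n} → Word n → Set
ExactlyOneDescent ω = ∃! _≡_ (Descent ω)

_InverseOf_ : ∀ {n} → Word n → Word n → Set
ω′ InverseOf ω = Inverseᵇ _≡_ _≡_ (lookup ω) (lookup ω′)

Bigrassmannian : ∀ {n} → Word n → Set
Bigrassmannian ω = ∃ λ ω⁻¹ → ω⁻¹ InverseOf ω × ExactlyOneDescent ω × ExactlyOneDescent ω⁻¹

vectors : ∀ n m → List (Vec (Fin n) m)
vectors n zero    = [ [] ]
vectors n (suc m) = cartesianProductWith _∷_ (allFin n) (vectors n m)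

∈-vectors : ∀ {n m} (v : Vec (Fin n) m) → v ∈ vectors n m
∈-vectors []      = here refl
∈-vectors (x ∷ v) = ∈-cartesianProductWith⁺ _∷_ (∈-allFin x) (∈-vectors v)

vectors-unique : ∀ n m → Unique (vectors n m)
vectors-unique n zero    = [] ∷ []
vectors-unique n (suc m) =
  Unique.cartesianProductWith⁺ _∷_ Vec.∷-injective (Unique.allFin⁺ n) (vectors-unique n m)

descent? : ∀ {n} (ω : Word n) → Decidable (Descent ω)
descent? ω i = Fin.any? λ j → (toℕ j ℕ.≟ suc (toℕ i)) ×-dec (lookup ω j Fin.<? lookup ω i)

exactlyOneDescent? : ∀ {n} (ω : Word n) → Dec (ExactlyOneDescent ω)
exactlyOneDescent? ω = Fin.any? λ i → descent? ω i ×-dec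
  map′ (λ f {j} → f j) (λ f j → f {j}) (Fin.all? λ j → descent? ω j →-dec (i Fin.≟ j))

inverseOf? : ∀ {n} (ω′ ω : Word n) → Dec (ω′ InverseOf ω)
inverseOf? ω′ ω = map′
  (λ { (l , r) → (λ { refl → l _ }) , (λ { refl → r _ }) })
  (λ { (l , r) → (λ _ → l refl) , (λ _ → r refl) })
  ((Fin.all? λ x → lookup ω (lookup ω′ x) Fin.≟ x) ×-dec
   (Fin.all? λ x → lookup ω′ (lookup ω x) Fin.≟ x))

bigrassmannian? : ∀ {n} → Decidable (Bigrassmannian {n})
bigrassmannian? {n} ω = map′
  (λ a → let (ω′ , _ , p) = find a in ω′ , p)
  (λ { (ω′ , p) → lose (∈-vectors ω′) p })
  (any? (λ ω′ → inverseOf? ω′ ω ×-dec exactlyOneDescent? ω ×-dec exactlyOneDescent? ω′)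
        (vectors n n))

𝔅 : ∀ n → List (Word n)
𝔅 n = filter bigrassmannian? (vectors n n)

-- 𝔅 n lists each bigrassmannian permutation exactly once.
∈-𝔅 : ∀ {n} {ω : Word n} → Bigrassmannian ω → ω ∈ 𝔅 n
∈-𝔅 {ω = ω} b = ∈-filter⁺ bigrassmannian? (∈-vectors ω) b

𝔅-unique : ∀ n → Unique (𝔅 n)
𝔅-unique n = Unique.filter⁺ bigrassmannian? (vectors-unique n n)

𝔟 : ℕ → ℕ
𝔟 n = length (𝔅 n)

β : ∀ {n} → Word n → ℕ
β {n} ω = length (filter (λ π → π ≤ᴮ? ω) (𝔅 n))

α : ∀ {n} → Word n → ℕ
α {n} ω = length (filter (λ τ → ω ≤ᴮ? τ) (𝔅 n))

------------------------------------------------------------------------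
-- Stars

-- For xs without repetitions, each k-element subset of xs occurs exactly once,
-- listed in the order of xs.
subsetsOfSize : ∀ {a} {A : Set a} → ℕ → List A → List (List A)
subsetsOfSize zero    _        = [ [] ]
subsetsOfSize (suc k) []       = []
subsetsOfSize (suc k) (x ∷ xs) = map (x ∷_) (subsetsOfSize k xs) ++ subsetsOfSize (suc k) xs

Triple : ℕ → Set
Triple n = List (Word n) × List (Word n) × List (Word n)

-- The conditions on Π and on Σ are imposed separately, so that an empty Σ does
-- not make the condition on Π vacuous, nor conversely.
IsStar : ∀ {n} → ℕ → ℕ → Triple n → Set
IsStar k ℓ (Π , R , Σ′) =
  length Π ≡ k × length Σ′ ≡ ℓ ×
  ∃ λ ρ → R ≡ [ ρ ] × All (λ π → ρ <ᴮ π) Π × All (λ σ → σ <ᴮ ρ) Σ′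

isStar? : ∀ {n} k ℓ → Decidable (IsStar {n} k ℓ)
isStar? k ℓ (Π , R , Σ′) =
  (length Π ℕ.≟ k) ×-dec (length Σ′ ℕ.≟ ℓ) ×-dec centre? R
  where
  Centre : List (Word _) → Set
  Centre R = ∃ λ ρ → R ≡ [ ρ ] × All (λ π → ρ <ᴮ π) Π × All (λ σ → σ <ᴮ ρ) Σ′

  centre? : Decidable Centre
  centre? []          = no λ ()
  centre? (_ ∷ _ ∷ _) = no λ ()
  centre? (ρ ∷ [])    = map′ (λ p → ρ , refl , p) (λ { (_ , refl , p) → p })
    (all? (λ π → ρ <ᴮ? π) Π ×-dec all? (λ σ → σ <ᴮ? ρ) Σ′)

triples : ∀ n → ℕ → ℕ → List (Triple n)
triples n k ℓ =
  cartesianProduct (subsetsOfSize k (𝔅 n))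
    (cartesianProduct (subsetsOfSize 1 (𝔅 n)) (subsetsOfSize ℓ (𝔅 n)))

------------------------------------------------------------------------
-- Probability and asymptotics

fromℕ : ℕ → ℚ
fromℕ m = + m ℚ./ 1

infixl 7 _/₀_

-- Division by zero gives zero, so a probability or a mean over an empty sample
-- space is zero.  Only finitely many n lead to a zero denominator below.
_/₀_ : ℚ → ℕ → ℚ
p /₀ zero      = 0ℚ
p /₀ d@(suc _) = p ℚ.* (+ 1 ℚ./ d)

-- The probability of P for a uniformly random entry of a list without repetitions.
ℙ : ∀ {A : Set} {P : A → Set} → List A → Decidable P → ℚ
ℙ xs P? = fromℕ (length (filter P? xs)) /₀ length xs

-- The expectation of X(ρ) for uniformly random ρ ∈ 𝔅 n.
𝔼 : ∀ n → (Word n → ℕ) → ℚ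
𝔼 n X = fromℕ (sum (map X (𝔅 n))) /₀ 𝔟 n

q : ℕ → ℕ → ℕ → ℚ
q n k ℓ = ℙ (triples n k ℓ) (isStar? k ℓ)

infix 4 _~_

_~_ : (ℕ → ℚ) → (ℕ → ℚ) → Set
f ~ g = ∀ ε → 0ℚ ℚ.< ε → ∃ λ N → ∀ n → N ℕ.≤ n →
  Σ[ g≢0 ∈ ℚ.NonZero (g n) ] ∣ (f n ÷ g n) {{g≢0}} - 1ℚ ∣ ℚ.< ε

{-# OPTIONS --safe #-}

-- Write a bigrassmannian permutation as 1⋯a (b+1)⋯c (a+1)⋯b (c+1)⋯n and put x = c − b, y = b − a,
-- z = a, w = n − c.  Reductions preserve bounds for the displacements in both directions and do not
-- move anything outside the interval (a, c]; conversely, sequences of reductions realise the four covers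
-- in which one of x, y drops by 1 and one of z, w grows by 1.  Hence (x,y,z,w) lies below (x′,y′,z′,w′) if and only if
-- x ≤ x′, y ≤ y′, z ≥ z′ and w ≥ w′, so that β = xy(x+y)/2 and α = (z+1)(w+1)(z+w+2)/2.  The formula
-- for the probability is a double count of stars by their centres.  Since α depends on z, w only and β
-- on x, y only, the number of stars is an iterated convolution, whose leading term follows from
-- Vandermonde's identity Σ_{i+j=n} C(i,d) C(j,e) = C(n+1,d+e+1).
module Submission where

open import Defs
open import Data.Nat using (ℕ; zero; suc; _+_; _*_; _∸_; _^_; _≤_; _<_; _⊔_; z≤n; s≤s; z<s; s<s; s≤s⁻¹; _!; NonZero)
open import Data.Nat.Properties
open import Data.Nat.Combinatorics using (_C_; nCk+nC[k+1]≡[n+1]C[k+1]; nC1≡n; nCn≡1)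
open import Data.Nat.DivMod using (_mod_; m<n⇒m%n≡m)
open import Data.Nat.ListAction using (sum)
open import Data.Nat.ListAction.Properties using (sum-++; sum-↭)
open import Data.Nat.Tactic.RingSolver using (solve-∀)
open import Data.Bool.Base using (true; false; if_then_else_)
open import Data.Fin as Fin using (Fin; toℕ; fromℕ<)
import Data.Fin.Properties as Fin
open import Data.Vec.Base using (Vec; []; _∷_; lookup; _[_]≔_)
import Data.Vec.Properties as Vec
open import Data.Product using (Σ; ∃; ∃₂; _×_; _,_; proj₁; proj₂; swap; map₁)
open import Data.Sum.Base using (_⊎_; inj₁; inj₂)
open import Data.Empty using (⊥)
open import Data.List.Base using (List; []; _∷_; [_]; _++_; map; filter; length; cartesianProduct; concatMap; allFin; tabulate)
open import Data.List.Properties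
  using (map-++; map-∘; map-tabulate; length-map; length-++; ++-assoc; ++-identityʳ; ∷-injective;
         filter-accept; filter-reject; filter-++; filter-all; filter-none)
open import Data.List.Membership.Propositional using (_∈_; lose; find)
open import Data.List.Membership.Propositional.Properties
  using (∈-allFin; ∈-filter⁺; ∈-filter⁻; ∈-map⁺; ∈-map⁻; ∈-concatMap⁺; ∈-concatMap⁻; ∈-cartesianProduct⁺; ∈-cartesianProduct⁻)
open import Data.List.Membership.Propositional.Properties.WithK using (unique∧set⇒bag)
open import Data.List.Relation.Binary.BagAndSetEquality using (∼bag⇒↭)
open import Data.List.Relation.Binary.Permutation.Propositional using (_↭_)
import Data.List.Relation.Binary.Permutation.Propositional.Properties as ↭
open import Data.List.Relation.Unary.Any using (here; there)
open import Data.List.Relation.Unary.All as All using (All; []; _∷_; all?)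
import Data.List.Relation.Unary.All.Properties as All
open import Data.List.Relation.Unary.AllPairs as AllPairs using (AllPairs; []; _∷_)
import Data.List.Relation.Unary.AllPairs.Properties as AllPairs
open import Data.List.Relation.Unary.Unique.Propositional using (Unique)
import Data.List.Relation.Unary.Unique.Propositional.Properties as Unique
open import Data.Integer.Base as ℤ using (+_; -[1+_])
import Data.Integer.Properties as ℤ
open import Data.Rational as ℚ using (ℚ; mkℚ; 0ℚ; 1ℚ; ∣_∣; _÷_; _-_)
import Data.Rational.Properties as ℚ
open import Data.Rational.Unnormalised as ℚᵘ using (mkℚᵘ; *≡*)
import Data.Rational.Unnormalised.Properties as ℚᵘ
open import Algebra.Properties.Group ℚ.+-0-group using (⁻¹-involutive)
open import Function.Base using (_∘_; id)
open import Function.Bundles using (mk⇔)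
open import Relation.Binary.Construct.Closure.ReflexiveTransitive using (Star; ε; _◅_; _◅◅_; gmap)
open import Relation.Binary.Definitions using (tri<; tri≈; tri>)
open import Relation.Binary.PropositionalEquality hiding ([_])
open import Relation.Nullary using (Dec; yes; no; does; ¬_; _×-dec_; contradiction)
open import Relation.Nullary.Decidable using (dec-true; dec-false)
open import Relation.Unary using (Decidable)
open import Relation.Unary.Properties using (∁?)

-- The four coordinates add up to `n`, so what `x` and `y` lose on the way down is what `z` and `w`
-- gain; this is why four covers that trade one unit each generate the whole order.
--
-- Truncated subtraction and limits are both awkward, so growth is expressed by pairs of
-- inequalities over ℕ in which bounded shifts of the argument are free; rationals enter the
-- asymptotics only at the end.
--
-- Origin of the constant: the inner sums of `i ^ ℓ * j ^ ℓ` contribute ℓ! ℓ! / (2ℓ+1)!, the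
-- reciprocal of (2ℓ+1) C(2ℓ, ℓ), and likewise for `k`. The outer convolution contributes (3ℓ+1)!
-- (3k+1)! / (3(k+ℓ)+3)!, the reciprocal of 3 (k+ℓ+1) C(3(k+ℓ)+2, 3k+1). The halves in α and β give
-- 1 / 2^(k+ℓ), and the sample size grows like (n³/6)^(k+ℓ+1) up to the factor 1 / (k! ℓ!), which
-- cancels. What remains is 6^(k+ℓ+1) / (3 · 2^(k+ℓ)) = 2 · 3^(k+ℓ).

private variable
  A B : Set
  n m : ℕ

-- Finite sums and counting

∑ : (A → ℕ) → List A → ℕ
∑ f xs = sum (map f xs)

∑-cong : {f g : A → ℕ} {xs : List A} → All (λ x → f x ≡ g x) xs → ∑ f xs ≡ ∑ g xs
∑-cong []       = refl
∑-cong (p ∷ ps) = cong₂ _+_ p (∑-cong ps)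

∑-cong′ : {f g : A → ℕ} (xs : List A) → (∀ x → f x ≡ g x) → ∑ f xs ≡ ∑ g xs
∑-cong′ xs p = ∑-cong {xs = xs} (All.universal p xs)

∑-++ : (f : A → ℕ) (xs ys : List A) → ∑ f (xs ++ ys) ≡ ∑ f xs + ∑ f ys
∑-++ f xs ys = trans (cong sum (map-++ f xs ys)) (sum-++ (map f xs) (map f ys))

∑-map : (f : B → ℕ) (g : A → B) (xs : List A) → ∑ f (map g xs) ≡ ∑ (f ∘ g) xs
∑-map f g xs = cong sum (sym (map-∘ xs))

∑-zero : (xs : List A) → ∑ (λ _ → 0) xs ≡ 0
∑-zero []       = refl
∑-zero (_ ∷ xs) = ∑-zero xs

∑-+ : (f g : A → ℕ) (xs : List A) → ∑ (λ x → f x + g x) xs ≡ ∑ f xs + ∑ g xs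
∑-+ f g []       = refl
∑-+ f g (x ∷ xs) = trans (cong (_+_ (f x + g x)) (∑-+ f g xs)) (lemma (f x) (g x) (∑ f xs) (∑ g xs))
  where
  lemma : ∀ a b c d → a + b + (c + d) ≡ a + c + (b + d)
  lemma = solve-∀

∑-*ˡ : (c : ℕ) (f : A → ℕ) (xs : List A) → ∑ (λ x → c * f x) xs ≡ c * ∑ f xs
∑-*ˡ c f []       = sym (*-zeroʳ c)
∑-*ˡ c f (x ∷ xs) = trans (cong (_+_ (c * f x)) (∑-*ˡ c f xs)) (sym (*-distribˡ-+ c (f x) (∑ f xs)))

∑-*ʳ : (c : ℕ) (f : A → ℕ) (xs : List A) → ∑ (λ x → f x * c) xs ≡ ∑ f xs * c
∑-*ʳ c f xs = trans (∑-cong′ xs λ x → *-comm (f x) c) (trans (∑-*ˡ c f xs) (*-comm c _))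

∑-swap : (f : A → B → ℕ) (xs : List A) (ys : List B) →
         ∑ (λ x → ∑ (f x) ys) xs ≡ ∑ (λ y → ∑ (λ x → f x y) xs) ys
∑-swap f []       ys = sym (∑-zero ys)
∑-swap f (x ∷ xs) ys =
  trans (cong (_+_ (∑ (f x) ys)) (∑-swap f xs ys)) (sym (∑-+ (f x) (λ y → ∑ (λ x → f x y) xs) ys))

∑-cartesianProduct : (f : A × B → ℕ) (xs : List A) (ys : List B) →
                     ∑ f (cartesianProduct xs ys) ≡ ∑ (λ x → ∑ (λ y → f (x , y)) ys) xs
∑-cartesianProduct f []       ys = refl
∑-cartesianProduct f (x ∷ xs) ys =
  trans (∑-++ f (map (x ,_) ys) _) (cong₂ _+_ (∑-map f (x ,_) ys) (∑-cartesianProduct f xs ys))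

∑-one : (xs : List A) → ∑ (λ _ → 1) xs ≡ length xs
∑-one []       = refl
∑-one (_ ∷ xs) = cong suc (∑-one xs)

𝟙 : {P : Set} → Dec P → ℕ
𝟙 d = if does d then 1 else 0

𝟙-yes : {P : Set} (d : Dec P) → P → 𝟙 d ≡ 1
𝟙-yes d p = cong (if_then 1 else 0) (dec-true d p)

𝟙-no : {P : Set} (d : Dec P) → ¬ P → 𝟙 d ≡ 0
𝟙-no d ¬p = cong (if_then 1 else 0) (dec-false d ¬p)

𝟙-cong : {P Q : Set} → (P → Q) → (Q → P) → (d : Dec P) (e : Dec Q) → 𝟙 d ≡ 𝟙 e
𝟙-cong f g (yes p) e = sym (𝟙-yes e (f p))
𝟙-cong f g (no ¬p) e = sym (𝟙-no e (¬p ∘ g))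

𝟙-× : {P Q : Set} (d : Dec P) (e : Dec Q) → 𝟙 (d ×-dec e) ≡ 𝟙 d * 𝟙 e
𝟙-× (yes _) e = sym (+-identityʳ _)
𝟙-× (no _)  e = refl

length-filter≡∑ : {P : A → Set} (P? : Decidable P) (xs : List A) →
                  length (filter P? xs) ≡ ∑ (λ x → 𝟙 (P? x)) xs
length-filter≡∑ P? []       = refl
length-filter≡∑ P? (x ∷ xs) with does (P? x)
... | true  = cong suc (length-filter≡∑ P? xs)
... | false = length-filter≡∑ P? xs

-- Subsets of given size

length-subsetsOfSize : ∀ k (xs : List A) → length (subsetsOfSize k xs) ≡ length xs C k
length-subsetsOfSize zero    xs       = refl
length-subsetsOfSize (suc k) []       = refl
length-subsetsOfSize (suc k) (x ∷ xs) = begin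
  length (map (x ∷_) (subsetsOfSize k xs) ++ subsetsOfSize (suc k) xs)
    ≡⟨ length-++ (map (x ∷_) (subsetsOfSize k xs)) ⟩
  length (map (x ∷_) (subsetsOfSize k xs)) + length (subsetsOfSize (suc k) xs)
    ≡⟨ cong₂ _+_ (trans (length-map (x ∷_) (subsetsOfSize k xs)) (length-subsetsOfSize k xs))
                 (length-subsetsOfSize (suc k) xs) ⟩
  length xs C k + length xs C suc k
    ≡⟨ nCk+nC[k+1]≡[n+1]C[k+1] (length xs) k ⟩
  suc (length xs) C suc k ∎
  where open ≡-Reasoning

All-length-subsetsOfSize : ∀ k (xs : List A) → All (λ ys → length ys ≡ k) (subsetsOfSize k xs)
All-length-subsetsOfSize zero    xs       = refl ∷ []
All-length-subsetsOfSize (suc k) []       = []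
All-length-subsetsOfSize (suc k) (x ∷ xs) =
  All.++⁺ (All.map⁺ (All.map (cong suc) (All-length-subsetsOfSize k xs)))
          (All-length-subsetsOfSize (suc k) xs)

subsetsOfSize-1 : (xs : List A) → subsetsOfSize 1 xs ≡ map [_] xs
subsetsOfSize-1 []       = refl
subsetsOfSize-1 (x ∷ xs) = cong ([ x ] ∷_) (subsetsOfSize-1 xs)

-- Pascal's rule along the list: if `x` satisfies `P`, the subsets through `x` supply the first
-- summand; otherwise none of them passes the test.
∑-all-subsetsOfSize : {P : A → Set} (P? : Decidable P) → ∀ k xs →
                      ∑ (λ ys → 𝟙 (all? P? ys)) (subsetsOfSize k xs) ≡ length (filter P? xs) C k
∑-all-subsetsOfSize P? zero    xs       = refl
∑-all-subsetsOfSize P? (suc k) []       = refl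
∑-all-subsetsOfSize {A = A} P? (suc k) (x ∷ xs) = begin
  ∑ F (map (x ∷_) (subsetsOfSize k xs) ++ subsetsOfSize (suc k) xs)
    ≡⟨ ∑-++ F (map (x ∷_) (subsetsOfSize k xs)) _ ⟩
  ∑ F (map (x ∷_) (subsetsOfSize k xs)) + ∑ F (subsetsOfSize (suc k) xs)
    ≡⟨ cong₂ _+_ (∑-map F (x ∷_) (subsetsOfSize k xs)) (∑-all-subsetsOfSize P? (suc k) xs) ⟩
  ∑ (F ∘ (x ∷_)) (subsetsOfSize k xs) + length (filter P? xs) C suc k
    ≡⟨ split (P? x) ⟩
  length (filter P? (x ∷ xs)) C suc k ∎
  where
  open ≡-Reasoning
  F : List A → ℕ
  F ys = 𝟙 (all? P? ys)

  split : Dec _ → ∑ (F ∘ (x ∷_)) (subsetsOfSize k xs) + length (filter P? xs) C suc k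
                ≡ length (filter P? (x ∷ xs)) C suc k
  split (yes px) = begin
    ∑ (F ∘ (x ∷_)) (subsetsOfSize k xs) + length (filter P? xs) C suc k
      ≡⟨ cong (_+ length (filter P? xs) C suc k) (∑-cong′ (subsetsOfSize k xs) λ ys → 𝟙-cong (λ { (_ ∷ p) → p }) (px ∷_) (all? P? (x ∷ ys)) (all? P? ys)) ⟩
    ∑ F (subsetsOfSize k xs) + length (filter P? xs) C suc k
      ≡⟨ cong (_+ length (filter P? xs) C suc k) (∑-all-subsetsOfSize P? k xs) ⟩
    length (filter P? xs) C k + length (filter P? xs) C suc k
      ≡⟨ nCk+nC[k+1]≡[n+1]C[k+1] (length (filter P? xs)) k ⟩
    suc (length (filter P? xs)) C suc k
      ≡⟨ cong (λ l → length l C suc k) (filter-accept P? px) ⟨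
    length (filter P? (x ∷ xs)) C suc k ∎
  split (no ¬px) = begin
    ∑ (F ∘ (x ∷_)) (subsetsOfSize k xs) + length (filter P? xs) C suc k
      ≡⟨ cong (_+ length (filter P? xs) C suc k) (∑-cong′ (subsetsOfSize k xs) λ ys → 𝟙-no (all? P? (x ∷ ys)) λ { (p ∷ _) → ¬px p }) ⟩
    ∑ (λ _ → 0) (subsetsOfSize k xs) + length (filter P? xs) C suc k
      ≡⟨ cong (_+ length (filter P? xs) C suc k) (∑-zero (subsetsOfSize k xs)) ⟩
    length (filter P? xs) C suc k
      ≡⟨ cong (λ l → length l C suc k) (filter-reject P? ¬px) ⟨
    length (filter P? (x ∷ xs)) C suc k ∎

-- Counting stars

-- `P` and `Q` differ at `ρ` only, and `ρ` occurs exactly once. The induction `go` works with `suc`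
-- on the other side, so that truncated subtraction enters only at the end.
count-strict : {P Q : A → Set} (P? : Decidable P) (Q? : Decidable Q) {ρ : A} →
               (∀ x → Q x → P x × x ≢ ρ) → (∀ x → P x → x ≢ ρ → Q x) → P ρ →
               ∀ {xs} → Unique xs → ρ ∈ xs →
               length (filter Q? xs) ≡ length (filter P? xs) ∸ 1
count-strict {P = P} {Q} P? Q? {ρ} Q⇒ ⇒Q Pρ u ρ∈ = cong (_∸ 1) (go u ρ∈)
  where
  away : ∀ {xs} → All (ρ ≢_) xs → length (filter Q? xs) ≡ length (filter P? xs)
  away []                 = refl
  away {x ∷ xs} (ρ≢x ∷ ps) with P? x
  ... | yes p = trans (cong length (filter-accept Q? {xs = xs} (⇒Q x p (≢-sym ρ≢x))))
                      (cong suc (away ps))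
  ... | no ¬p = trans (cong length (filter-reject Q? {xs = xs} (¬p ∘ proj₁ ∘ Q⇒ x)))
                      (away ps)

  go : ∀ {xs} → Unique xs → ρ ∈ xs → suc (length (filter Q? xs)) ≡ length (filter P? xs)
  go {x ∷ xs} (x∉ ∷ u) (here refl) =
    trans (cong (suc ∘ length) (filter-reject Q? {xs = xs} (λ q → proj₂ (Q⇒ x q) refl)))
    (trans (cong suc (away x∉)) (sym (cong length (filter-accept P? {xs = xs} Pρ))))
  go {x ∷ xs} (x∉ ∷ u) (there ρ∈) with P? x
  ... | yes p = trans (cong (suc ∘ length) (filter-accept Q? {xs = xs}
                        (⇒Q x p (All.lookup x∉ ρ∈)))) (cong suc (go u ρ∈))
  ... | no ¬p = trans (cong (suc ∘ length) (filter-reject Q? {xs = xs} (¬p ∘ proj₁ ∘ Q⇒ x)))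
                      (go u ρ∈)

module _ {n : ℕ} {ρ : Word n} (ρ∈ : ρ ∈ 𝔅 n) where

  count-above : length (filter (λ π → ρ <ᴮ? π) (𝔅 n)) ≡ α ρ ∸ 1
  count-above = count-strict (λ π → ρ ≤ᴮ? π) (λ π → ρ <ᴮ? π)
    (λ { _ (p , ≢) → p , ≢-sym ≢ }) (λ _ p ≢ → p , ≢-sym ≢) ε (𝔅-unique n) ρ∈

  count-below : length (filter (λ σ → σ <ᴮ? ρ) (𝔅 n)) ≡ β ρ ∸ 1
  count-below = count-strict (λ σ → σ ≤ᴮ? ρ) (λ σ → σ <ᴮ? ρ)
    (λ _ p → p) (λ _ → _,_) ε (𝔅-unique n) ρ∈

starWeight : ∀ {n} → ℕ → ℕ → Word n → ℕ
starWeight k ℓ ρ = ((α ρ ∸ 1) C k) * ((β ρ ∸ 1) C ℓ)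

count-stars : ∀ n k ℓ → length (filter (isStar? k ℓ) (triples n k ℓ)) ≡ ∑ (starWeight k ℓ) (𝔅 n)
count-stars n k ℓ = begin
  length (filter (isStar? k ℓ) (triples n k ℓ))
    ≡⟨ length-filter≡∑ (isStar? k ℓ) (triples n k ℓ) ⟩
  ∑ (λ t → 𝟙 (isStar? k ℓ t)) (triples n k ℓ)
    ≡⟨ ∑-cartesianProduct (λ t → 𝟙 (isStar? k ℓ t)) Πs (cartesianProduct (subsetsOfSize 1 (𝔅 n)) Σs) ⟩
  ∑ (λ Π → ∑ (λ t → 𝟙 (isStar? k ℓ (Π , t))) (cartesianProduct (subsetsOfSize 1 (𝔅 n)) Σs)) Πs
    -- The size tests in `IsStar` succeed because the enumerated lists have the prescribed lengths.
    -- This is known for members of the enumeration only, hence the congruence along `All`.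
    ≡⟨ ∑-cong (All.map (λ {Π} → perΠ Π) (All-length-subsetsOfSize k (𝔅 n))) ⟩
  ∑ (λ Π → ∑ (λ ρ → ∑ (λ Σ′ → above ρ Π * below ρ Σ′) Σs) (𝔅 n)) Πs
    ≡⟨ ∑-swap (λ Π ρ → ∑ (λ Σ′ → above ρ Π * below ρ Σ′) Σs) Πs (𝔅 n) ⟩
  ∑ (λ ρ → ∑ (λ Π → ∑ (λ Σ′ → above ρ Π * below ρ Σ′) Σs) Πs) (𝔅 n)
    ≡⟨ ∑-cong (All.tabulate perρ) ⟩
  ∑ (starWeight k ℓ) (𝔅 n) ∎
  where
  open ≡-Reasoning
  Πs = subsetsOfSize k (𝔅 n)
  Σs = subsetsOfSize ℓ (𝔅 n)

  above below : Word n → List (Word n) → ℕ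
  above ρ Π  = 𝟙 (all? (λ π → ρ <ᴮ? π) Π)
  below ρ Σ′ = 𝟙 (all? (λ σ → σ <ᴮ? ρ) Σ′)

  perTriple : ∀ Π ρ Σ′ → length Π ≡ k → length Σ′ ≡ ℓ →
              𝟙 (isStar? k ℓ (Π , [ ρ ] , Σ′)) ≡ above ρ Π * below ρ Σ′
  perTriple Π ρ Σ′ |Π| |Σ| = trans
    (𝟙-cong (λ { (_ , _ , _ , refl , p) → p }) (λ p → |Π| , |Σ| , ρ , refl , p)
      (isStar? k ℓ (Π , [ ρ ] , Σ′)) (all? (λ π → ρ <ᴮ? π) Π ×-dec all? (λ σ → σ <ᴮ? ρ) Σ′))
    (𝟙-× (all? (λ π → ρ <ᴮ? π) Π) (all? (λ σ → σ <ᴮ? ρ) Σ′))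

  perΠ : ∀ Π → length Π ≡ k →
         ∑ (λ t → 𝟙 (isStar? k ℓ (Π , t))) (cartesianProduct (subsetsOfSize 1 (𝔅 n)) Σs)
         ≡ ∑ (λ ρ → ∑ (λ Σ′ → above ρ Π * below ρ Σ′) Σs) (𝔅 n)
  perΠ Π |Π| = begin
    ∑ (λ t → 𝟙 (isStar? k ℓ (Π , t))) (cartesianProduct (subsetsOfSize 1 (𝔅 n)) Σs)
      ≡⟨ ∑-cartesianProduct (λ t → 𝟙 (isStar? k ℓ (Π , t))) (subsetsOfSize 1 (𝔅 n)) Σs ⟩
    ∑ (λ R → ∑ (λ Σ′ → 𝟙 (isStar? k ℓ (Π , R , Σ′))) Σs) (subsetsOfSize 1 (𝔅 n))
      ≡⟨ cong (∑ (λ R → ∑ (λ Σ′ → 𝟙 (isStar? k ℓ (Π , R , Σ′))) Σs)) (subsetsOfSize-1 (𝔅 n)) ⟩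
    ∑ (λ R → ∑ (λ Σ′ → 𝟙 (isStar? k ℓ (Π , R , Σ′))) Σs) (map [_] (𝔅 n))
      ≡⟨ ∑-map (λ R → ∑ (λ Σ′ → 𝟙 (isStar? k ℓ (Π , R , Σ′))) Σs) [_] (𝔅 n) ⟩
    ∑ (λ ρ → ∑ (λ Σ′ → 𝟙 (isStar? k ℓ (Π , [ ρ ] , Σ′))) Σs) (𝔅 n)
      ≡⟨ ∑-cong′ (𝔅 n) (λ ρ → ∑-cong
           (All.map (λ {Σ′} → perTriple Π ρ Σ′ |Π|) (All-length-subsetsOfSize ℓ (𝔅 n)))) ⟩
    ∑ (λ ρ → ∑ (λ Σ′ → above ρ Π * below ρ Σ′) Σs) (𝔅 n) ∎

  perρ : ∀ {ρ} → ρ ∈ 𝔅 n → ∑ (λ Π → ∑ (λ Σ′ → above ρ Π * below ρ Σ′) Σs) Πs ≡ starWeight k ℓ ρ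
  perρ {ρ} ρ∈ = begin
    ∑ (λ Π → ∑ (λ Σ′ → above ρ Π * below ρ Σ′) Σs) Πs
      ≡⟨ ∑-cong′ Πs (λ Π → ∑-*ˡ (above ρ Π) (below ρ) Σs) ⟩
    ∑ (λ Π → above ρ Π * ∑ (below ρ) Σs) Πs
      ≡⟨ ∑-*ʳ (∑ (below ρ) Σs) (above ρ) Πs ⟩
    ∑ (above ρ) Πs * ∑ (below ρ) Σs
      ≡⟨ cong₂ _*_ (trans (∑-all-subsetsOfSize (λ π → ρ <ᴮ? π) k (𝔅 n)) (cong (_C k) (count-above ρ∈)))
                   (trans (∑-all-subsetsOfSize (λ σ → σ <ᴮ? ρ) ℓ (𝔅 n)) (cong (_C ℓ) (count-below ρ∈))) ⟩
    starWeight k ℓ ρ ∎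

length-cartesianProduct : (xs : List A) (ys : List B) →
                          length (cartesianProduct xs ys) ≡ length xs * length ys
length-cartesianProduct []       ys = refl
length-cartesianProduct (x ∷ xs) ys =
  trans (length-++ (map (x ,_) ys)) (cong₂ _+_ (length-map (x ,_) ys) (length-cartesianProduct xs ys))

length-triples : ∀ n k ℓ → length (triples n k ℓ) ≡ (𝔟 n C k) * (𝔟 n * (𝔟 n C ℓ))
length-triples n k ℓ = trans
  (length-cartesianProduct (subsetsOfSize k (𝔅 n)) _)
  (cong₂ _*_ (length-subsetsOfSize k (𝔅 n)) (trans
    (length-cartesianProduct (subsetsOfSize 1 (𝔅 n)) (subsetsOfSize ℓ (𝔅 n)))
    (cong₂ _*_ (trans (cong length (subsetsOfSize-1 (𝔅 n))) (length-map [_] (𝔅 n)))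
               (length-subsetsOfSize ℓ (𝔅 n)))))

q≡ratio : ∀ n k ℓ → q n k ℓ ≡ fromℕ (∑ (starWeight k ℓ) (𝔅 n)) /₀ ((𝔟 n C k) * (𝔟 n * (𝔟 n C ℓ)))
q≡ratio n k ℓ = cong₂ (λ a b → fromℕ a /₀ b) (count-stars n k ℓ) (length-triples n k ℓ)

-- Zero denominators are consistent: `/₀` returns zero for them, so both sides vanish as soon as `a`
-- or `b` does.
/₀-/₀ : ∀ p a b → p /₀ a /₀ b ≡ p /₀ (a * b)
/₀-/₀ p zero    zero    = refl
/₀-/₀ p zero    (suc b) = ℚ.*-zeroˡ (+ 1 ℚ./ suc b)
/₀-/₀ p (suc a) zero    = cong (p /₀_) (sym (*-zeroʳ (suc a)))
/₀-/₀ p (suc a) (suc b) = trans (ℚ.*-assoc p _ _) (cong (p ℚ.*_) (ℚ.toℚᵘ-injective lemma))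
  where
  lemma : ℚ.toℚᵘ ((+ 1 ℚ./ suc a) ℚ.* (+ 1 ℚ./ suc b)) ℚᵘ.≃ ℚ.toℚᵘ (+ 1 ℚ./ (suc a * suc b))
  lemma = ℚᵘ.≃-trans (ℚ.toℚᵘ-homo-* (+ 1 ℚ./ suc a) (+ 1 ℚ./ suc b)) (ℚᵘ.≃-trans
    (ℚᵘ.*-cong (ℚ.toℚᵘ-fromℚᵘ (mkℚᵘ (+ 1) a)) (ℚ.toℚᵘ-fromℚᵘ (mkℚᵘ (+ 1) b)))
    (ℚᵘ.≃-sym (ℚ.toℚᵘ-fromℚᵘ (mkℚᵘ (+ 1) (b + a * suc b)))))

q≡𝔼 : ∀ n k ℓ → q n k ℓ ≡ 𝔼 n (starWeight k ℓ) /₀ ((𝔟 n C k) * (𝔟 n C ℓ))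
q≡𝔼 n k ℓ = begin
  q n k ℓ                                        ≡⟨ q≡ratio n k ℓ ⟩
  fromℕ S /₀ ((𝔟 n C k) * (𝔟 n * (𝔟 n C ℓ)))      ≡⟨ cong (fromℕ S /₀_) (comm (𝔟 n C k) (𝔟 n) (𝔟 n C ℓ)) ⟩
  fromℕ S /₀ (𝔟 n * ((𝔟 n C k) * (𝔟 n C ℓ)))      ≡⟨ /₀-/₀ (fromℕ S) (𝔟 n) _ ⟨
  𝔼 n (starWeight k ℓ) /₀ ((𝔟 n C k) * (𝔟 n C ℓ)) ∎
  where
  open ≡-Reasoning
  S = ∑ (starWeight k ℓ) (𝔅 n)
  comm : ∀ a b c → a * (b * c) ≡ b * (a * c)
  comm = solve-∀

-- Sums over antidiagonals

Diag : (ℕ → ℕ → ℕ) → ℕ → ℕ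
Diag F zero    = F 0 0
Diag F (suc n) = F 0 (suc n) + Diag (λ i j → F (suc i) j) n

infixl 7 _⋆_

_⋆_ : (ℕ → ℕ) → (ℕ → ℕ) → ℕ → ℕ
(f ⋆ g) n = Diag (λ i j → f i * g j) n

Diag-mono : ∀ {F G} n → (∀ i j → i + j ≡ n → F i j ≤ G i j) → Diag F n ≤ Diag G n
Diag-mono zero    F≤G = F≤G 0 0 refl
Diag-mono (suc n) F≤G =
  +-mono-≤ (F≤G 0 (suc n) refl) (Diag-mono n λ i j eq → F≤G (suc i) j (cong suc eq))

Diag-cong : ∀ {F G} n → (∀ i j → i + j ≡ n → F i j ≡ G i j) → Diag F n ≡ Diag G n
Diag-cong zero    F≡G = F≡G 0 0 refl
Diag-cong (suc n) F≡G =
  cong₂ _+_ (F≡G 0 (suc n) refl) (Diag-cong n λ i j eq → F≡G (suc i) j (cong suc eq))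

Diag-*ˡ : ∀ c F n → Diag (λ i j → c * F i j) n ≡ c * Diag F n
Diag-*ˡ c F zero    = refl
Diag-*ˡ c F (suc n) =
  trans (cong (_+_ (c * F 0 (suc n))) (Diag-*ˡ c (λ i j → F (suc i) j) n)) (sym (*-distribˡ-+ c _ _))

Diag-+ : ∀ F G n → Diag (λ i j → F i j + G i j) n ≡ Diag F n + Diag G n
Diag-+ F G zero    = refl
Diag-+ F G (suc n) =
  trans (cong (_+_ (F 0 (suc n) + G 0 (suc n))) (Diag-+ (λ i j → F (suc i) j) (λ i j → G (suc i) j) n))
        (lemma (F 0 (suc n)) (G 0 (suc n)) _ _)
  where
  lemma : ∀ a b c d → a + b + (c + d) ≡ a + c + (b + d)
  lemma = solve-∀

-- The pairs `(K + i , K′ + j)` form part of a longer antidiagonal, and the omitted terms are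
-- nonnegative. This is how shifts of the two factors become one shift of their convolution.
Diag-shift : ∀ F K K′ n → Diag (λ i j → F (K + i) (K′ + j)) n ≤ Diag F (K + K′ + n)
Diag-shift F (suc K) K′       n =
  ≤-trans (Diag-shift (λ i j → F (suc i) j) K K′ n) (m≤n+m _ _)
Diag-shift F zero    zero     n = ≤-refl
Diag-shift F zero    (suc K′) n = ≤-trans (Diag-shift (λ i j → F i (suc j)) zero K′ n) (shift F (K′ + n))
  where
  shift : ∀ F n → Diag (λ i j → F i (suc j)) n ≤ Diag F (suc n)
  shift F zero    = m≤m+n _ _
  shift F (suc n) = +-monoʳ-≤ (F 0 (suc (suc n))) (shift (λ i j → F (suc i) j) n)

-- Binomial coefficients and powers

vandermonde : ∀ d e n → Diag (λ i j → (i C d) * (j C e)) n ≡ suc n C suc (d + e)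
vandermonde zero    zero    zero    = refl
vandermonde zero    (suc e) zero    = refl
vandermonde (suc d) e       zero    = refl
vandermonde zero    e       (suc n) = begin
  1 * (suc n C e) + Diag (λ i j → 1 * (j C e)) n ≡⟨ cong₂ _+_ (*-identityˡ _) (vandermonde zero e n) ⟩
  (suc n C e) + (suc n C suc e)                  ≡⟨ nCk+nC[k+1]≡[n+1]C[k+1] (suc n) e ⟩
  suc (suc n) C suc e                            ∎
  where open ≡-Reasoning
vandermonde (suc d) e       (suc n) = begin
  -- The term with `i = 0` has vanished by computation, since `0 C suc d` is zero. Pascal's rule in
  -- the first factor splits the rest into two instances at `n`, one of them with `d` lowered.
  Diag (λ i j → (suc i C suc d) * (j C e)) n
    ≡⟨ Diag-cong n (λ i j _ → trans (cong (_* (j C e)) (sym (nCk+nC[k+1]≡[n+1]C[k+1] i d)))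
                                    (*-distribʳ-+ (j C e) (i C d) (i C suc d))) ⟩
  Diag (λ i j → (i C d) * (j C e) + (i C suc d) * (j C e)) n
    ≡⟨ Diag-+ (λ i j → (i C d) * (j C e)) (λ i j → (i C suc d) * (j C e)) n ⟩
  Diag (λ i j → (i C d) * (j C e)) n + Diag (λ i j → (i C suc d) * (j C e)) n
    ≡⟨ cong₂ _+_ (vandermonde d e n) (vandermonde (suc d) e n) ⟩
  (suc n C suc (d + e)) + (suc n C suc (suc d + e))
    ≡⟨ nCk+nC[k+1]≡[n+1]C[k+1] (suc n) (suc (d + e)) ⟩
  suc (suc n) C suc (suc d + e) ∎
  where open ≡-Reasoning

C-absorb : ∀ n k → suc k * (suc n C suc k) ≡ suc n * (n C k)
C-absorb zero    zero    = refl
C-absorb zero    (suc k) = *-zeroʳ k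
C-absorb (suc n) zero    = trans (*-identityˡ _) (trans (nC1≡n (suc (suc n))) (sym (*-identityʳ _)))
C-absorb (suc n) (suc k) = begin
  suc (suc k) * (suc (suc n) C suc (suc k))
    ≡⟨ cong (suc (suc k) *_) (nCk+nC[k+1]≡[n+1]C[k+1] (suc n) (suc k)) ⟨
  suc (suc k) * (X + Y)             ≡⟨ split k X Y ⟩
  suc k * X + suc (suc k) * Y + X   ≡⟨ cong₂ (λ a b → a + b + X) (C-absorb n k) (C-absorb n (suc k)) ⟩
  suc n * (n C k) + suc n * (n C suc k) + X
    ≡⟨ cong (_+ X) (*-distribˡ-+ (suc n) (n C k) (n C suc k)) ⟨
  suc n * ((n C k) + (n C suc k)) + X
    ≡⟨ cong (λ a → suc n * a + X) (nCk+nC[k+1]≡[n+1]C[k+1] n k) ⟩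
  suc n * X + X                     ≡⟨ +-comm (suc n * X) X ⟩
  suc (suc n) * X                   ∎
  where
  open ≡-Reasoning
  X = suc n C suc k
  Y = suc n C suc (suc k)
  split : ∀ k X Y → suc (suc k) * (X + Y) ≡ suc k * X + suc (suc k) * Y + X
  split = solve-∀

[1+k]!*C : ∀ n k → suc k ! * (suc n C suc k) ≡ suc n * (k ! * (n C k))
[1+k]!*C n k = begin
  suc k * k ! * (suc n C suc k)   ≡⟨ assoc (suc k) (k !) _ ⟩
  k ! * (suc k * (suc n C suc k)) ≡⟨ cong (k ! *_) (C-absorb n k) ⟩
  k ! * (suc n * (n C k))         ≡⟨ comm (k !) (suc n) (n C k) ⟩
  suc n * (k ! * (n C k))         ∎
  where
  open ≡-Reasoning
  assoc : ∀ a b c → a * b * c ≡ b * (a * c)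
  assoc = solve-∀
  comm : ∀ a b c → a * (b * c) ≡ b * (a * c)
  comm = solve-∀

k!*nCk≤n^k : ∀ n k → k ! * (n C k) ≤ n ^ k
k!*nCk≤n^k n       zero    = ≤-refl
k!*nCk≤n^k zero    (suc k) = ≤-reflexive (*-zeroʳ (suc k !))
k!*nCk≤n^k (suc n) (suc k) = begin
  suc k ! * (suc n C suc k)   ≡⟨ [1+k]!*C n k ⟩
  suc n * (k ! * (n C k))     ≤⟨ *-monoʳ-≤ (suc n) (k!*nCk≤n^k n k) ⟩
  suc n * n ^ k               ≤⟨ *-monoʳ-≤ (suc n) (^-monoˡ-≤ k (n≤1+n n)) ⟩
  suc n * suc n ^ k           ∎
  where open ≤-Reasoning

-- With `k!*nCk≤n^k` this encloses the falling factorial `k ! * (n C k)` between powers. Shifting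
-- the upper index by `k` replaces the subtraction in (n - k)^k.
n^k≤k!*[k+n]Ck : ∀ n k → n ^ k ≤ k ! * ((k + n) C k)
n^k≤k!*[k+n]Ck n zero    = ≤-refl
n^k≤k!*[k+n]Ck n (suc k) = begin
  n * n ^ k                         ≤⟨ *-mono-≤ (≤-trans (m≤n+m n k) (n≤1+n _)) (n^k≤k!*[k+n]Ck n k) ⟩
  suc (k + n) * (k ! * ((k + n) C k)) ≡⟨ [1+k]!*C (k + n) k ⟨
  suc k ! * (suc (k + n) C suc k)   ∎
  where open ≤-Reasoning

C-monoˡ-≤ : ∀ k {m n} → m ≤ n → m C k ≤ n C k
C-monoˡ-≤ zero    m≤n       = ≤-refl
C-monoˡ-≤ (suc k) z≤n       = z≤n
C-monoˡ-≤ (suc k) {suc m} {suc n} (s≤s m≤n) =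
  subst₂ _≤_ (nCk+nC[k+1]≡[n+1]C[k+1] m k) (nCk+nC[k+1]≡[n+1]C[k+1] n k)
    (+-mono-≤ (C-monoˡ-≤ k m≤n) (C-monoˡ-≤ (suc k) m≤n))

^-distribʳ-* : ∀ m n k → (m * n) ^ k ≡ m ^ k * n ^ k
^-distribʳ-* m n zero    = refl
^-distribʳ-* m n (suc k) =
  trans (cong (m * n *_) (^-distribʳ-* m n k)) (interchange′ m n (m ^ k) (n ^ k))
  where
  interchange′ : ∀ a b c d → a * b * (c * d) ≡ a * c * (b * d)
  interchange′ = solve-∀

-- Leading terms

-- f n = (c / q) n ^ d (1 + O (1 / n)), in a form closed under convolution.
record LeadingTerm (d c q : ℕ) (f : ℕ → ℕ) : Set where
  constructor leadingTerm
  field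
    lower : ∃ λ K → ∀ n → c * n ^ d ≤ q * f (K + n)
    upper : ∃ λ K → ∀ n → q * f n ≤ c * (K + n) ^ d

open LeadingTerm

private
  *-interchange : ∀ a b c d → a * b * (c * d) ≡ a * c * (b * d)
  *-interchange = solve-∀

power : ∀ d → LeadingTerm d 1 1 (_^ d)
power d = leadingTerm (0 , λ _ → ≤-refl) (0 , λ _ → ≤-refl)

successor : LeadingTerm 1 1 1 suc
successor = leadingTerm
  (0 , λ n → *-monoʳ-≤ 1 (≤-trans (≤-reflexive (*-identityʳ n)) (n≤1+n n)))
  (1 , λ n → *-monoʳ-≤ 1 (≤-reflexive (sym (*-identityʳ (suc n)))))

product : ∀ {d e c c′ q q′ f g} → LeadingTerm d c q f → LeadingTerm e c′ q′ g →
          LeadingTerm (d + e) (c * c′) (q * q′) (λ n → f n * g n)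
product {d} {e} {c} {c′} {q} {q′} {f} {g}
  (leadingTerm (K , f≥) (L , f≤)) (leadingTerm (K′ , g≥) (L′ , g≤)) = leadingTerm
  (K + K′ , λ n → begin
    c * c′ * n ^ (d + e)         ≡⟨ regroup n ⟩
    -- Each power takes over the other factor's shift, so that both functions end up at the same
    -- argument; powers are monotone, while nothing of the kind is known of `f` and `g`.
    (c * n ^ d) * (c′ * n ^ e)   ≤⟨ *-mono-≤ (*-monoʳ-≤ c (^-monoˡ-≤ d (m≤n+m n K′)))
                                              (*-monoʳ-≤ c′ (^-monoˡ-≤ e (m≤n+m n K))) ⟩
    (c * (K′ + n) ^ d) * (c′ * (K + n) ^ e)
      ≤⟨ *-mono-≤ (f≥ (K′ + n)) (g≥ (K + n)) ⟩
    (q * f (K + (K′ + n))) * (q′ * g (K′ + (K + n)))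
      ≡⟨ cong₂ (λ a b → q * f a * (q′ * g b)) (sym (+-assoc K K′ n)) (commute K′ K n) ⟩
    (q * f (K + K′ + n)) * (q′ * g (K + K′ + n))
      ≡⟨ *-interchange q (f (K + K′ + n)) q′ (g (K + K′ + n)) ⟩
    q * q′ * (f (K + K′ + n) * g (K + K′ + n)) ∎)
  (L + L′ , λ n → begin
    q * q′ * (f n * g n)         ≡⟨ *-interchange q q′ (f n) (g n) ⟩
    (q * f n) * (q′ * g n)       ≤⟨ *-mono-≤ (f≤ n) (g≤ n) ⟩
    (c * (L + n) ^ d) * (c′ * (L′ + n) ^ e)
      ≤⟨ *-mono-≤ (*-monoʳ-≤ c (^-monoˡ-≤ d (+-monoˡ-≤ n (m≤m+n L L′))))
                  (*-monoʳ-≤ c′ (^-monoˡ-≤ e (+-monoˡ-≤ n (m≤n+m L′ L)))) ⟩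
    (c * (L + L′ + n) ^ d) * (c′ * (L + L′ + n) ^ e) ≡⟨ regroup (L + L′ + n) ⟨
    c * c′ * (L + L′ + n) ^ (d + e) ∎)
  where
  open ≤-Reasoning
  commute : ∀ a b c → a + (b + c) ≡ b + a + c
  commute = solve-∀
  regroup : ∀ n → c * c′ * n ^ (d + e) ≡ (c * n ^ d) * (c′ * n ^ e)
  regroup n = trans (cong (c * c′ *_) (^-distribˡ-+-* n d e)) (*-interchange c c′ (n ^ d) (n ^ e))

-- The new factor d! e! / (d+e+1)! is the beta integral of t^d (1-t)^e. Powers are traded for
-- binomial coefficients, whose convolution Vandermonde's identity evaluates exactly, and traded
-- back; each trade costs a bounded shift.
convolution : ∀ {d e c c′ q q′ f g} → LeadingTerm d c q f → LeadingTerm e c′ q′ g →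
              LeadingTerm (suc (d + e)) (c * c′ * (d ! * e !)) (q * q′ * suc (d + e) !) (f ⋆ g)
convolution {d} {e} {c} {c′} {q} {q′} {f} {g}
  (leadingTerm (K , f≥) (K″ , f≤)) (leadingTerm (K′ , g≥) (K‴ , g≤)) = leadingTerm
  -- The summand `d + e` makes `suc N` equal to `D + n`, the upper index at which `n ^ D` is bounded
  -- by a binomial coefficient.
  (K + K′ + (d + e) , λ n → let N = d + e + n in begin
    c * c′ * (d ! * e !) * n ^ D
      ≤⟨ *-monoʳ-≤ (c * c′ * (d ! * e !)) (n^k≤k!*[k+n]Ck n D) ⟩
    c * c′ * (d ! * e !) * (D ! * (suc N C D))
      ≡⟨ toDiag N ⟩
    D ! * Diag (λ i j → (c * (d ! * (i C d))) * (c′ * (e ! * (j C e)))) N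
      ≤⟨ *-monoʳ-≤ (D !) (Diag-mono N λ i j _ → *-mono-≤
           (≤-trans (*-monoʳ-≤ c (k!*nCk≤n^k i d)) (f≥ i))
           (≤-trans (*-monoʳ-≤ c′ (k!*nCk≤n^k j e)) (g≥ j))) ⟩
    D ! * Diag (λ i j → (q * f (K + i)) * (q′ * g (K′ + j))) N
      ≤⟨ *-monoʳ-≤ (D !) (Diag-shift (λ i j → (q * f i) * (q′ * g j)) K K′ N) ⟩
    D ! * Diag (λ i j → (q * f i) * (q′ * g j)) (K + K′ + N)
      ≡⟨ fromDiag (K + K′ + N) ⟩
    q * q′ * D ! * (f ⋆ g) (K + K′ + N)
      ≡⟨ cong (λ x → q * q′ * D ! * (f ⋆ g) x) (+-assoc (K + K′) (d + e) n) ⟨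
    q * q′ * D ! * (f ⋆ g) (K + K′ + (d + e) + n) ∎)
  -- Both factors are shifted for their own bounds, and Vandermonde's identity raises the upper
  -- index by one more.
  (suc (d + K″ + (e + K‴)) , λ n → let N = d + K″ + (e + K‴) + n in begin
    q * q′ * D ! * (f ⋆ g) n
      ≡⟨ fromDiag n ⟨
    D ! * Diag (λ i j → (q * f i) * (q′ * g j)) n
      ≤⟨ *-monoʳ-≤ (D !) (Diag-mono n λ i j _ → *-mono-≤ (above c d K″ i (f≤ i)) (above c′ e K‴ j (g≤ j))) ⟩
    D ! * Diag (λ i j → (c * (d ! * ((d + K″ + i) C d))) * (c′ * (e ! * ((e + K‴ + j) C e)))) n
      ≤⟨ *-monoʳ-≤ (D !) (Diag-shift (λ i j → (c * (d ! * (i C d))) * (c′ * (e ! * (j C e)))) (d + K″) (e + K‴) n) ⟩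
    D ! * Diag (λ i j → (c * (d ! * (i C d))) * (c′ * (e ! * (j C e)))) N
      ≡⟨ toDiag N ⟨
    c * c′ * (d ! * e !) * (D ! * (suc N C D))
      ≤⟨ *-monoʳ-≤ (c * c′ * (d ! * e !)) (k!*nCk≤n^k (suc N) D) ⟩
    c * c′ * (d ! * e !) * suc N ^ D ∎)
  where
  open ≤-Reasoning
  D = suc (d + e)

  above : ∀ {y} c d K n → y ≤ c * (K + n) ^ d → y ≤ c * (d ! * ((d + K + n) C d))
  above c d K n y≤ = ≤-trans y≤ (*-monoʳ-≤ c
    (subst (λ x → (K + n) ^ d ≤ d ! * (x C d)) (sym (+-assoc d K n)) (n^k≤k!*[k+n]Ck (K + n) d)))

  fromDiag : ∀ N → D ! * Diag (λ i j → (q * f i) * (q′ * g j)) N ≡ q * q′ * D ! * (f ⋆ g) N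
  fromDiag N = trans
    (cong (D ! *_) (trans (Diag-cong N λ i j _ → *-interchange q (f i) q′ (g j))
                          (Diag-*ˡ (q * q′) (λ i j → f i * g j) N)))
    (commute (D !) (q * q′) _)
    where
    commute : ∀ a b c → a * (b * c) ≡ b * a * c
    commute = solve-∀

  toDiag : ∀ N → c * c′ * (d ! * e !) * (D ! * (suc N C D)) ≡
                 D ! * Diag (λ i j → (c * (d ! * (i C d))) * (c′ * (e ! * (j C e)))) N
  toDiag N = trans (commute (c * c′ * (d ! * e !)) (D !) _) (cong (D ! *_) (trans
    (cong (c * c′ * (d ! * e !) *_) (sym (vandermonde d e N))) (trans
    (sym (Diag-*ˡ (c * c′ * (d ! * e !)) (λ i j → (i C d) * (j C e)) N))
    (Diag-cong N λ i j _ → regroup c c′ (d !) (e !) (i C d) (j C e)))))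
    where
    commute : ∀ a b c → a * (b * c) ≡ b * (a * c)
    commute = solve-∀
    regroup : ∀ c c′ d e x y → c * c′ * (d * e) * (x * y) ≡ (c * (d * x)) * (c′ * (e * y))
    regroup = solve-∀

-- Lets an exact but unwieldy `f` inherit the growth of a simple `h` that agrees with `r * f` up to
-- shifts in both directions.
transfer : ∀ {d c q f} h r A B → LeadingTerm d c q h →
           (∀ n → h n ≤ r * f (A + n)) → (∀ n → r * f n ≤ h (B + n)) →
           LeadingTerm d c (q * r) f
transfer {d} {c} {q} {f} h r A B (leadingTerm (K , h≥) (K′ , h≤)) h≤f f≤h = leadingTerm
  (A + K , λ n → begin
    c * n ^ d                  ≤⟨ h≥ n ⟩
    q * h (K + n)              ≤⟨ *-monoʳ-≤ q (h≤f (K + n)) ⟩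
    q * (r * f (A + (K + n)))  ≡⟨ *-assoc q r _ ⟨
    q * r * f (A + (K + n))    ≡⟨ cong (λ x → q * r * f x) (+-assoc A K n) ⟨
    q * r * f (A + K + n)      ∎)
  (K′ + B , λ n → begin
    q * r * f n                ≡⟨ *-assoc q r _ ⟩
    q * (r * f n)              ≤⟨ *-monoʳ-≤ q (f≤h n) ⟩
    q * h (B + n)              ≤⟨ h≤ (B + n) ⟩
    c * (K′ + (B + n)) ^ d     ≡⟨ cong (λ x → c * x ^ d) (+-assoc K′ B n) ⟨
    c * (K′ + B + n) ^ d       ∎)
  where open ≤-Reasoning

-- A power is bounded by a binomial coefficient only after its upper index has been raised by `k`.
-- Strict growth of `f` turns that into a shift of the argument: `k + f n ≤ f (k + n)`.
binomial : ∀ {d c q f} k → LeadingTerm d c q f → (∀ n → f n < f (suc n)) →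
           LeadingTerm (d * k) (c ^ k) (q ^ k * k !) (λ n → f n C k)
binomial {d} {c} {q} {f} k (leadingTerm (K , f≥) (K′ , f≤)) f< = leadingTerm
  (k + K , λ n → begin
    c ^ k * n ^ (d * k)                ≡⟨ regroup n ⟩
    (c * n ^ d) ^ k                    ≤⟨ ^-monoˡ-≤ k (f≥ n) ⟩
    (q * f (K + n)) ^ k                ≡⟨ ^-distribʳ-* q (f (K + n)) k ⟩
    q ^ k * f (K + n) ^ k              ≤⟨ *-monoʳ-≤ (q ^ k) (n^k≤k!*[k+n]Ck (f (K + n)) k) ⟩
    q ^ k * (k ! * ((k + f (K + n)) C k))
      ≤⟨ *-monoʳ-≤ (q ^ k) (*-monoʳ-≤ (k !) (C-monoˡ-≤ k (growth k (K + n)))) ⟩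
    q ^ k * (k ! * (f (k + (K + n)) C k)) ≡⟨ *-assoc (q ^ k) (k !) _ ⟨
    q ^ k * k ! * (f (k + (K + n)) C k)
      ≡⟨ cong (λ x → q ^ k * k ! * (f x C k)) (+-assoc k K n) ⟨
    q ^ k * k ! * (f (k + K + n) C k) ∎)
  (K′ , λ n → begin
    q ^ k * k ! * (f n C k)            ≡⟨ *-assoc (q ^ k) (k !) _ ⟩
    q ^ k * (k ! * (f n C k))          ≤⟨ *-monoʳ-≤ (q ^ k) (k!*nCk≤n^k (f n) k) ⟩
    q ^ k * f n ^ k                    ≡⟨ ^-distribʳ-* q (f n) k ⟨
    (q * f n) ^ k                      ≤⟨ ^-monoˡ-≤ k (f≤ n) ⟩
    (c * (K′ + n) ^ d) ^ k             ≡⟨ regroup (K′ + n) ⟨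
    c ^ k * (K′ + n) ^ (d * k)         ∎)
  where
  open ≤-Reasoning
  regroup : ∀ n → c ^ k * n ^ (d * k) ≡ (c * n ^ d) ^ k
  regroup n = trans (cong (c ^ k *_) (sym (^-*-assoc n d k))) (sym (^-distribʳ-* c (n ^ d) k))

  growth : ∀ j n → j + f n ≤ f (j + n)
  growth zero    n = ≤-refl
  growth (suc j) n = ≤-trans (s≤s (growth j n)) (f< (j + n))

-- Ratios

private
  -- A division-free form of (1 + K/u)^D ≤ 1 + A/u. The recursion for `A` comes from (1 + K/u)(1 +
  -- A/u) = 1 + (K + A)/u + KA/u², where the last term is at most KA/u for `u ≥ 1`.
  power-ratio : ∀ K D → ∃ λ A → ∀ u → u * (K + u) ^ D ≤ (A + u) * u ^ D
  power-ratio K zero    = 0 , λ _ → ≤-refl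
  power-ratio K (suc D) with A , bound ← power-ratio K D = K * A + (K + A) , go
    where
    open ≤-Reasoning
    assoc : ∀ a b c → a * (b * c) ≡ b * (a * c)
    assoc = solve-∀
    expand : ∀ K A u → K * A + (K * A * u + (K + A + suc u) * suc u) ≡ (K * A + (K + A) + suc u) * suc u
    expand = solve-∀
    expand′ : ∀ K A u → (K + suc u) * (A + suc u) ≡ K * A + ((K + A + suc u) * suc u)
    expand′ = solve-∀
    go : ∀ u → u * (K + u) ^ suc D ≤ (K * A + (K + A) + u) * u ^ suc D
    go zero      = z≤n
    go u@(suc v) = begin
      u * ((K + u) * (K + u) ^ D)   ≡⟨ assoc u (K + u) _ ⟩
      (K + u) * (u * (K + u) ^ D)   ≤⟨ *-monoʳ-≤ (K + u) (bound u) ⟩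
      (K + u) * ((A + u) * u ^ D)   ≡⟨ *-assoc (K + u) (A + u) _ ⟨
      (K + u) * (A + u) * u ^ D     ≡⟨ cong (_* u ^ D) (expand′ K A v) ⟩
      (K * A + (K + A + u) * u) * u ^ D
        ≤⟨ *-monoˡ-≤ (u ^ D) (+-monoʳ-≤ (K * A) (m≤n+m ((K + A + u) * u) (K * A * v))) ⟩
      (K * A + (K * A * v + (K + A + u) * u)) * u ^ D ≡⟨ cong (_* u ^ D) (expand K A v) ⟩
      (K * A + (K + A) + u) * u * u ^ D ≡⟨ *-assoc (K * A + (K + A) + u) u _ ⟩
      (K * A + (K + A) + u) * (u * u ^ D) ∎

  power-ratio→1 : ∀ K D r → ∃ λ N → ∀ u → N ≤ u → r * (K + u) ^ D ≤ suc r * u ^ D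
  -- Once `u ≥ r * A`, the factor `r * (A + u)` is at most `suc r * u`; the extra `suc` makes `u`
  -- positive, so that it can be cancelled.
  power-ratio→1 K D r with A , bound ← power-ratio K D = suc (r * A) , go
    where
    open ≤-Reasoning
    assoc : ∀ a b c → a * (b * c) ≡ b * (a * c)
    assoc = solve-∀
    go : ∀ u → suc (r * A) ≤ u → r * (K + u) ^ D ≤ suc r * u ^ D
    go u@(suc _) rA<u = *-cancelˡ-≤ u (begin
      u * (r * (K + u) ^ D)     ≡⟨ assoc u r _ ⟩
      r * (u * (K + u) ^ D)     ≤⟨ *-monoʳ-≤ r (bound u) ⟩
      r * ((A + u) * u ^ D)     ≡⟨ *-assoc r (A + u) _ ⟨
      r * (A + u) * u ^ D       ≡⟨ cong (_* u ^ D) (*-distribˡ-+ r A u) ⟩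
      (r * A + r * u) * u ^ D   ≤⟨ *-monoˡ-≤ (u ^ D) (+-monoˡ-≤ (r * u) (<⇒≤ rA<u)) ⟩
      (suc r * u) * u ^ D       ≡⟨ cong (_* u ^ D) (*-comm (suc r) u) ⟩
      (u * suc r) * u ^ D       ≡⟨ *-assoc u (suc r) _ ⟩
      u * (suc r * u ^ D)       ∎)

-- Combines the upper bound for `f` with the lower bound for `g`; the shifts in both are paid for by
-- the factor 1 + 1/r, whose denominator has been cleared.
ratio-≤ : ∀ {D c c′ q q′ f g} → LeadingTerm D c q f → LeadingTerm D c′ q′ g →
          ∀ r → ∃ λ N → ∀ n → N ≤ n → r * (q * c′ * f n) ≤ suc r * (q′ * c * g n)
ratio-≤ {D} {c} {c′} {q} {q′} {f} {g} F G r
  with K , f≤ ← upper F | K′ , g≥ ← lower G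
  with N , bound ← power-ratio→1 (K + K′) D r = K′ + N , λ n K′+N≤n →
    subst (λ n → r * (q * c′ * f n) ≤ suc r * (q′ * c * g n)) (m+[n∸m]≡n (m+n≤o⇒m≤o K′ K′+N≤n))
      (go (n ∸ K′) (m+n≤o⇒m≤o∸n N (subst (_≤ n) (+-comm K′ N) K′+N≤n)))
  where
  open ≤-Reasoning
  e₁ : ∀ r q c′ x → r * (q * c′ * x) ≡ r * c′ * (q * x)
  e₁ = solve-∀
  e₂ : ∀ r c′ c x → r * c′ * (c * x) ≡ c * c′ * (r * x)
  e₂ = solve-∀
  e₃ : ∀ r c′ c x → c * c′ * (r * x) ≡ r * c * (c′ * x)
  e₃ = solve-∀
  e₄ : ∀ r q′ c x → r * c * (q′ * x) ≡ r * (q′ * c * x)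
  e₄ = solve-∀
  go : ∀ u → N ≤ u → r * (q * c′ * f (K′ + u)) ≤ suc r * (q′ * c * g (K′ + u))
  go u N≤u = begin
    r * (q * c′ * f (K′ + u))           ≡⟨ e₁ r q c′ _ ⟩
    r * c′ * (q * f (K′ + u))           ≤⟨ *-monoʳ-≤ (r * c′) (f≤ (K′ + u)) ⟩
    r * c′ * (c * (K + (K′ + u)) ^ D)   ≡⟨ cong (λ x → r * c′ * (c * x ^ D)) (+-assoc K K′ u) ⟨
    r * c′ * (c * (K + K′ + u) ^ D)     ≡⟨ e₂ r c′ c _ ⟩
    c * c′ * (r * (K + K′ + u) ^ D)     ≤⟨ *-monoʳ-≤ (c * c′) (bound u N≤u) ⟩
    c * c′ * (suc r * u ^ D)            ≡⟨ e₃ (suc r) c′ c _ ⟩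
    suc r * c * (c′ * u ^ D)            ≤⟨ *-monoʳ-≤ (suc r * c) (g≥ u) ⟩
    suc r * c * (q′ * g (K′ + u))       ≡⟨ e₄ (suc r) q′ c _ ⟩
    suc r * (q′ * c * g (K′ + u))       ∎

-- The equation is the cleared form of (c/q) / (c′/q′) = Num/Den. The conclusion holds `f m / g m`
-- and Num/Den within a factor 1 + 1/r of each other, by `ratio-≤` used in both directions.
ratio-limit : ∀ {D c c′ q q′ f g} → LeadingTerm D c q f → LeadingTerm D c′ q′ g →
              ∀ Num Den → .{{_ : NonZero (q * c′)}} → q′ * c * Den ≡ q * c′ * Num →
              ∀ r → ∃ λ N → ∀ m → N ≤ m →
              r * (f m * Den) ≤ suc r * (Num * g m) × r * (Num * g m) ≤ suc r * (f m * Den)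
ratio-limit {D} {c} {c′} {q} {q′} {f} {g} F H Num Den eq r
  with N₁ , f≤g ← ratio-≤ F H r | N₂ , g≤f ← ratio-≤ H F r
  = N₁ ⊔ N₂ , λ m N≤m →
    (*-cancelˡ-≤ (q * c′) (begin
      q * c′ * (r * (f m * Den))         ≡⟨ e₁ (q * c′) r (f m) Den ⟩
      Den * (r * (q * c′ * f m))         ≤⟨ *-monoʳ-≤ Den (f≤g m (m⊔n≤o⇒m≤o N₁ N₂ N≤m)) ⟩
      Den * (suc r * (q′ * c * g m))     ≡⟨ e₂ Den (suc r) (q′ * c) (g m) ⟩
      suc r * (q′ * c * Den * g m)       ≡⟨ cong (λ x → suc r * (x * g m)) eq ⟩
      suc r * (q * c′ * Num * g m)       ≡⟨ e₃ (suc r) (q * c′) Num (g m) ⟩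
      q * c′ * (suc r * (Num * g m))     ∎)) ,
    (*-cancelˡ-≤ (q * c′) (begin
      q * c′ * (r * (Num * g m))         ≡⟨ e₃ r (q * c′) Num (g m) ⟨
      r * (q * c′ * Num * g m)           ≡⟨ cong (λ x → r * (x * g m)) eq ⟨
      r * (q′ * c * Den * g m)           ≡⟨ e₂ Den r (q′ * c) (g m) ⟨
      Den * (r * (q′ * c * g m))         ≤⟨ *-monoʳ-≤ Den (g≤f m (m⊔n≤o⇒n≤o N₁ N₂ N≤m)) ⟩
      Den * (suc r * (q * c′ * f m))     ≡⟨ e₁ (q * c′) (suc r) (f m) Den ⟨
      q * c′ * (suc r * (f m * Den))     ∎))
  where
  open ≤-Reasoning
  e₁ : ∀ q r s d → q * (r * (s * d)) ≡ d * (r * (q * s))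
  e₁ = solve-∀
  e₂ : ∀ d r q t → d * (r * (q * t)) ≡ r * (q * d * t)
  e₂ = solve-∀
  e₃ : ∀ r q n t → r * (q * n * t) ≡ q * (r * (n * t))
  e₃ = solve-∀

-- Growth of the number of stars and of the sample size

binomialSum : (ℕ → ℕ → ℕ) → ℕ → ℕ → ℕ
binomialSum B ℓ = Diag λ i j → (B i j ∸ 1) C ℓ

module _ (B : ℕ → ℕ → ℕ) (2B≡ : ∀ i j → 2 * B i j ≡ suc i * suc j * (2 + (i + j))) where

  private
    ^-distribʳ-*₃ : ∀ a b c ℓ → (a * (b * c)) ^ ℓ ≡ a ^ ℓ * (b ^ ℓ * c ^ ℓ)
    ^-distribʳ-*₃ a b c ℓ = trans (^-distribʳ-* a (b * c) ℓ) (cong (a ^ ℓ *_) (^-distribʳ-* b c ℓ))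

    -- Passing from `B` to `B ∸ 1` and from a binomial coefficient to a power loses `suc ℓ`. Moving
    -- both arguments up by `ℓ` gains at least that much.
    lowerB : ∀ ℓ i j → (i + j) ^ ℓ * (i ^ ℓ * j ^ ℓ) ≤ 2 ^ ℓ * ℓ ! * ((B (ℓ + i) (ℓ + j) ∸ 1) C ℓ)
    lowerB ℓ i j = begin
      (i + j) ^ ℓ * (i ^ ℓ * j ^ ℓ)     ≡⟨ ^-distribʳ-*₃ (i + j) i j ℓ ⟨
      ((i + j) * (i * j)) ^ ℓ           ≤⟨ ^-monoˡ-≤ ℓ small ⟩
      (2 * b) ^ ℓ                       ≡⟨ ^-distribʳ-* 2 b ℓ ⟩
      2 ^ ℓ * b ^ ℓ                     ≤⟨ *-monoʳ-≤ (2 ^ ℓ) (n^k≤k!*[k+n]Ck b ℓ) ⟩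
      2 ^ ℓ * (ℓ ! * ((ℓ + b) C ℓ))     ≡⟨ *-assoc (2 ^ ℓ) (ℓ !) _ ⟨
      2 ^ ℓ * ℓ ! * ((ℓ + b) C ℓ)       ≡⟨ cong (λ x → 2 ^ ℓ * ℓ ! * ((x ∸ 1) C ℓ)) B≡ ⟩
      2 ^ ℓ * ℓ ! * ((B (ℓ + i) (ℓ + j) ∸ 1) C ℓ) ∎
      where
      open ≤-Reasoning
      -- Chosen so that `B (ℓ + i) (ℓ + j) ∸ 1` is `ℓ + b`, the upper index in `n^k≤k!*[k+n]Ck`.
      b = B (ℓ + i) (ℓ + j) ∸ suc ℓ

      -- The exact remainder in the expansion of the cubic; as a natural number expression it
      -- exhibits its own nonnegativity.
      extra = i * j * (2 + (ℓ + ℓ)) + (suc ℓ * (i + j) * (i + j)) + suc ℓ * (i + j) * (2 + (ℓ + ℓ))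
        + suc ℓ * suc ℓ * (i + j) + (ℓ * ℓ + (ℓ + ℓ)) * (2 * suc ℓ)

      expand : ∀ ℓ i j → (i + j) * (i * j) + 2 * suc ℓ +
        (i * j * (2 + (ℓ + ℓ)) + (suc ℓ * (i + j) * (i + j)) + suc ℓ * (i + j) * (2 + (ℓ + ℓ))
          + suc ℓ * suc ℓ * (i + j) + (ℓ * ℓ + (ℓ + ℓ)) * (2 * suc ℓ))
        ≡ suc (ℓ + i) * suc (ℓ + j) * (2 + (ℓ + i + (ℓ + j)))
      expand = solve-∀

      large : (i + j) * (i * j) + 2 * suc ℓ ≤ 2 * B (ℓ + i) (ℓ + j)
      large = begin
        (i + j) * (i * j) + 2 * suc ℓ           ≤⟨ m≤m+n _ extra ⟩
        (i + j) * (i * j) + 2 * suc ℓ + extra   ≡⟨ expand ℓ i j ⟩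
        suc (ℓ + i) * suc (ℓ + j) * (2 + (ℓ + i + (ℓ + j))) ≡⟨ 2B≡ (ℓ + i) (ℓ + j) ⟨
        2 * B (ℓ + i) (ℓ + j)                   ∎

      B≡ : suc ℓ + b ≡ B (ℓ + i) (ℓ + j)
      B≡ = m+[n∸m]≡n {suc ℓ} (*-cancelˡ-≤ {suc ℓ} 2 (m+n≤o⇒n≤o ((i + j) * (i * j)) large))

      small : (i + j) * (i * j) ≤ 2 * b
      small = +-cancelʳ-≤ (2 * suc ℓ) _ _ (begin
        (i + j) * (i * j) + 2 * suc ℓ  ≤⟨ large ⟩
        2 * B (ℓ + i) (ℓ + j)          ≡⟨ cong (2 *_) B≡ ⟨
        2 * (suc ℓ + b)                ≡⟨ *-distribˡ-+ 2 (suc ℓ) b ⟩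
        2 * suc ℓ + 2 * b              ≡⟨ +-comm (2 * suc ℓ) (2 * b) ⟩
        2 * b + 2 * suc ℓ              ∎)

    upperB : ∀ ℓ i j → 2 ^ ℓ * ℓ ! * ((B i j ∸ 1) C ℓ) ≤ (2 + (i + j)) ^ ℓ * (suc i ^ ℓ * suc j ^ ℓ)
    upperB ℓ i j = begin
      2 ^ ℓ * ℓ ! * ((B i j ∸ 1) C ℓ)     ≡⟨ *-assoc (2 ^ ℓ) (ℓ !) _ ⟩
      2 ^ ℓ * (ℓ ! * ((B i j ∸ 1) C ℓ))   ≤⟨ *-monoʳ-≤ (2 ^ ℓ) (k!*nCk≤n^k (B i j ∸ 1) ℓ) ⟩
      2 ^ ℓ * (B i j ∸ 1) ^ ℓ             ≤⟨ *-monoʳ-≤ (2 ^ ℓ) (^-monoˡ-≤ ℓ (m∸n≤m (B i j) 1)) ⟩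
      2 ^ ℓ * B i j ^ ℓ                   ≡⟨ ^-distribʳ-* 2 (B i j) ℓ ⟨
      (2 * B i j) ^ ℓ                     ≡⟨ cong (_^ ℓ) (trans (2B≡ i j) (*-comm (suc i * suc j) _)) ⟩
      ((2 + (i + j)) * (suc i * suc j)) ^ ℓ ≡⟨ ^-distribʳ-*₃ (2 + (i + j)) (suc i) (suc j) ℓ ⟩
      (2 + (i + j)) ^ ℓ * (suc i ^ ℓ * suc j ^ ℓ) ∎
      where open ≤-Reasoning

  -- The constants have the shape in which product and convolution deliver them.
  binomialSum-leadingTerm : ∀ ℓ → LeadingTerm (ℓ + suc (ℓ + ℓ)) (1 * (1 * 1 * (ℓ ! * ℓ !)))
                                    (1 * (1 * 1 * suc (ℓ + ℓ) !) * (2 ^ ℓ * ℓ !)) (binomialSum B ℓ)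
  binomialSum-leadingTerm ℓ = transfer h (2 ^ ℓ * ℓ !) (ℓ + ℓ) 2
    (product (power ℓ) (convolution (power ℓ) (power ℓ))) h≤G G≤h
    where
    open ≤-Reasoning
    h : ℕ → ℕ
    -- The factor `(i + j) ^ ℓ` is constant on the antidiagonal and leaves the sum; what stays
    -- inside is a convolution of powers.
    h s = s ^ ℓ * ((_^ ℓ) ⋆ (_^ ℓ)) s

    h≤G : ∀ n → h n ≤ 2 ^ ℓ * ℓ ! * binomialSum B ℓ (ℓ + ℓ + n)
    h≤G n = begin
      n ^ ℓ * Diag (λ i j → i ^ ℓ * j ^ ℓ) n ≡⟨ Diag-*ˡ (n ^ ℓ) _ n ⟨
      Diag (λ i j → n ^ ℓ * (i ^ ℓ * j ^ ℓ)) n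
        ≤⟨ Diag-mono n (λ { i j refl → lowerB ℓ i j }) ⟩
      Diag (λ i j → 2 ^ ℓ * ℓ ! * ((B (ℓ + i) (ℓ + j) ∸ 1) C ℓ)) n ≡⟨ Diag-*ˡ (2 ^ ℓ * ℓ !) _ n ⟩
      2 ^ ℓ * ℓ ! * Diag (λ i j → ((B (ℓ + i) (ℓ + j) ∸ 1) C ℓ)) n
        ≤⟨ *-monoʳ-≤ (2 ^ ℓ * ℓ !) (Diag-shift (λ i j → (B i j ∸ 1) C ℓ) ℓ ℓ n) ⟩
      2 ^ ℓ * ℓ ! * binomialSum B ℓ (ℓ + ℓ + n) ∎

    G≤h : ∀ n → 2 ^ ℓ * ℓ ! * binomialSum B ℓ n ≤ h (2 + n)
    G≤h n = begin
      2 ^ ℓ * ℓ ! * binomialSum B ℓ n ≡⟨ Diag-*ˡ (2 ^ ℓ * ℓ !) _ n ⟨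
      Diag (λ i j → 2 ^ ℓ * ℓ ! * ((B i j ∸ 1) C ℓ)) n ≤⟨ Diag-mono n (λ { i j refl → upperB ℓ i j }) ⟩
      Diag (λ i j → (2 + n) ^ ℓ * (suc i ^ ℓ * suc j ^ ℓ)) n ≡⟨ Diag-*ˡ ((2 + n) ^ ℓ) _ n ⟩
      (2 + n) ^ ℓ * Diag (λ i j → suc i ^ ℓ * suc j ^ ℓ) n
        ≤⟨ *-monoʳ-≤ ((2 + n) ^ ℓ) (Diag-shift (λ i j → i ^ ℓ * j ^ ℓ) 1 1 n) ⟩
      h (2 + n) ∎

-- These are the numbers C(m+3, 3), that is `𝔟 n` for n = m + 2: there are s + 1 pairs
-- `(x - 1 , y - 1)` of sum s and t + 1 pairs `(z , w)` of sum t, where s + t = m.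
tetrahedral : ℕ → ℕ
tetrahedral = suc ⋆ suc

tetrahedral-leadingTerm : LeadingTerm 3 1 6 tetrahedral
tetrahedral-leadingTerm = convolution successor successor

tetrahedral-< : ∀ n → tetrahedral n < tetrahedral (suc n)
tetrahedral-< n = begin-strict
  Diag (λ i j → suc i * suc j) n
    ≤⟨ Diag-mono n (λ i j _ → *-monoˡ-≤ (suc j) (n≤1+n (suc i))) ⟩
  Diag (λ i j → suc (suc i) * suc j) n
    <⟨ m<n+m _ z<s ⟩
  tetrahedral (suc n) ∎
  where open ≤-Reasoning

[a+b]Ca*a!b! : ∀ a b → ((a + b) C a) * (a ! * b !) ≡ (a + b) !
[a+b]Ca*a!b! zero    b = trans (*-identityˡ _) (*-identityˡ _)
[a+b]Ca*a!b! (suc a) b = begin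
  (suc (a + b) C suc a) * (suc a ! * b !)   ≡⟨ regroup (suc (a + b) C suc a) (suc a !) (b !) ⟩
  suc a ! * (suc (a + b) C suc a) * b !     ≡⟨ cong (_* b !) ([1+k]!*C (a + b) a) ⟩
  suc (a + b) * (a ! * ((a + b) C a)) * b ! ≡⟨ regroup′ (suc (a + b)) (a !) ((a + b) C a) (b !) ⟩
  suc (a + b) * (((a + b) C a) * (a ! * b !)) ≡⟨ cong (suc (a + b) *_) ([a+b]Ca*a!b! a b) ⟩
  suc (a + b) ! ∎
  where
  open ≡-Reasoning
  regroup : ∀ c a b → c * (a * b) ≡ a * c * b
  regroup = solve-∀
  regroup′ : ∀ s a c b → s * (a * c) * b ≡ s * (c * (a * b))
  regroup′ = solve-∀

numerator denominator : ℕ → ℕ → ℕ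
numerator k ℓ   = 2 * 3 ^ (k + ℓ)
denominator k ℓ = (k + ℓ + 1) * ((3 * (k + ℓ) + 2) C (3 * k + 1))
         * (2 * k + 1) * ((2 * k) C k) * (2 * ℓ + 1) * ((2 * ℓ) C ℓ)

-- The left factor collects the sets below a centre, governed by `x` and `y`, and the right factor
-- those above it, governed by `z` and `w`. One function `B` serves both.
starCount : (ℕ → ℕ → ℕ) → ℕ → ℕ → ℕ → ℕ
starCount B k ℓ = binomialSum B ℓ ⋆ binomialSum B k

sampleSize : ℕ → ℕ → ℕ → ℕ
sampleSize k ℓ m = (tetrahedral m C k) * (tetrahedral m * (tetrahedral m C ℓ))

module _ (B : ℕ → ℕ → ℕ) (2B≡ : ∀ i j → 2 * B i j ≡ suc i * suc j * (2 + (i + j))) (k ℓ : ℕ) where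

  private
    -- The constants are kept exactly as `convolution`, `product` and `binomial` compute them, so
    -- that those results apply as they stand; all simplification is left to `constants`.
    c₁ = 1 * (1 * 1 * (ℓ ! * ℓ !)) * (1 * (1 * 1 * (k ! * k !)))
         * ((ℓ + suc (ℓ + ℓ)) ! * (k + suc (k + k)) !)
    q₁ = 1 * (1 * 1 * suc (ℓ + ℓ) !) * (2 ^ ℓ * ℓ !) * (1 * (1 * 1 * suc (k + k) !) * (2 ^ k * k !))
         * suc (ℓ + suc (ℓ + ℓ) + (k + suc (k + k))) !
    c₂ = 1 ^ k * (1 * 1 ^ ℓ)
    q₂ = 6 ^ k * k ! * (6 * (6 ^ ℓ * ℓ !))

    6^ : ∀ n → 6 ^ n ≡ 2 ^ n * 3 ^ n
    6^ n = ^-distribʳ-* 2 3 n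

    2* : ∀ n → n + n ≡ 2 * n
    2* = solve-∀

    3* : ∀ n → n + suc (n + n) ≡ 3 * n + 1
    3* = solve-∀

    central : ∀ n → (n + n) ! ≡ ((2 * n) C n) * (n ! * n !)
    central n = trans (sym ([a+b]Ca*a!b! n n)) (cong (λ x → (x C n) * (n ! * n !)) (2* n))

    X = ℓ + suc (ℓ + ℓ) + (k + suc (k + k))

    X! : X ! ≡ ((3 * (k + ℓ) + 2) C (3 * k + 1)) * ((k + suc (k + k)) ! * (ℓ + suc (ℓ + ℓ)) !)
    X! = trans (cong _! (+-comm (ℓ + suc (ℓ + ℓ)) _)) (trans (sym ([a+b]Ca*a!b! (k + suc (k + k)) (ℓ + suc (ℓ + ℓ))))
      (cong₂ (λ x y → (x C y) * ((k + suc (k + k)) ! * (ℓ + suc (ℓ + ℓ)) !)) (total k ℓ) (3* k)))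
      where
      total : ∀ k ℓ → k + suc (k + k) + (ℓ + suc (ℓ + ℓ)) ≡ 3 * (k + ℓ) + 2
      total = solve-∀

    c₁≡ : c₁ ≡ (ℓ ! * ℓ !) * (k ! * k !) * ((ℓ + suc (ℓ + ℓ)) ! * (k + suc (k + k)) !)
    c₁≡ = cong₂ (λ x y → x * y * ((ℓ + suc (ℓ + ℓ)) ! * (k + suc (k + k)) !)) (one (ℓ ! * ℓ !)) (one (k ! * k !))
      where
      one : ∀ n → 1 * (1 * 1 * n) ≡ n
      one = solve-∀

    q₁≡ : q₁ ≡ (suc (ℓ + ℓ) * (((2 * ℓ) C ℓ) * (ℓ ! * ℓ !))) * (2 ^ ℓ * ℓ !)
               * ((suc (k + k) * (((2 * k) C k) * (k ! * k !))) * (2 ^ k * k !))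
               * (suc X * (((3 * (k + ℓ) + 2) C (3 * k + 1)) * ((k + suc (k + k)) ! * (ℓ + suc (ℓ + ℓ)) !)))
    q₁≡ = cong₂ _*_ (cong₂ (λ x y → x * (2 ^ ℓ * ℓ !) * (y * (2 ^ k * k !))) (odd ℓ) (odd k)) (cong (suc X *_) X!)
      where
      one : ∀ n → 1 * (1 * 1 * n) ≡ n
      one = solve-∀
      odd : ∀ n → 1 * (1 * 1 * suc (n + n) !) ≡ suc (n + n) * (((2 * n) C n) * (n ! * n !))
      odd n = trans (one (suc (n + n) !)) (cong (suc (n + n) *_) (central n))

    -- Once `6 ^ n` is split as `2 ^ n * 3 ^ n` and the large factorials are written through
    -- binomial coefficients, only a polynomial identity in opaque atoms is left. In it `suc X` is 3
    -- (k + ℓ + 1), which turns the 6 of the sample size into the 2 of the numerator.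
    constants : q₂ * c₁ * denominator k ℓ ≡ q₁ * c₂ * numerator k ℓ
    constants = begin
      q₂ * c₁ * denominator k ℓ
        ≡⟨ cong₂ (λ x y → x * y * denominator k ℓ)
             (cong₂ (λ x y → x * k ! * (6 * (y * ℓ !))) (6^ k) (6^ ℓ)) c₁≡ ⟩
      2 ^ k * 3 ^ k * k ! * (6 * (2 ^ ℓ * 3 ^ ℓ * ℓ !))
        * ((ℓ ! * ℓ !) * (k ! * k !) * ((ℓ + suc (ℓ + ℓ)) ! * (k + suc (k + k)) !)) * denominator k ℓ
        ≡⟨ identity k ℓ (2 ^ k) (2 ^ ℓ) (3 ^ k) (3 ^ ℓ) (k !) (ℓ !) ((k + suc (k + k)) !) ((ℓ + suc (ℓ + ℓ)) !)
             ((3 * (k + ℓ) + 2) C (3 * k + 1)) ((2 * k) C k) ((2 * ℓ) C ℓ) ⟩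
      (suc (ℓ + ℓ) * (((2 * ℓ) C ℓ) * (ℓ ! * ℓ !))) * (2 ^ ℓ * ℓ !)
               * ((suc (k + k) * (((2 * k) C k) * (k ! * k !))) * (2 ^ k * k !))
               * (suc X * (((3 * (k + ℓ) + 2) C (3 * k + 1)) * ((k + suc (k + k)) ! * (ℓ + suc (ℓ + ℓ)) !)))
        * 1 * (2 * (3 ^ k * 3 ^ ℓ))
        ≡⟨ cong₂ _*_ (cong₂ _*_ (sym q₁≡) (sym (cong₂ (λ x y → x * (1 * y)) (^-zeroˡ k) (^-zeroˡ ℓ))))
                     (cong (2 *_) (sym (^-distribˡ-+-* 3 k ℓ))) ⟩
      q₁ * c₂ * numerator k ℓ ∎
      where
      open ≡-Reasoning
      identity : ∀ k ℓ a b c d g f s p C₁ C₂ C₃ →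
        a * c * g * (6 * (b * d * f)) * ((f * f) * (g * g) * (p * s))
          * ((k + ℓ + 1) * C₁ * (2 * k + 1) * C₂ * (2 * ℓ + 1) * C₃)
        ≡ (suc (ℓ + ℓ) * (C₃ * (f * f))) * (b * f) * ((suc (k + k) * (C₂ * (g * g))) * (a * g))
          * (suc (ℓ + suc (ℓ + ℓ) + (k + suc (k + k))) * (C₁ * (s * p))) * 1 * (2 * (c * d))
      identity = solve-∀

    D  = suc (ℓ + suc (ℓ + ℓ) + (k + suc (k + k)))

    starCount-leadingTerm : LeadingTerm D c₁ q₁ (starCount B k ℓ)
    starCount-leadingTerm = convolution (binomialSum-leadingTerm B 2B≡ ℓ) (binomialSum-leadingTerm B 2B≡ k)

    sampleSize-leadingTerm : LeadingTerm D c₂ q₂ (sampleSize k ℓ)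
    sampleSize-leadingTerm = subst (λ d → LeadingTerm d c₂ q₂ (sampleSize k ℓ)) (degree k ℓ)
      (product (binomial k tetrahedral-leadingTerm tetrahedral-<)
        (product tetrahedral-leadingTerm (binomial ℓ tetrahedral-leadingTerm tetrahedral-<)))
      where
      degree : ∀ k ℓ → 3 * k + (3 + 3 * ℓ) ≡ suc (ℓ + suc (ℓ + ℓ) + (k + suc (k + k)))
      degree = solve-∀

    q₁c₂-nonZero : NonZero (q₁ * c₂)
    q₁c₂-nonZero = m*n≢0 q₁ c₂ {{m*n≢0 _ _ {{m*n≢0 _ _ {{block ℓ}} {{block k}}}} {{D !≢0}}}}
      {{m*n≢0 _ _ {{m^n≢0 1 k}} {{m*n≢0 1 _ {{_}} {{m^n≢0 1 ℓ}}}}}}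
      where
      block : ∀ n → NonZero (1 * (1 * 1 * suc (n + n) !) * (2 ^ n * n !))
      block n = m*n≢0 _ _ {{m*n≢0 1 _ {{_}} {{m*n≢0 1 _ {{_}} {{suc (n + n) !≢0}}}}}}
                          {{m*n≢0 _ _ {{m^n≢0 2 n}} {{n !≢0}}}}

  starCount~ : ∀ r → ∃ λ N → ∀ m → N ≤ m →
    r * (starCount B k ℓ m * denominator k ℓ) ≤ suc r * (numerator k ℓ * sampleSize k ℓ m) ×
    r * (numerator k ℓ * sampleSize k ℓ m) ≤ suc r * (starCount B k ℓ m * denominator k ℓ)
  starCount~ = ratio-limit starCount-leadingTerm sampleSize-leadingTerm
    (numerator k ℓ) (denominator k ℓ) {{q₁c₂-nonZero}} constants

-- Passing to the rationals

C-pos : ∀ {n k} → k ≤ n → 0 < n C k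
C-pos {k = k} k≤n = ≤-trans (≤-reflexive (sym (nCn≡1 k))) (C-monoˡ-≤ k k≤n)

denominator-pos : ∀ k ℓ → 0 < denominator k ℓ
denominator-pos k ℓ =
  *-mono-≤ (*-mono-≤ (*-mono-≤ (*-mono-≤ (*-mono-≤ (m≤n+m 1 (k + ℓ)) (C-pos 3k+1≤))
    (m≤n+m 1 (2 * k))) (C-pos {2 * k} {k} (m≤m+n k _))) (m≤n+m 1 (2 * ℓ))) (C-pos {2 * ℓ} {ℓ} (m≤m+n ℓ _))
  where
  3k+1≤ : 3 * k + 1 ≤ 3 * (k + ℓ) + 2
  3k+1≤ = +-mono-≤ (*-monoʳ-≤ 3 (m≤m+n k ℓ)) (s≤s z≤n)

numerator-pos : ∀ k ℓ → 0 < numerator k ℓ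
numerator-pos k ℓ = *-mono-≤ (s≤s {n = 1} z≤n) (m^n>0 3 (k + ℓ))

tetrahedral-≥ : ∀ n → n < tetrahedral n
tetrahedral-≥ zero    = z<s
tetrahedral-≥ (suc n) = <-≤-trans (s<s (tetrahedral-≥ n)) (tetrahedral-< n)

sampleSize-pos : ∀ k ℓ m → k ⊔ ℓ ≤ m → 0 < sampleSize k ℓ m
sampleSize-pos k ℓ m k⊔ℓ≤m = *-mono-≤ (C-pos (≤-trans (m⊔n≤o⇒m≤o k ℓ k⊔ℓ≤m) m≤))
  (*-mono-≤ (≤-<-trans z≤n (tetrahedral-≥ m)) (C-pos (≤-trans (m⊔n≤o⇒n≤o k ℓ k⊔ℓ≤m) m≤)))
  where m≤ = <⇒≤ (tetrahedral-≥ m)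

-- Comparisons of fractions are made on unnormalised representatives, where they are
-- cross-multiplied statements about integers; normalisation by the gcd would block computation.
toℚᵘ-/₀ : ∀ a b → ℚ.toℚᵘ (fromℕ a /₀ suc b) ℚᵘ.≃ mkℚᵘ (+ a) b
toℚᵘ-/₀ a b = ℚᵘ.≃-trans (ℚ.toℚᵘ-homo-* (fromℕ a) (+ 1 ℚ./ suc b)) (ℚᵘ.≃-trans
  (ℚᵘ.*-cong (ℚ.toℚᵘ-fromℚᵘ (mkℚᵘ (+ a) 0)) (ℚ.toℚᵘ-fromℚᵘ (mkℚᵘ (+ 1) b)))
  (*≡* (cong₂ ℤ._*_ (ℤ.*-identityʳ (+ a)) (cong (λ x → + suc x) (sym (+-identityʳ b))))))

/₀-nonZero : ∀ {a b} → 0 < a → 0 < b → ℚ.NonZero (fromℕ a /₀ b)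
/₀-nonZero {suc a} {suc b} _ _ = ℚ.≢-nonZero λ eq →
  numerator≢0 (ℚᵘ.≃-trans (ℚᵘ.≃-sym (toℚᵘ-/₀ (suc a) b)) (ℚᵘ.≃-reflexive (cong ℚ.toℚᵘ eq)))
  where
  numerator≢0 : mkℚᵘ (+ suc a) b ℚᵘ.≃ ℚ.toℚᵘ 0ℚ → ⊥
  numerator≢0 (*≡* ())

/₀-÷-/₀ : ∀ s t u d → 0 < t → 0 < u → 0 < d → .{{_ : ℚ.NonZero (fromℕ u /₀ d)}} →
          (fromℕ s /₀ t) ÷ (fromℕ u /₀ d) ≡ fromℕ (s * d) /₀ (u * t)
/₀-÷-/₀ s (suc t) (suc u) (suc d) _ _ _ = begin
  x ÷ g              ≡⟨ cong (_÷ g) x≡yg ⟩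
  y ℚ.* g ÷ g        ≡⟨ ℚ.*-assoc y g (ℚ.1/ g) ⟩
  y ℚ.* (g ℚ.* ℚ.1/ g) ≡⟨ cong (y ℚ.*_) (ℚ.*-inverseʳ g) ⟩
  y ℚ.* 1ℚ           ≡⟨ ℚ.*-identityʳ y ⟩
  y                  ∎
  where
  open ≡-Reasoning
  x = fromℕ s /₀ suc t
  g = fromℕ (suc u) /₀ suc d
  y = fromℕ (s * suc d) /₀ (suc u * suc t)

  cross : ∀ s t u d → s * ((u * t) * d) ≡ s * d * u * t
  cross = solve-∀

  x≡yg : x ≡ y ℚ.* g
  x≡yg = ℚ.toℚᵘ-injective (ℚᵘ.≃-trans (toℚᵘ-/₀ s t) (ℚᵘ.≃-sym (ℚᵘ.≃-trans (ℚ.toℚᵘ-homo-* y g) (ℚᵘ.≃-trans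
    (ℚᵘ.*-cong (toℚᵘ-/₀ (s * suc d) (t + u * suc t)) (toℚᵘ-/₀ (suc u) d))
    (ℚᵘ.≃-sym (*≡* (begin
      + s ℤ.* + ((suc u * suc t) * suc d)        ≡⟨ ℤ.pos-* s _ ⟨
      + (s * ((suc u * suc t) * suc d))          ≡⟨ cong +_ (cross s (suc t) (suc u) (suc d)) ⟩
      + (s * suc d * suc u * suc t)              ≡⟨ ℤ.pos-* (s * suc d * suc u) (suc t) ⟩
      + (s * suc d * suc u) ℤ.* + suc t          ≡⟨ cong (ℤ._* + suc t) (ℤ.pos-* (s * suc d) (suc u)) ⟩
      + (s * suc d) ℤ.* + suc u ℤ.* + suc t      ∎)))))))

∣-∣<-criterion : ∀ {p q δ : ℚ} → p ℚ.< δ ℚ.+ q → q ℚ.< δ ℚ.+ p → ∣ p - q ∣ ℚ.< δ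
∣-∣<-criterion {p} {q} {δ} p< q< with ℚ.∣p∣≡p∨∣p∣≡-p (p - q)
... | inj₁ eq rewrite eq = cancel p q p<
  where
  cancel : ∀ p q → p ℚ.< δ ℚ.+ q → p - q ℚ.< δ
  cancel p q p< = subst (p - q ℚ.<_)
    (trans (ℚ.+-assoc δ q (ℚ.- q)) (trans (cong (δ ℚ.+_) (ℚ.+-inverseʳ q)) (ℚ.+-identityʳ δ)))
    (ℚ.+-monoˡ-< (ℚ.- q) p<)
... | inj₂ eq rewrite eq = subst (ℚ._< δ)
    (trans (ℚ.+-comm q (ℚ.- p)) (sym (trans (ℚ.neg-distrib-+ p (ℚ.- q)) (cong (ℚ.- p ℚ.+_) (⁻¹-involutive q)))))
  (subst (q - p ℚ.<_)
    (trans (ℚ.+-assoc δ p (ℚ.- p)) (trans (cong (δ ℚ.+_) (ℚ.+-inverseʳ p)) (ℚ.+-identityʳ δ)))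
    (ℚ.+-monoˡ-< (ℚ.- p) q<))

private
  -- From a/b ≤ 1 + 1/(d+2) follows a/b < 1 + 1/(d+1). The strictness is the unit in (d+2)² =
  -- (d+1)(d+3) + 1.
  cross-below : ∀ d a b → 0 < b → (2 + d) * a ≤ (3 + d) * b → a * suc d < (2 + d) * b
  cross-below d a b 0<b a≤b = *-cancelˡ-< (2 + d) _ _ (begin-strict
    (2 + d) * (a * suc d)            ≡⟨ e₁ d a ⟩
    suc d * ((2 + d) * a)            ≤⟨ *-monoʳ-≤ (suc d) a≤b ⟩
    suc d * ((3 + d) * b)            <⟨ m<n+m _ 0<b ⟩
    b + suc d * ((3 + d) * b)        ≡⟨ e₂ d b ⟩
    (2 + d) * ((2 + d) * b)          ∎)
    where
    open ≤-Reasoning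
    e₁ : ∀ d a → (2 + d) * (a * suc d) ≡ suc d * ((2 + d) * a)
    e₁ = solve-∀
    e₂ : ∀ d b → b + suc d * ((3 + d) * b) ≡ (2 + d) * ((2 + d) * b)
    e₂ = solve-∀

  -- The bound a/b ≥ (d+2)/(d+3) exceeds 1 - 1/(d+1) = d/(d+1), since (d+1)(d+2) = d(d+3) + 2.
  cross-above : ∀ d a b → 0 < b → (2 + d) * b ≤ (3 + d) * a → d * b < a * suc d
  cross-above d a b 0<b b≤a = *-cancelˡ-< (3 + d) _ _ (begin-strict
    (3 + d) * (d * b)                <⟨ m<n+m _ 0<b ⟩
    b + (3 + d) * (d * b)            ≤⟨ m≤n+m _ b ⟩
    b + (b + (3 + d) * (d * b))      ≡⟨ e₁ d b ⟩
    suc d * ((2 + d) * b)            ≤⟨ *-monoʳ-≤ (suc d) b≤a ⟩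
    suc d * ((3 + d) * a)            ≡⟨ e₂ d a ⟩
    (3 + d) * (a * suc d)            ∎)
    where
    open ≤-Reasoning
    e₁ : ∀ d b → b + (b + (3 + d) * (d * b)) ≡ suc d * ((2 + d) * b)
    e₁ = solve-∀
    e₂ : ∀ d a → suc d * ((3 + d) * a) ≡ (3 + d) * (a * suc d)
    e₂ = solve-∀

-- The tolerance δ = (p+1)/(d+1) is bounded below by 1/(d+1), which reduces both estimates to
-- `cross-below` and `cross-above`.
∣a/b-1∣<δ : ∀ δ p d a b → ℚ.toℚᵘ δ ≡ mkℚᵘ (+ suc p) d →
            0 < b → (2 + d) * a ≤ (3 + d) * b → (2 + d) * b ≤ (3 + d) * a →
            ∣ fromℕ a /₀ b - 1ℚ ∣ ℚ.< δ
∣a/b-1∣<δ δ p d zero    (suc b) eq _ _ b≤a with () ← ≤-trans b≤a (≤-reflexive (*-zeroʳ (3 + d)))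
∣a/b-1∣<δ δ p d (suc a) (suc b) eq 0<b a≤b b≤a = ∣-∣<-criterion
  (ℚ.toℚᵘ-cancel-< (ℚᵘ.<-respˡ-≃ (ℚᵘ.≃-sym (toℚᵘ-/₀ (suc a) b))
    (ℚᵘ.<-respʳ-≃ (ℚᵘ.≃-sym (ℚᵘ.≃-trans (ℚ.toℚᵘ-homo-+ δ 1ℚ) (ℚᵘ.+-congˡ δ₁ (ℚᵘ.≃-reflexive eq))))
      (ℚᵘ.*<* (ℤ.+<+ lhs)))))
  (ℚ.toℚᵘ-cancel-< (ℚᵘ.<-respʳ-≃ (ℚᵘ.≃-sym (ℚᵘ.≃-trans (ℚ.toℚᵘ-homo-+ δ (fromℕ (suc a) /₀ suc b))
        (ℚᵘ.+-cong (ℚᵘ.≃-reflexive eq) (toℚᵘ-/₀ (suc a) b))))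
      (ℚᵘ.*<* (ℤ.+<+ rhs))))
  where
  open ≤-Reasoning
  δ₁ = ℚ.toℚᵘ 1ℚ
  lhs : suc a * (suc d * 1) < (suc p * 1 + (suc d + 0)) * suc b
  lhs = begin-strict
    suc a * (suc d * 1)  ≡⟨ cong (suc a *_) (*-identityʳ (suc d)) ⟩
    suc a * suc d        <⟨ cross-below d (suc a) (suc b) 0<b a≤b ⟩
    (2 + d) * suc b      ≤⟨ *-monoˡ-≤ (suc b) (s≤s (≤-trans (m≤n+m (suc d) (p * 1))
                              (≤-reflexive (cong (_+_ (p * 1)) (sym (+-identityʳ (suc d))))))) ⟩
    (suc p * 1 + (suc d + 0)) * suc b ∎
  rhs : suc d * suc b + 0 < (suc p * suc b + suc a * suc d) * 1
  rhs = begin-strict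
    suc d * suc b + 0              ≡⟨ +-identityʳ _ ⟩
    suc b + d * suc b              <⟨ +-monoʳ-< (suc b) (cross-above d (suc a) (suc b) 0<b b≤a) ⟩
    suc b + suc a * suc d          ≤⟨ +-monoˡ-≤ (suc a * suc d) (m≤m+n (suc b) (p * suc b)) ⟩
    suc p * suc b + suc a * suc d  ≡⟨ *-identityʳ _ ⟨
    (suc p * suc b + suc a * suc d) * 1 ∎

positive-fraction : ∀ δ → 0ℚ ℚ.< δ → ∃₂ λ p d → ℚ.toℚᵘ δ ≡ mkℚᵘ (+ suc p) d
positive-fraction (mkℚ (+ suc p) d _) _ = p , d , refl
positive-fraction (mkℚ (+ zero) d _) (ℚ.*<* 0<0) = contradiction 0<0 (ℤ.<-irrefl refl)
positive-fraction (mkℚ -[1+ n ] d _) (ℚ.*<* ())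

~-intro : ∀ (f : ℕ → ℚ) (S T : ℕ → ℕ) Num Den N₀ →
          (∀ m → f (2 + m) ≡ fromℕ (S m) /₀ T m) → (∀ m → N₀ ≤ m → 0 < T m) → 0 < Num → 0 < Den →
          (∀ r → ∃ λ N → ∀ m → N ≤ m →
             r * (S m * Den) ≤ suc r * (Num * T m) × r * (Num * T m) ≤ suc r * (S m * Den)) →
          f ~ λ _ → fromℕ Num /₀ Den
~-intro f S T Num Den N₀ f≡ T>0 Num>0 Den>0 close δ 0<δ
  with p , d , δ≡ ← positive-fraction δ 0<δ
  -- The inner `2 + d` gives the relative error 1/(d+2), strictly smaller than δ. The outer `2`
  -- translates from `m` to `n = 2 + m`.
  with N , close ← close (2 + d) = 2 + (N ⊔ N₀) , bound
  where
  g = fromℕ Num /₀ Den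
  bound : ∀ n → 2 + (N ⊔ N₀) ≤ n → Σ (ℚ.NonZero g) λ g≢0 → ∣ (f n ÷ g) {{g≢0}} - 1ℚ ∣ ℚ.< δ
  bound (suc (suc m)) (s≤s (s≤s N≤m)) = g≢0 , subst (λ x → ∣ x - 1ℚ ∣ ℚ.< δ)
      (sym (trans (cong (λ x → (x ÷ g) {{g≢0}}) (f≡ m)) (/₀-÷-/₀ (S m) (T m) Num Den Tm>0 Num>0 Den>0 {{g≢0}})))
      (∣a/b-1∣<δ δ p d (S m * Den) (Num * T m) δ≡ (*-mono-≤ Num>0 Tm>0) (proj₁ bounds) (proj₂ bounds))
    where
    g≢0 : ℚ.NonZero g
    g≢0 = /₀-nonZero Num>0 Den>0
    Tm>0 = T>0 m (m⊔n≤o⇒n≤o N N₀ N≤m)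
    bounds = close m (m⊔n≤o⇒m≤o N N₀ N≤m)

-- Words as lists of naturals

range : ℕ → ℕ → List ℕ
range s zero    = []
range s (suc m) = s ∷ range (suc s) m

range-∷ʳ : ∀ s m xs → range s (suc m) ++ xs ≡ range s m ++ (s + m) ∷ xs
range-∷ʳ s zero    xs = cong (_∷ xs) (sym (+-identityʳ s))
range-∷ʳ s (suc m) xs = cong (s ∷_) (trans (range-∷ʳ (suc s) m xs)
  (cong (λ a → range (suc s) m ++ a ∷ xs) (sym (+-suc s m))))

length-range : ∀ s m → length (range s m) ≡ m
length-range s zero    = refl
length-range s (suc m) = cong suc (length-range (suc s) m)

All-range : ∀ {P : ℕ → Set} s m → (∀ {v} → s ≤ v → v < s + m → P v) → All P (range s m)
All-range s zero    p = []
All-range s (suc m) p = p ≤-refl (m<m+n s z<s) ∷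
  All-range (suc s) m λ s< v< → p (<⇒≤ s<) (<-≤-trans v< (≤-reflexive (sym (+-suc s m))))

-- The permutation 1⋯a (b+1)⋯c (a+1)⋯b (c+1)⋯n with a = z, b = z + y, c = z + y + x and n = z + y + x + w,
-- counting from 0.
perm : (x y z w : ℕ) → List ℕ
perm x y z w = range 0 z ++ range (z + y) x ++ range z y ++ range (z + y + x) w

length-perm : ∀ x y z w → length (perm x y z w) ≡ x + y + z + w
length-perm x y z w = begin
  length (perm x y z w)
    ≡⟨ trans (length-++ (range 0 z)) (cong (_+_ (length (range 0 z))) (trans (length-++ (range (z + y) x))
         (cong (_+_ (length (range (z + y) x))) (length-++ (range z y))))) ⟩
  length (range 0 z) + (length (range (z + y) x) + (length (range z y) + length (range (z + y + x) w)))
    ≡⟨ cong₂ _+_ (length-range 0 z) (cong₂ _+_ (length-range (z + y) x)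
         (cong₂ _+_ (length-range z y) (length-range (z + y + x) w))) ⟩
  z + (x + (y + w))  ≡⟨ arrange x y z w ⟩
  x + y + z + w      ∎
  where
  open ≡-Reasoning
  arrange : ∀ x y z w → z + (x + (y + w)) ≡ x + y + z + w
  arrange = solve-∀

perm-< : ∀ x y z w → All (_< x + y + z + w) (perm x y z w)
perm-< x y z w =
  All.++⁺ (All-range 0 z λ _ v< → <-≤-trans v< (subst (z ≤_) (arrange x y z w) (m≤m+n z _)))
  (All.++⁺ (All-range (z + y) x λ _ v< → <-≤-trans v< (subst (z + y + x ≤_) (arrange′ x y z w) (m≤m+n _ w)))
  (All.++⁺ (All-range z y λ _ v< → <-≤-trans v< (subst (z + y ≤_) (arrange″ x y z w) (m≤m+n _ _)))
  (All-range (z + y + x) w λ _ v< → <-≤-trans v< (≤-reflexive (arrange′ x y z w)))))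
  where
  arrange : ∀ x y z w → z + (x + y + w) ≡ x + y + z + w
  arrange = solve-∀
  arrange′ : ∀ x y z w → z + y + x + w ≡ x + y + z + w
  arrange′ = solve-∀
  arrange″ : ∀ x y z w → z + y + (x + w) ≡ x + y + z + w
  arrange″ = solve-∀

values : Vec (Fin n) m → List ℕ
values []      = []
values (a ∷ v) = toℕ a ∷ values v

values-injective : (u v : Vec (Fin n) m) → values u ≡ values v → u ≡ v
values-injective []      []      _  = refl
values-injective (a ∷ u) (b ∷ v) eq =
  cong₂ _∷_ (Fin.toℕ-injective (proj₁ (∷-injective eq))) (values-injective u v (proj₂ (∷-injective eq)))

-- Entries are reduced modulo n and missing ones are 0, which makes the map total.
fromValues : ∀ n m → List ℕ → Vec (Fin (suc n)) m
fromValues n zero    _        = []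
fromValues n (suc m) []       = Fin.zero ∷ fromValues n m []
fromValues n (suc m) (a ∷ as) = a mod suc n ∷ fromValues n m as

values-fromValues : ∀ n m {as} → All (_< suc n) as → length as ≡ m → values (fromValues n m as) ≡ as
values-fromValues n zero    []         refl = refl
values-fromValues n (suc m) (a< ∷ as<) refl =
  cong₂ _∷_ (trans (Fin.toℕ-fromℕ< _) (m<n⇒m%n≡m a<)) (values-fromValues n m as< refl)

-- Reductions of lists

infix 4 _↘_ _↘*_

-- Reductions without positions: the exchanged entries are exhibited by splitting the list, so that
-- work on the blocks of `perm` is mere concatenation.
data _↘_ : List ℕ → List ℕ → Set where
  exchange : ∀ {a b} as bs → b < a → a ∷ as ++ b ∷ bs ↘ b ∷ as ++ a ∷ bs
  skip : ∀ {a as bs} → as ↘ bs → a ∷ as ↘ a ∷ bs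

_↘*_ : List ℕ → List ℕ → Set
_↘*_ = Star _↘_

-- This is `_⟶_` with the length freed from the size of the alphabet, since the induction passes to
-- tails.
Reduct : Vec (Fin n) m → Vec (Fin n) m → Set
Reduct v v′ = ∃₂ λ i j → i Fin.< j × lookup v j Fin.< lookup v i ×
                         v′ ≡ (v [ i ]≔ lookup v j) [ j ]≔ lookup v i

private
  locate : ∀ (v : Vec (Fin n) m) as {b bs} → values v ≡ as ++ b ∷ bs →
           ∃ λ j → toℕ (lookup v j) ≡ b × ∀ c → values (v [ j ]≔ c) ≡ as ++ toℕ c ∷ bs
  locate (c ∷ v) []       eq = Fin.zero , proj₁ (∷-injective eq) , λ d → cong (toℕ d ∷_) (proj₂ (∷-injective eq))
  locate (c ∷ v) (a ∷ as) eq with j , v[j]≡b , upd ← locate v as (proj₂ (∷-injective eq)) =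
    Fin.suc j , v[j]≡b , λ d → cong₂ _∷_ (proj₁ (∷-injective eq)) (upd d)

↘⇒Reduct : ∀ (v : Vec (Fin n) m) {as bs} → values v ≡ as → as ↘ bs → ∃ λ v′ → values v′ ≡ bs × Reduct v v′
↘⇒Reduct (c ∷ v) eq (exchange {a} {b} as bs b<a) with j , v[j]≡b , upd ← locate v as (proj₂ (∷-injective eq)) =
  lookup v j ∷ (v [ j ]≔ c) ,
  cong₂ _∷_ v[j]≡b (trans (upd c) (cong (λ d → as ++ d ∷ bs) (proj₁ (∷-injective eq)))) ,
  Fin.zero , Fin.suc j , z<s , subst₂ _<_ (sym v[j]≡b) (sym (proj₁ (∷-injective eq))) b<a , refl
↘⇒Reduct (c ∷ v) eq (skip r) with v′ , eq′ , i , j , i<j , inv , refl ← ↘⇒Reduct v (proj₂ (∷-injective eq)) r =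
  c ∷ v′ , cong₂ _∷_ (proj₁ (∷-injective eq)) eq′ , Fin.suc i , Fin.suc j , s<s i<j , inv , refl

↘*⇒≤ᴮ : ∀ (σ π : Word n) {as bs} → values σ ≡ as → values π ≡ bs → as ↘* bs → π ≤ᴮ σ
↘*⇒≤ᴮ σ π σ≡ π≡ ε with refl ← values-injective σ π (trans σ≡ (sym π≡)) = ε
↘*⇒≤ᴮ σ π σ≡ π≡ (r ◅ rs) with σ′ , σ′≡ , red ← ↘⇒Reduct σ σ≡ r = red ◅ ↘*⇒≤ᴮ σ′ π σ′≡ π≡ rs

prefix : ∀ as {bs cs} → bs ↘* cs → as ++ bs ↘* as ++ cs
prefix []       rs = rs
prefix (a ∷ as) rs = gmap (a ∷_) skip (prefix as rs)

moveRight : ∀ {a as} bs → All (_< a) as → a ∷ as ++ bs ↘* as ++ a ∷ bs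
moveRight bs []                         = ε
moveRight {a} {b ∷ as} bs (b<a ∷ as<a) = exchange [] (as ++ bs) b<a ◅ gmap (b ∷_) skip (moveRight bs as<a)

moveLeft : ∀ {a as} bs → All (a <_) as → as ++ a ∷ bs ↘* a ∷ as ++ bs
moveLeft bs []                         = ε
moveLeft {a} {b ∷ as} bs (a<b ∷ a<as) = gmap (b ∷_) skip (moveLeft bs a<as) ◅◅ (exchange [] (as ++ bs) a<b ◅ ε)

-- The least value of the third block travels left through the second block and joins the first.
y-to-z : ∀ x y z w → perm x (suc y) z w ↘* perm x y (suc z) w
y-to-z x y z w = subst₂ _↘*_
  (cong (λ b → range 0 z ++ range b x ++ range z (suc y) ++ range (b + x) w) (sym (+-suc z y)))
  (sym (range-∷ʳ 0 z _))
  (prefix (range 0 z) (moveLeft _ (All-range (suc (z + y)) x λ b≤ _ → ≤-trans (s≤s (m≤m+n z y)) b≤)))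

-- The greatest value of the second block travels right through the third block and joins the
-- fourth.
x-to-w : ∀ x y z w → perm (suc x) y z w ↘* perm x y z (suc w)
x-to-w x y z w = subst (_↘* perm x y z (suc w))
  (cong (range 0 z ++_) (trans
    (sym (range-∷ʳ (z + y) x (range z y ++ range (suc (z + y + x)) w)))
    (cong (λ c → range (z + y) (suc x) ++ range z y ++ range c w) (sym (+-suc (z + y) x)))))
  (prefix (range 0 z) (prefix (range (z + y) x) (moveRight _
    (All-range z y λ _ v< → <-≤-trans v< (m≤m+n (z + y) x)))))

-- The heads of the second and third blocks are exchanged, so `z` joins the first block. The value
-- that replaces it exceeds the rest of the third block and travels right to the end of that block.
x-to-z : ∀ x y z w → perm (suc x) (suc y) z w ↘* perm x (suc y) (suc z) w
x-to-z x y z w = subst₂ _↘*_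
  (cong₂ (λ b c → range 0 z ++ range b (suc x) ++ range z (suc y) ++ range c w)
    (sym (+-suc z y)) (c≡ z y x))
  (sym (trans (range-∷ʳ 0 z _) (cong (λ b → range 0 z ++ z ∷ range b x ++ range (suc z) (suc y) ++ range (b + x) w)
    (cong suc (+-suc z y)))))
  (prefix (range 0 z) (exchange (range (2 + (z + y)) x) _ (s≤s (m≤m+n z y)) ◅
    gmap (z ∷_) skip (prefix (range (2 + (z + y)) x)
      (subst (suc (z + y) ∷ range (suc z) y ++ range (2 + (z + y) + x) w ↘*_)
        (sym (range-∷ʳ (suc z) y _))
        (moveRight _ (All-range (suc z) y λ _ v< → v<))))))
  where
  c≡ : ∀ z y x → 2 + (z + y) + x ≡ z + suc y + suc x
  c≡ = solve-∀

-- The last entries of the second and third blocks are exchanged, so the greater one joins the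
-- fourth block. The value that replaces it is below the rest of the second block and travels left
-- to the front of that block.
y-to-w : ∀ x y z w → perm (suc x) (suc y) z w ↘* perm (suc x) y z (suc w)
y-to-w x y z w = subst₂ _↘*_
  (cong (range 0 z ++_) (sym (begin
    range (z + suc y) (suc x) ++ range z (suc y) ++ range (z + suc y + suc x) w
      ≡⟨ cong₂ (λ b c → range b (suc x) ++ range z (suc y) ++ range c w) (+-suc z y) (c≡ z y x) ⟩
    range (suc (z + y)) (suc x) ++ range z (suc y) ++ range (2 + (z + y) + x) w
      ≡⟨ range-∷ʳ (suc (z + y)) x _ ⟩
    as ++ c ∷ range z (suc y) ++ range (suc c) w
      ≡⟨ cong (λ l → as ++ c ∷ l) (range-∷ʳ z y _) ⟩
    as ++ c ∷ range z y ++ b ∷ range (suc c) w ∎)))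
  (cong (λ d → range 0 z ++ b ∷ as ++ range z y ++ d ∷ range (suc d) w) (sym (+-suc (z + y) x)))
  (prefix (range 0 z) (prefix as (exchange (range z y) _ (s≤s (m≤m+n (z + y) x)) ◅ ε) ◅◅
    moveLeft _ (All-range (suc (z + y)) x λ b< _ → b<)))
  where
  open ≡-Reasoning
  b = z + y
  c = suc (z + y) + x
  as = range (suc (z + y)) x
  c≡ : ∀ z y x → z + suc y + suc x ≡ 2 + (z + y) + x
  c≡ = solve-∀

-- Here `p` and `r` are the losses of `x` and `y`, `u` and `v` the gains of `z` and `w`. The totals
-- agree, so losses and gains can be paired off, one cover per pair. The middle blocks never become
-- empty, as `x-to-z` and `y-to-w` require.
chain : ∀ p r u v i j k l → p + r ≡ u + v →
        perm (suc (p + i)) (suc (r + j)) k l ↘* perm (suc i) (suc j) (u + k) (v + l)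
chain zero    zero    zero    zero    i j k l _  = ε
chain (suc p) r       (suc u) v       i j k l eq = x-to-z (suc (p + i)) (r + j) k l ◅◅
  subst (λ k′ → perm (suc (p + i)) (suc (r + j)) (suc k) l ↘* perm (suc i) (suc j) k′ (v + l)) (+-suc u k)
    (chain p r u v i j (suc k) l (suc-injective eq))
chain (suc p) r       zero    (suc v) i j k l eq = x-to-w (suc (p + i)) (suc (r + j)) k l ◅◅
  subst (λ l′ → perm (suc (p + i)) (suc (r + j)) k (suc l) ↘* perm (suc i) (suc j) k l′) (+-suc v l)
    (chain p r zero v i j k (suc l) (suc-injective eq))
chain zero    (suc r) (suc u) v       i j k l eq = y-to-z (suc i) (suc (r + j)) k l ◅◅
  subst (λ k′ → perm (suc i) (suc (r + j)) (suc k) l ↘* perm (suc i) (suc j) k′ (v + l)) (+-suc u k)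
    (chain zero r u v i j (suc k) l (suc-injective eq))
chain zero    (suc r) zero    (suc v) i j k l eq = y-to-w i (suc (r + j)) k l ◅◅
  subst (λ l′ → perm (suc i) (suc (r + j)) k (suc l) ↘* perm (suc i) (suc j) k l′) (+-suc v l)
    (chain zero r zero v i j k (suc l) (suc-injective eq))

-- Bruhat order in coordinates

module _ (P : ℕ → ℕ → Set) where

  -- A property of the graph of a list, with positions counted from `k` so that it passes to tails
  -- and to later blocks.
  data AllIx : ℕ → List ℕ → Set where
    []  : ∀ {k} → AllIx k []
    _∷_ : ∀ {k a as} → P k a → AllIx (suc k) as → AllIx k (a ∷ as)

  AllIx-range⁺ : ∀ k s m {as} → (∀ t → t < m → P (k + t) (s + t)) → AllIx (k + m) as → AllIx k (range s m ++ as)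
  AllIx-range⁺ k s zero    {as} p ps = subst (λ k → AllIx k as) (+-identityʳ k) ps
  AllIx-range⁺ k s (suc m) {as} p ps = subst₂ P (+-identityʳ k) (+-identityʳ s) (p 0 z<s) ∷
    AllIx-range⁺ (suc k) (suc s) m
      (λ t t< → subst₂ P (+-suc k t) (+-suc s t) (p (suc t) (s<s t<)))
      (subst (λ k → AllIx k as) (+-suc k m) ps)

  AllIx-range⁻ : ∀ k s m {as} → AllIx k (range s m ++ as) → (∀ t → t < m → P (k + t) (s + t)) × AllIx (k + m) as
  AllIx-range⁻ k s zero    {as} ps = (λ _ ()) , subst (λ k → AllIx k as) (sym (+-identityʳ k)) ps
  AllIx-range⁻ k s (suc m) {as} (p ∷ ps) with q , qs ← AllIx-range⁻ (suc k) (suc s) m ps =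
    (λ { zero    _        → subst₂ P (sym (+-identityʳ k)) (sym (+-identityʳ s)) p
       ; (suc t) (s<s t<) → subst₂ P (sym (+-suc k t)) (sym (+-suc s t)) (q t t<) }) ,
    subst (λ k → AllIx k as) (sym (+-suc k m)) qs

  -- The graph of `perm x y z w` consists of four segments of slope 1; each field runs along one of
  -- them, with the position as first and the value as second argument of `P`.
  record Blocks (x y z w : ℕ) : Set where
    constructor blocks
    field
      block₁ : ∀ t → t < z → P t t
      block₂ : ∀ t → t < x → P (z + t) (z + y + t)
      block₃ : ∀ t → t < y → P (z + x + t) (z + t)
      block₄ : ∀ t → t < w → P (z + x + y + t) (z + y + x + t)

  AllIx-perm⁺ : ∀ {x y z w} → Blocks x y z w → AllIx 0 (perm x y z w)
  AllIx-perm⁺ {x} {y} {z} {w} (blocks p₁ p₂ p₃ p₄) =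
    AllIx-range⁺ 0 0 z p₁ (AllIx-range⁺ z (z + y) x p₂ (AllIx-range⁺ (z + x) z y p₃
      (subst (AllIx (z + x + y)) (++-identityʳ _) (AllIx-range⁺ (z + x + y) (z + y + x) w p₄ []))))

  AllIx-perm⁻ : ∀ {x y z w} → AllIx 0 (perm x y z w) → Blocks x y z w
  AllIx-perm⁻ {x} {y} {z} {w} ps
    with p₁ , ps ← AllIx-range⁻ 0 0 z ps
    with p₂ , ps ← AllIx-range⁻ z (z + y) x ps
    with p₃ , ps ← AllIx-range⁻ (z + x) z y ps
    with p₄ , _  ← AllIx-range⁻ (z + x + y) (z + y + x) w (subst (AllIx (z + x + y)) (sym (++-identityʳ _)) ps)
    = blocks p₁ p₂ p₃ p₄

  AllIx-values⁺ : ∀ k (v : Vec (Fin n) m) → (∀ i → P (k + toℕ i) (toℕ (lookup v i))) → AllIx k (values v)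
  AllIx-values⁺ k []      p = []
  AllIx-values⁺ k (a ∷ v) p = subst (λ k → P k (toℕ a)) (+-identityʳ k) (p Fin.zero) ∷
    AllIx-values⁺ (suc k) v (λ i → subst (λ k → P k (toℕ (lookup v i))) (+-suc k (toℕ i)) (p (Fin.suc i)))

  AllIx-values⁻ : ∀ k (v : Vec (Fin n) m) → AllIx k (values v) → ∀ i → P (k + toℕ i) (toℕ (lookup v i))
  AllIx-values⁻ k (a ∷ v) (p ∷ ps) Fin.zero    = subst (λ k → P k (toℕ a)) (sym (+-identityʳ k)) p
  AllIx-values⁻ k (a ∷ v) (p ∷ ps) (Fin.suc i) =
    subst (λ k → P k (toℕ (lookup v i))) (sym (+-suc k (toℕ i))) (AllIx-values⁻ (suc k) v ps i)

-- The graph of perm x y z w satisfies this relation, and reductions preserve it.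
Within : (x y z i v : ℕ) → Set
Within x y z i v = i ≤ v + x × v ≤ i + y × (i ≡ v ⊎ (z ≤ i × i < z + x + y × z ≤ v × v < z + x + y))

Within-perm : ∀ x y z w → Blocks (Within x y z) x y z w
Within-perm x y z w = blocks
  (λ t _ → m≤m+n t x , m≤m+n t y , inj₁ refl)
  (λ t t<x → ≤-trans (+-monoʳ-≤ z (<⇒≤ t<x)) (+-monoˡ-≤ x (≤-trans (m≤m+n z y) (m≤m+n _ t))) ,
     ≤-reflexive (e₁ z y t) ,
     inj₂ (m≤m+n z t , ≤-trans (+-monoʳ-< z t<x) (m≤m+n _ y) ,
           ≤-trans (m≤m+n z y) (m≤m+n _ t) , <-≤-trans (+-monoʳ-< (z + y) t<x) (≤-reflexive (e₁ z y x))))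
  (λ t t<y → ≤-reflexive (e₁ z x t) ,
     ≤-trans (+-monoʳ-≤ z (<⇒≤ t<y)) (+-monoˡ-≤ y (≤-trans (m≤m+n z x) (m≤m+n _ t))) ,
     inj₂ (≤-trans (m≤m+n z x) (m≤m+n _ t) , +-monoʳ-< (z + x) t<y ,
           m≤m+n z t , <-≤-trans (+-monoʳ-< z t<y) (+-monoˡ-≤ y (m≤m+n z x))))
  (λ t _ → ≤-trans (≤-reflexive (e₂ z x y t)) (m≤m+n _ x) , ≤-trans (≤-reflexive (sym (e₂ z x y t))) (m≤m+n _ y) ,
     inj₁ (e₂ z x y t))
  where
  e₁ : ∀ z y t → z + y + t ≡ z + t + y
  e₁ = solve-∀
  e₂ : ∀ z x y t → z + x + y + t ≡ z + y + x + t
  e₂ = solve-∀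

-- Two fixed points never form an inversion, so one of the two points lies in the interval, and the
-- inequalities `i < j` and `v < u` force the other one in. The displacement bounds follow from
-- `j ≤ v + x` and `u ≤ i + y`, since `i < j` and `v < u`.
Within-exchange : ∀ {x y z i j u v} → i < j → v < u → Within x y z i u → Within x y z j v →
                  Within x y z i v × Within x y z j u
Within-exchange {x} {y} {z} {i} {j} {u} {v} i<j v<u (_ , u≤i+y , iu) (j≤v+x , _ , jv) =
  (≤-trans (<⇒≤ i<j) j≤v+x , ≤-trans (<⇒≤ v<u) u≤i+y , inj₂ (z≤i , i<c , z≤v , v<c)) ,
  (≤-trans j≤v+x (+-monoˡ-≤ x (<⇒≤ v<u)) , ≤-trans u≤i+y (+-monoˡ-≤ y (<⇒≤ i<j)) , inj₂ (z≤j , j<c , z≤u , u<c))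
  where
  c = z + x + y
  inside : (i ≡ u ⊎ (z ≤ i × i < c × z ≤ u × u < c)) → (j ≡ v ⊎ (z ≤ j × j < c × z ≤ v × v < c)) →
           (z ≤ i × i < c) × (z ≤ u × u < c) × (z ≤ j × j < c) × (z ≤ v × v < c)
  inside (inj₁ refl) (inj₁ refl) = contradiction i<j (<⇒≯ v<u)
  inside (inj₁ refl) (inj₂ (z≤j , j<c , z≤v , v<c)) =
    (≤-trans z≤v (<⇒≤ v<u) , <-trans i<j j<c) , (≤-trans z≤v (<⇒≤ v<u) , <-trans i<j j<c) , (z≤j , j<c) , (z≤v , v<c)
  inside (inj₂ (z≤i , i<c , z≤u , u<c)) (inj₁ refl) =
    (z≤i , i<c) , (z≤u , u<c) , (≤-trans z≤i (<⇒≤ i<j) , <-trans v<u u<c) , (≤-trans z≤i (<⇒≤ i<j) , <-trans v<u u<c)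
  inside (inj₂ (z≤i , i<c , z≤u , u<c)) (inj₂ (z≤j , j<c , z≤v , v<c)) =
    (z≤i , i<c) , (z≤u , u<c) , (z≤j , j<c) , (z≤v , v<c)
  ins = inside iu jv
  z≤i = proj₁ (proj₁ ins)
  i<c = proj₂ (proj₁ ins)
  z≤u = proj₁ (proj₁ (proj₂ ins))
  u<c = proj₂ (proj₁ (proj₂ ins))
  z≤j = proj₁ (proj₁ (proj₂ (proj₂ ins)))
  j<c = proj₂ (proj₁ (proj₂ (proj₂ ins)))
  z≤v = proj₁ (proj₂ (proj₂ (proj₂ ins)))
  v<c = proj₂ (proj₂ (proj₂ (proj₂ ins)))

Within-⟶ : ∀ {x y z} {σ π : Word n} → σ ⟶ π →
           (∀ i → Within x y z (toℕ i) (toℕ (lookup σ i))) → ∀ i → Within x y z (toℕ i) (toℕ (lookup π i))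
Within-⟶ {x = x} {y} {z} {σ} (i , j , i<j , inv , refl) p = go
  where
  exchanged = Within-exchange {x} {y} {z} i<j inv (p i) (p j)
  σ₁ = σ [ i ]≔ lookup σ j
  go : ∀ h → Within x y z (toℕ h) (toℕ (lookup (interchange σ i j) h))
  go h with h Fin.≟ j
  ... | yes refl = subst (λ a → Within x y z (toℕ j) (toℕ a))
          (sym (Vec.lookup∘update j σ₁ (lookup σ i))) (proj₂ exchanged)
  ... | no h≢j with h Fin.≟ i
  ...   | yes refl = subst (λ a → Within x y z (toℕ i) (toℕ a))
            (sym (trans (Vec.lookup∘update′ h≢j σ₁ (lookup σ i)) (Vec.lookup∘update i σ (lookup σ j))))
            (proj₁ exchanged)
  ...   | no h≢i = subst (λ a → Within x y z (toℕ h) (toℕ a))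
            (sym (trans (Vec.lookup∘update′ h≢j σ₁ (lookup σ i)) (Vec.lookup∘update′ h≢i σ (lookup σ j))))
            (p h)

Within-≤ᴮ : ∀ {x y z} {σ π : Word n} → π ≤ᴮ σ →
            (∀ i → Within x y z (toℕ i) (toℕ (lookup σ i))) → ∀ i → Within x y z (toℕ i) (toℕ (lookup π i))
Within-≤ᴮ ε        p = p
Within-≤ᴮ (r ◅ rs) p = Within-≤ᴮ rs (Within-⟶ r p)

-- Coordinates (x - 1 , y - 1) , (z , w).
Coords : Set
Coords = (ℕ × ℕ) × (ℕ × ℕ)

total : Coords → ℕ
total ((i , j) , (k , l)) = i + j + (k + l)

permOf : Coords → List ℕ
permOf ((i , j) , (k , l)) = perm (suc i) (suc j) k l

word : ∀ m → Coords → Word (2 + m)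
word m c = fromValues (suc m) (2 + m) (permOf c)

total-perm : ∀ i j k l → suc i + suc j + k + l ≡ 2 + (i + j + (k + l))
total-perm = solve-∀

values-word : ∀ m c → total c ≡ m → values (word m c) ≡ permOf c
values-word m ((i , j) , (k , l)) refl = values-fromValues (suc m) (2 + m)
  (All.map (λ v< → <-≤-trans v< (≤-reflexive (total-perm i j k l))) (perm-< (suc i) (suc j) k l))
  (trans (length-perm (suc i) (suc j) k l) (total-perm i j k l))

infix 4 _⊑_

_⊑_ : Coords → Coords → Set
((i , j) , (k , l)) ⊑ ((i′ , j′) , (k′ , l′)) = (i ≤ i′ × j ≤ j′) × (k′ ≤ k × l′ ≤ l)

⊑-antisym : ∀ {c d} → c ⊑ d → d ⊑ c → c ≡ d
⊑-antisym ((a , b) , (c , d)) ((a′ , b′) , (c′ , d′)) =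
  cong₂ _,_ (cong₂ _,_ (≤-antisym a a′) (≤-antisym b b′)) (cong₂ _,_ (≤-antisym c′ c) (≤-antisym d′ d))

-- Provides the balance condition of `chain`, and in `downSet` the amount to be distributed.
⊑-surplus : ∀ {i j k l i′ j′ k′ l′} → i + j + (k + l) ≡ i′ + j′ + (k′ + l′) →
            i ≤ i′ → j ≤ j′ → k′ ≤ k → l′ ≤ l → (i′ ∸ i) + (j′ ∸ j) ≡ (k ∸ k′) + (l ∸ l′)
⊑-surplus {i} {j} {k} {l} {i′} {j′} {k′} {l′} eq i≤ j≤ k≤ l≤ = +-cancelʳ-≡ (i + j + (k′ + l′)) _ _ (begin
  (i′ ∸ i) + (j′ ∸ j) + (i + j + (k′ + l′))        ≡⟨ arrange (i′ ∸ i) (j′ ∸ j) i j k′ l′ ⟩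
  (i′ ∸ i) + i + ((j′ ∸ j) + j) + (k′ + l′)
    ≡⟨ cong₂ (λ a b → a + b + (k′ + l′)) (m∸n+n≡m i≤) (m∸n+n≡m j≤) ⟩
  i′ + j′ + (k′ + l′)                              ≡⟨ eq ⟨
  i + j + (k + l)
    ≡⟨ cong₂ (λ a b → i + j + (a + b)) (m∸n+n≡m k≤) (m∸n+n≡m l≤) ⟨
  i + j + ((k ∸ k′) + k′ + ((l ∸ l′) + l′))        ≡⟨ arrange′ i j (k ∸ k′) (l ∸ l′) k′ l′ ⟩
  (k ∸ k′) + (l ∸ l′) + (i + j + (k′ + l′))        ∎)
  where
  open ≡-Reasoning
  arrange : ∀ a b i j k l → a + b + (i + j + (k + l)) ≡ a + i + (b + j) + (k + l)
  arrange = solve-∀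
  arrange′ : ∀ i j a b k l → i + j + (a + k + (b + l)) ≡ a + b + (i + j + (k + l))
  arrange′ = solve-∀

⊑⇒≤ᴮ : ∀ {m c d} → total c ≡ m → total d ≡ m → c ⊑ d → word m c ≤ᴮ word m d
⊑⇒≤ᴮ {m} {c@((i , j) , (k , l))} {d@((i′ , j′) , (k′ , l′))} c≡m d≡m ((i≤ , j≤) , (k≤ , l≤)) =
  ↘*⇒≤ᴮ (word m d) (word m c) (values-word m d d≡m) (values-word m c c≡m)
    (subst₂ _↘*_ (cong₂ (λ i j → perm (suc i) (suc j) k′ l′) (m∸n+n≡m i≤) (m∸n+n≡m j≤))
                 (cong₂ (perm (suc i) (suc j)) (m∸n+n≡m k≤) (m∸n+n≡m l≤))
      (chain (i′ ∸ i) (j′ ∸ j) (k ∸ k′) (l ∸ l′) i j k′ l′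
        (⊑-surplus (trans c≡m (sym d≡m)) i≤ j≤ k≤ l≤)))

word-blocks⁺ : ∀ {m P} c → total c ≡ m →
               let ((i , j) , (k , l)) = c in Blocks P (suc i) (suc j) k l →
               ∀ a → P (toℕ a) (toℕ (lookup (word m c) a))
word-blocks⁺ {m} {P} c c≡m p = AllIx-values⁻ P 0 (word m c)
  (subst (AllIx P 0) (sym (values-word m c c≡m)) (AllIx-perm⁺ P p))

word-blocks⁻ : ∀ {m P} c → total c ≡ m →
               (∀ a → P (toℕ a) (toℕ (lookup (word m c) a))) →
               let ((i , j) , (k , l)) = c in Blocks P (suc i) (suc j) k l
word-blocks⁻ {m} {P} c c≡m p = AllIx-perm⁻ P
  (subst (AllIx P 0) (values-word m c c≡m) (AllIx-values⁺ P 0 (word m c) p))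

-- Two entries of the smaller word reveal all four coordinates. The first entry of the second block
-- sits at position z with displacement y; the last entry of the third sits just before the end of
-- the moved interval with displacement x. Neither is a fixed point, so `Within` places both in the
-- interval of the larger word. The bound on `l` then follows from the equal totals.
≤ᴮ⇒⊑ : ∀ {m c d} → total c ≡ m → total d ≡ m → word m c ≤ᴮ word m d → c ⊑ d
≤ᴮ⇒⊑ {m} {c@((i , j) , (k , l))} {d@((i′ , j′) , (k′ , l′))} c≡m d≡m c≤d =
  (s≤s⁻¹ x≤x′ , s≤s⁻¹ y≤y′) , (k′≤k , l′≤l)
  where
  within : Blocks (Within (suc i′) (suc j′) k′) (suc i) (suc j) k l
  within = word-blocks⁻ c c≡m (Within-≤ᴮ c≤d
    (word-blocks⁺ {P = Within (suc i′) (suc j′) k′} d d≡m (Within-perm (suc i′) (suc j′) k′ l′)))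

  first : Within (suc i′) (suc j′) k′ (k + 0) (k + suc j + 0)
  first = Blocks.block₂ within 0 z<s

  last : Within (suc i′) (suc j′) k′ (k + suc i + j) (k + j)
  last = Blocks.block₃ within j ≤-refl

  y≤y′ : suc j ≤ suc j′
  y≤y′ = +-cancelˡ-≤ k _ _ (subst₂ _≤_ (+-identityʳ _) (cong (_+ suc j′) (+-identityʳ k)) (proj₁ (proj₂ first)))

  k′≤k : k′ ≤ k
  k′≤k with proj₂ (proj₂ first)
  ... | inj₁ eq = contradiction (trans eq (+-identityʳ (k + suc j))) (<⇒≢ (+-monoʳ-< k z<s))
  ... | inj₂ (k′≤ , _) = subst (k′ ≤_) (+-identityʳ k) k′≤

  e₁ : ∀ k x j → k + x + j ≡ k + j + x
  e₁ = solve-∀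

  x≤x′ : suc i ≤ suc i′
  x≤x′ = +-cancelˡ-≤ (k + j) _ _ (subst (_≤ k + j + suc i′) (e₁ k (suc i) j) (proj₁ last))

  upper-bound : k + suc i + suc j ≤ k′ + suc i′ + suc j′
  upper-bound with proj₂ (proj₂ last)
  ... | inj₁ eq = contradiction (sym (trans (sym (e₁ k (suc i) j)) eq)) (<⇒≢ (m<m+n (k + j) z<s))
  ... | inj₂ (_ , <c , _) = subst (_≤ k′ + suc i′ + suc j′) (sym (+-suc (k + suc i) j)) <c

  e₂ : ∀ i j k l → k + suc i + suc j + l ≡ 2 + (i + j + (k + l))
  e₂ = solve-∀

  l′≤l : l′ ≤ l
  l′≤l = +-cancelˡ-≤ (k′ + suc i′ + suc j′) _ _ (begin
    k′ + suc i′ + suc j′ + l′    ≡⟨ trans (e₂ i′ j′ k′ l′) (cong (_+_ 2) (trans d≡m (sym c≡m))) ⟩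
    2 + (i + j + (k + l))        ≡⟨ e₂ i j k l ⟨
    k + suc i + suc j + l        ≤⟨ +-monoˡ-≤ l upper-bound ⟩
    k′ + suc i′ + suc j′ + l     ∎)
    where open ≤-Reasoning

word-injective : ∀ {m c d} → total c ≡ m → total d ≡ m → word m c ≡ word m d → c ≡ d
word-injective {m} {c} {d} c≡m d≡m eq = ⊑-antisym
  (≤ᴮ⇒⊑ c≡m d≡m (subst (word m c ≤ᴮ_) eq ε)) (≤ᴮ⇒⊑ d≡m c≡m (subst (_≤ᴮ word m c) eq ε))

-- perm x y z w is bigrassmannian

-- Quantifying over all `a` at position `p` spares the construction of an element of `Fin n` from
-- each arithmetic expression.
At : Word n → ℕ → ℕ → Set
At ω p v = ∀ a → toℕ a ≡ p → toℕ (lookup ω a) ≡ v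

-- Inversion exchanges the lengths of the two middle blocks.
transpose : Coords → Coords
transpose ((i , j) , (k , l)) = (j , i) , (k , l)

total-transpose : ∀ c → total (transpose c) ≡ total c
total-transpose ((i , j) , (k , l)) = cong (_+ (k + l)) (+-comm j i)

module _ {m} c (c≡m : total c ≡ m) where

  private
    i = proj₁ (proj₁ c)
    j = proj₂ (proj₁ c)
    k = proj₁ (proj₂ c)
    l = proj₂ (proj₂ c)

  word-At : Blocks (At (word m c)) (suc i) (suc j) k l
  word-At = word-blocks⁻ c c≡m λ a b b≡a → cong (toℕ ∘ lookup (word m c)) (Fin.toℕ-injective b≡a)

  private
    ω = word m c

    length≡ : k + suc i + suc j + l ≡ 2 + m
    length≡ = trans (lemma i j k l) (cong (_+_ 2) c≡m)
      where
      lemma : ∀ i j k l → k + suc i + suc j + l ≡ 2 + (i + j + (k + l))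
      lemma = solve-∀

    inside₄ : ∀ (b : Fin (2 + m)) t → toℕ b ≡ k + suc i + suc j + t → t < l
    inside₄ b t b≡ = +-cancelˡ-< (k + suc i + suc j) t l (subst₂ _<_ b≡ (sym length≡) (Fin.toℕ<n b))

    -- Says that a descent at position `p` with value `v` can only be at the last position of the
    -- second block; in this form it can be checked segment by segment.
    P : ℕ → ℕ → Set
    P p v = ∀ b → toℕ b ≡ suc p → toℕ (lookup ω b) < v → k + i ≡ p

    open Blocks word-At

    ascents : Blocks P (suc i) (suc j) k l
    ascents = blocks p₁ p₂ p₃ p₄
      where
      p₁ : ∀ t → t < k → P t t
      p₁ t t<k b b≡ v< with m≤n⇒m<n∨m≡n t<k
      ... | inj₁ t+1<k = contradiction (subst (_< t) (block₁ (suc t) t+1<k b b≡) v<) (≤⇒≯ (n≤1+n t))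
      ... | inj₂ t+1≡k = contradiction (subst (_< t) (block₂ 0 z<s b (trans b≡ (trans t+1≡k (sym (+-identityʳ k))))) v<)
              (≤⇒≯ (≤-trans (<⇒≤ t<k) (≤-trans (m≤m+n k (suc j)) (m≤m+n _ 0))))
      p₂ : ∀ t → t < suc i → P (k + t) (k + suc j + t)
      p₂ t t<x b b≡ v< with m≤n⇒m<n∨m≡n t<x
      ... | inj₁ t+1<x = contradiction (subst (_< k + suc j + t) (block₂ (suc t) t+1<x b (trans b≡ (sym (+-suc k t)))) v<)
              (≤⇒≯ (+-monoʳ-≤ (k + suc j) (n≤1+n t)))
      ... | inj₂ t+1≡x = cong (_+_ k) (sym (suc-injective t+1≡x))
      p₃ : ∀ t → t < suc j → P (k + suc i + t) (k + t)
      p₃ t t<y b b≡ v< with m≤n⇒m<n∨m≡n t<y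
      ... | inj₁ t+1<y = contradiction (subst (_< k + t) (block₃ (suc t) t+1<y b (trans b≡ (sym (+-suc _ t)))) v<)
              (≤⇒≯ (+-monoʳ-≤ k (n≤1+n t)))
      ... | inj₂ t+1≡y = contradiction (subst (_< k + t) (block₄ 0 (inside₄ b 0 b≡′) b b≡′) v<)
              (≤⇒≯ (≤-trans (+-monoʳ-≤ k (<⇒≤ t<y)) (≤-trans (m≤m+n (k + suc j) (suc i)) (m≤m+n _ 0))))
        where
        b≡′ : toℕ b ≡ k + suc i + suc j + 0
        b≡′ = trans b≡ (trans (sym (+-suc _ t)) (trans (cong (_+_ (k + suc i)) t+1≡y) (sym (+-identityʳ _))))
      p₄ : ∀ t → t < l → P (k + suc i + suc j + t) (k + suc j + suc i + t)
      p₄ t t<w b b≡ v< = contradiction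
        (subst (_< k + suc j + suc i + t) (block₄ (suc t) (inside₄ b (suc t) b≡′) b b≡′) v<)
        (≤⇒≯ (+-monoʳ-≤ (k + suc j + suc i) (n≤1+n t)))
        where
        b≡′ : toℕ b ≡ k + suc i + suc j + suc t
        b≡′ = trans b≡ (sym (+-suc _ t))

    d+1<n : k + suc i < 2 + m
    d+1<n = <-≤-trans (m<m+n (k + suc i) z<s) (≤-trans (m≤m+n _ l) (≤-reflexive length≡))

    d<n : k + i < 2 + m
    d<n = <-trans (+-monoʳ-< k (n<1+n i)) d+1<n

  word-exactlyOneDescent : ExactlyOneDescent (word m c)
  word-exactlyOneDescent = fromℕ< d<n , (fromℕ< d+1<n ,
      trans (Fin.toℕ-fromℕ< d+1<n) (trans (+-suc k i) (cong suc (sym (Fin.toℕ-fromℕ< d<n)))) ,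
      subst₂ _<_ (sym (block₃ 0 z<s _ (trans (Fin.toℕ-fromℕ< d+1<n) (sym (+-identityʳ _)))))
                 (sym (block₂ i ≤-refl _ (Fin.toℕ-fromℕ< d<n)))
                 (subst (_< k + suc j + i) (sym (+-identityʳ k)) (<-≤-trans (m<m+n k z<s) (m≤m+n (k + suc j) i)))) ,
    λ { {a} (b , b≡ , inv) → Fin.toℕ-injective (trans (Fin.toℕ-fromℕ< d<n)
          (word-blocks⁺ {P = P} c c≡m ascents a b b≡ inv)) }

word-transpose : ∀ {m} c → total c ≡ m → ∀ a → lookup (word m (transpose c)) (lookup (word m c) a) ≡ a
word-transpose {m} c c≡m a = Fin.toℕ-injective (word-blocks⁺ {P = λ p v → At (word m (transpose c)) v p} c c≡m
  -- With positions and values exchanged, the second and third segments of the transposed graph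
  -- trade places.
  (blocks block₁ block₃ block₂ block₄) a _ refl)
  where open Blocks (word-At (transpose c) (trans (total-transpose c) c≡m))

word-bigrassmannian : ∀ {m} c → total c ≡ m → Bigrassmannian (word m c)
word-bigrassmannian {m} c c≡m = word m (transpose c) ,
  ((λ { refl → word-transpose (transpose c) ct≡m _ }) , (λ { refl → word-transpose c c≡m _ })) ,
  word-exactlyOneDescent c c≡m , word-exactlyOneDescent (transpose c) ct≡m
  where
  ct≡m = trans (total-transpose c) c≡m

-- Every bigrassmannian permutation is of the form perm x y z w

module _ {ω : Word n} (inj : ∀ {a b} → lookup ω a ≡ lookup ω b → a ≡ b)
         {d} (unique : ∀ {a} → Descent ω a → d ≡ a) where

  private
    step : ∀ a b → toℕ b ≡ suc (toℕ a) → (b Fin.≤ d ⊎ d Fin.< a) → lookup ω a Fin.< lookup ω b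
    step a b b≡ side with Fin.<-cmp (lookup ω a) (lookup ω b)
    ... | tri< ωa<ωb _ _ = ωa<ωb
    ... | tri≈ _ ωa≡ωb _ = contradiction (trans (sym b≡) (cong toℕ (sym (inj ωa≡ωb)))) 1+n≢n
    ... | tri> _ _ ωb<ωa with refl ← unique (b , b≡ , ωb<ωa) | side
    ...   | inj₁ b≤d = contradiction (≤-trans (≤-reflexive (sym b≡)) b≤d) 1+n≰n
    ...   | inj₂ d<d = contradiction d<d (<-irrefl refl)

    steps : ∀ g a b → toℕ b ≡ suc g + toℕ a → (b Fin.≤ d ⊎ d Fin.< a) → lookup ω a Fin.< lookup ω b
    steps zero    a b b≡ side = step a b b≡ side
    steps (suc g) a b b≡ side = <-trans (step a a′ a′≡ (near side)) (steps g a′ b b≡′ (far side))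
      where
      a+1<b : suc (toℕ a) < toℕ b
      a+1<b = subst (suc (toℕ a) <_) (sym b≡) (s≤s (s≤s (m≤n+m (toℕ a) g)))
      a′ = fromℕ< (<-trans a+1<b (Fin.toℕ<n b))
      a′≡ : toℕ a′ ≡ suc (toℕ a)
      a′≡ = Fin.toℕ-fromℕ< _
      b≡′ : toℕ b ≡ suc g + toℕ a′
      b≡′ = trans b≡ (trans (sym (+-suc (suc g) (toℕ a))) (cong (_+_ (suc g)) (sym a′≡)))
      near : (b Fin.≤ d ⊎ d Fin.< a) → (a′ Fin.≤ d ⊎ d Fin.< a)
      near (inj₁ b≤d) = inj₁ (≤-trans (≤-reflexive a′≡) (≤-trans (<⇒≤ a+1<b) b≤d))
      near (inj₂ d<a) = inj₂ d<a
      far : (b Fin.≤ d ⊎ d Fin.< a) → (b Fin.≤ d ⊎ d Fin.< a′)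
      far (inj₁ b≤d) = inj₁ b≤d
      far (inj₂ d<a) = inj₂ (<-trans d<a (subst (toℕ a <_) (sym a′≡) (n<1+n _)))

  -- Two positions on the same side of the only descent are joined by ascents alone, injectivity
  -- excluding equal neighbours.
  increasing : ∀ {a b} → a Fin.< b → (b Fin.≤ d ⊎ d Fin.< a) → lookup ω a Fin.< lookup ω b
  increasing {a} {b} a<b = steps (toℕ b ∸ suc (toℕ a)) a b
    (sym (trans (sym (+-suc _ (toℕ a))) (m∸n+n≡m a<b)))

values≡map : (v : Vec (Fin n) m) → values v ≡ map (toℕ ∘ lookup v) (allFin m)
values≡map v = trans (tabulated v) (sym (map-tabulate id (toℕ ∘ lookup v)))
  where
  tabulated : ∀ {m} (v : Vec (Fin n) m) → values v ≡ tabulate (toℕ ∘ lookup v)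
  tabulated []      = refl
  tabulated (a ∷ v) = cong (toℕ a ∷_) (tabulated v)

-- The hypothesis makes `P` closed under passing to earlier entries, so the entries satisfying it
-- form an initial segment.
filter-partition : {P : A → Set} (P? : Decidable P) {xs : List A} → AllPairs (λ u v → P v → P u) xs →
                   xs ≡ filter P? xs ++ filter (∁? P?) xs
filter-partition P? []                 = refl
filter-partition P? {x ∷ xs} (px ∷ ps) with P? x
... | yes p = cong (x ∷_) (filter-partition P? ps)
... | no ¬p = trans (cong (x ∷_) (sym (filter-all (∁? P?) none))) (sym (cong (_++ x ∷ filter (∁? P?) xs) (filter-none P? none)))
  where none = All.map (λ v⇒x v → ¬p (v⇒x v)) px

AllPairs-filter : {P : A → Set} {R S : A → A → Set} (P? : Decidable P) →
                  (∀ {a b} → P a → P b → R a b → S a b) → ∀ {xs} → AllPairs R xs → AllPairs S (filter P? xs)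
AllPairs-filter P? f []                 = []
AllPairs-filter P? f {x ∷ xs} (rx ∷ rs) with P? x
... | yes p = All.map (λ { (r , q) → f p q r }) (All.zip (All.filter⁺ P? rx , All.all-filter P? xs)) ∷ AllPairs-filter P? f rs
... | no _  = AllPairs-filter P? f rs

increasing-unique : {xs ys : List ℕ} → AllPairs _<_ xs → AllPairs _<_ ys →
                    (∀ {v} → v ∈ xs → v ∈ ys) → (∀ {v} → v ∈ ys → v ∈ xs) → xs ≡ ys
increasing-unique {[]}     {[]}     _ _ _ _ = refl
increasing-unique {[]}     {y ∷ ys} _ _ _ ⊇ with () ← ⊇ (here refl)
increasing-unique {x ∷ xs} {[]}     _ _ ⊆ _ with () ← ⊆ (here refl)
increasing-unique {x ∷ xs} {y ∷ ys} (x< ∷ xs<) (y< ∷ ys<) ⊆ ⊇ = cong₂ _∷_ x≡y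
  (increasing-unique xs< ys<
    (λ v∈ → tail x≡y (All.lookup x< v∈) (⊆ (there v∈)))
    (λ v∈ → tail (sym x≡y) (All.lookup y< v∈) (⊇ (there v∈))))
  where
  head : x ∈ y ∷ ys → y ∈ x ∷ xs → x ≡ y
  head (here x≡y) _           = x≡y
  head (there _)  (here y≡x)  = sym y≡x
  head (there x∈) (there y∈)  = contradiction (All.lookup x< y∈) (<⇒≯ (All.lookup y< x∈))
  x≡y = head (⊆ (here refl)) (⊇ (here refl))
  tail : ∀ {a b v bs} → a ≡ b → a < v → v ∈ b ∷ bs → v ∈ bs
  tail a≡b a<v (here v≡b)  = contradiction (trans a≡b (sym v≡b)) (<⇒≢ a<v)
  tail _   _   (there v∈) = v∈

range-increasing : ∀ s m → AllPairs _<_ (range s m)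
range-increasing s zero    = []
range-increasing s (suc m) = All-range (suc s) m (λ s< _ → s<) ∷ range-increasing (suc s) m

∈-range⁺ : ∀ {s m v} → s ≤ v → v < s + m → v ∈ range s m
∈-range⁺ {s} {zero}  s≤v v< = contradiction s≤v (<⇒≱ (subst (_ <_) (+-identityʳ s) v<))
∈-range⁺ {s} {suc m} {v} s≤v v< with m≤n⇒m<n∨m≡n s≤v
... | inj₁ s<v = there (∈-range⁺ s<v (subst (v <_) (+-suc s m) v<))
... | inj₂ s≡v = here (sym s≡v)

∈-range⁻ : ∀ {s m v} → v ∈ range s m → s ≤ v × v < s + m
∈-range⁻ {s} {m} = All.lookup (All-range s m λ s≤ v< → s≤ , v<)

range-++⁻ : ∀ s m xs ys → xs ++ ys ≡ range s m →
            xs ≡ range s (length xs) × ys ≡ range (s + length xs) (length ys) × length xs + length ys ≡ m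
range-++⁻ s m []       ys eq = refl ,
  trans eq (cong₂ range (sym (+-identityʳ s)) (sym len)) , len
  where len = trans (cong length eq) (length-range s m)
range-++⁻ s (suc m) (x ∷ xs) ys eq with xs≡ , ys≡ , len ← range-++⁻ (suc s) m xs ys (proj₂ (∷-injective eq)) =
  cong₂ _∷_ (proj₁ (∷-injective eq)) xs≡ , trans ys≡ (cong (λ s → range s (length ys)) (sym (+-suc s (length xs)))) ,
  cong suc len

∈⇒0<length : {a : A} {as : List A} → a ∈ as → 0 < length as
∈⇒0<length (here _)  = z<s
∈⇒0<length (there _) = z<s

module _ {m} (ω : Word (2 + m)) (bigrassmannian : Bigrassmannian ω) where

  private
    ω⁻¹ = proj₁ bigrassmannian
    ωω⁻¹ : ∀ a → lookup ω (lookup ω⁻¹ a) ≡ a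
    ωω⁻¹ a = proj₁ (proj₁ (proj₂ bigrassmannian)) refl
    ω⁻¹ω : ∀ a → lookup ω⁻¹ (lookup ω a) ≡ a
    ω⁻¹ω a = proj₂ (proj₁ (proj₂ bigrassmannian)) refl

    ω-injective : ∀ {a b} → lookup ω a ≡ lookup ω b → a ≡ b
    ω-injective eq = trans (sym (ω⁻¹ω _)) (trans (cong (lookup ω⁻¹) eq) (ω⁻¹ω _))
    ω⁻¹-injective : ∀ {a b} → lookup ω⁻¹ a ≡ lookup ω⁻¹ b → a ≡ b
    ω⁻¹-injective eq = trans (sym (ωω⁻¹ _)) (trans (cong (lookup ω) eq) (ωω⁻¹ _))

    ω-descent   = proj₁ (proj₂ (proj₂ bigrassmannian))
    ω⁻¹-descent = proj₂ (proj₂ (proj₂ bigrassmannian))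
    d = proj₁ ω-descent
    e = proj₁ ω⁻¹-descent
    d⁺ = proj₁ (proj₁ (proj₂ ω-descent))

    d<d⁺ : d Fin.< d⁺
    d<d⁺ = ≤-reflexive (sym (proj₁ (proj₂ (proj₁ (proj₂ ω-descent)))))

    ωd⁺<ωd : lookup ω d⁺ Fin.< lookup ω d
    ωd⁺<ωd = proj₂ (proj₂ (proj₁ (proj₂ ω-descent)))

    ω-increasing : ∀ {a b} → a Fin.< b → (b Fin.≤ d ⊎ d Fin.< a) → lookup ω a Fin.< lookup ω b
    ω-increasing = increasing {ω = ω} ω-injective (proj₂ (proj₂ ω-descent))

    small-or-large : ∀ {a b} → lookup ω a Fin.< lookup ω b → (lookup ω b Fin.≤ e ⊎ e Fin.< lookup ω a) → a Fin.< b
    small-or-large {a} {b} ωa<ωb side = subst₂ Fin._<_ (ω⁻¹ω a) (ω⁻¹ω b)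
      (increasing {ω = ω⁻¹} ω⁻¹-injective (proj₂ (proj₂ ω⁻¹-descent)) ωa<ωb side)

    -- Positions are cut at the descent `d` of `ω`, values at the descent `e` of its inverse. On
    -- each side of `d` the word increases, so small entries precede large ones there. The inverse
    -- increases on each side of `e`, so the small entries, read from left to right through the
    -- whole word, are consecutive from 0, and the large ones continue from `suc e`. The four
    -- resulting classes are the blocks of `perm`.
    Left Small : Fin (2 + m) → Set
    Left  a = a Fin.≤ d
    Small a = lookup ω a Fin.≤ e

    left? : Decidable Left
    left? a = a Fin.≤? d
    small? : Decidable Small
    small? a = lookup ω a Fin.≤? e

    reflect : ∀ {a b} → a Fin.< b → (lookup ω a Fin.≤ e × lookup ω b Fin.≤ e ⊎ e Fin.< lookup ω a × e Fin.< lookup ω b) →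
              lookup ω a Fin.< lookup ω b
    reflect {a} {b} a<b side with Fin.<-cmp (lookup ω a) (lookup ω b)
    ... | tri< ωa<ωb _ _ = ωa<ωb
    ... | tri≈ _ ωa≡ωb _ = contradiction (cong toℕ (ω-injective ωa≡ωb)) (<⇒≢ a<b)
    reflect a<b (inj₁ (ωa≤ , _)) | tri> _ _ ωb<ωa = contradiction (small-or-large ωb<ωa (inj₁ ωa≤)) (<⇒≯ a<b)
    reflect a<b (inj₂ (_ , ωb>)) | tri> _ _ ωb<ωa = contradiction (small-or-large ωb<ωa (inj₂ ωb>)) (<⇒≯ a<b)

    positions = allFin (2 + m)

    positions-increasing : AllPairs Fin._<_ positions
    positions-increasing = AllPairs.tabulate⁺-< id

    L R LS LB RS RB : List (Fin (2 + m))
    L  = filter left? positions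
    R  = filter (∁? left?) positions
    LS = filter small? L
    LB = filter (∁? small?) L
    RS = filter small? R
    RB = filter (∁? small?) R

    positions≡ : positions ≡ L ++ R
    positions≡ = filter-partition left? (AllPairs.map (λ a<b b≤d → ≤-trans (<⇒≤ a<b) b≤d) positions-increasing)

    L≡ : L ≡ LS ++ LB
    L≡ = filter-partition small? (AllPairs-filter left?
      (λ _ b≤d a<b ωb≤e → ≤-trans (<⇒≤ (ω-increasing a<b (inj₁ b≤d))) ωb≤e) positions-increasing)

    R≡ : R ≡ RS ++ RB
    R≡ = filter-partition small? (AllPairs-filter (∁? left?)
      (λ d<a _ a<b ωb≤e → ≤-trans (<⇒≤ (ω-increasing a<b (inj₂ (≰⇒> d<a)))) ωb≤e) positions-increasing)

    value : Fin (2 + m) → ℕ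
    value a = toℕ (lookup ω a)

    smalls : map value (filter small? positions) ≡ range 0 (suc (toℕ e))
    smalls = increasing-unique
      (AllPairs.map⁺ (AllPairs-filter small? (λ a b a<b → reflect a<b (inj₁ (a , b))) positions-increasing))
      (range-increasing 0 _)
      (λ v∈ → let a , a∈ , v≡ = ∈-map⁻ value v∈ in
        ∈-range⁺ z≤n (subst (_< suc (toℕ e)) (sym v≡) (s≤s (proj₂ (∈-filter⁻ small? {xs = positions} a∈)))))
      (λ {v} v∈ → let v≤e = s≤s⁻¹ (proj₂ (∈-range⁻ v∈))
                      v<n = ≤-<-trans v≤e (Fin.toℕ<n e)
                      ωa≡ = trans (cong toℕ (ωω⁻¹ (fromℕ< v<n))) (Fin.toℕ-fromℕ< v<n) in
        subst (_∈ map value (filter small? positions)) ωa≡ (∈-map⁺ value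
          (∈-filter⁺ small? (∈-allFin (lookup ω⁻¹ (fromℕ< v<n))) (subst (_≤ toℕ e) (sym ωa≡) v≤e))))

    larges : map value (filter (∁? small?) positions) ≡ range (suc (toℕ e)) (2 + m ∸ suc (toℕ e))
    larges = increasing-unique
      (AllPairs.map⁺ (AllPairs-filter (∁? small?) (λ a b a<b → reflect a<b (inj₂ (≰⇒> a , ≰⇒> b))) positions-increasing))
      (range-increasing (suc (toℕ e)) _)
      (λ v∈ → let a , a∈ , v≡ = ∈-map⁻ value v∈ in
        ∈-range⁺ (subst (toℕ e <_) (sym v≡) (≰⇒> (proj₂ (∈-filter⁻ (∁? small?) {xs = positions} a∈))))
                 (subst₂ _<_ (sym v≡) (sym n≡) (Fin.toℕ<n (lookup ω a))))
      (λ {v} v∈ → let e<v = proj₁ (∈-range⁻ v∈)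
                      v<n = <-≤-trans (proj₂ (∈-range⁻ v∈)) (≤-reflexive n≡)
                      ωa≡ = trans (cong toℕ (ωω⁻¹ (fromℕ< v<n))) (Fin.toℕ-fromℕ< v<n) in
        subst (_∈ map value (filter (∁? small?) positions)) ωa≡ (∈-map⁺ value
          (∈-filter⁺ (∁? small?) (∈-allFin (lookup ω⁻¹ (fromℕ< v<n))) (<⇒≱ (subst (toℕ e <_) (sym ωa≡) e<v)))))
      where
      n≡ : suc (toℕ e) + (2 + m ∸ suc (toℕ e)) ≡ 2 + m
      n≡ = m+[n∸m]≡n (Fin.toℕ<n e)

    split-filter : ∀ {P : Fin (2 + m) → Set} (P? : Decidable P) {s k} → map value (filter P? positions) ≡ range s k →
            map value (filter P? L) ++ map value (filter P? R) ≡ range s k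
    split-filter P? eq = trans (sym (map-++ value (filter P? L) (filter P? R)))
      (trans (cong (map value) (sym (trans (cong (filter P?) positions≡) (filter-++ P? L R)))) eq)

    z = length (map value LS)
    x = length (map value LB)
    y = length (map value RS)
    w = length (map value RB)

    smalls-split-filter = range-++⁻ 0 (suc (toℕ e)) (map value LS) (map value RS) (split-filter small? smalls)
    larges-split-filter = range-++⁻ (suc (toℕ e)) _ (map value LB) (map value RB) (split-filter (∁? small?) larges)

    e≡ : z + y ≡ suc (toℕ e)
    e≡ = proj₂ (proj₂ smalls-split-filter)

    values≡perm : values ω ≡ perm x y z w
    values≡perm = begin
      values ω                                ≡⟨ values≡map ω ⟩
      map value positions                     ≡⟨ cong (map value) positions≡ ⟩
      map value (L ++ R)                      ≡⟨ map-++ value L R ⟩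
      map value L ++ map value R
        ≡⟨ cong₂ (λ l r → map value l ++ map value r) L≡ R≡ ⟩
      map value (LS ++ LB) ++ map value (RS ++ RB)
        ≡⟨ cong₂ _++_ (map-++ value LS LB) (map-++ value RS RB) ⟩
      (map value LS ++ map value LB) ++ map value RS ++ map value RB
        ≡⟨ ++-assoc (map value LS) (map value LB) _ ⟩
      map value LS ++ map value LB ++ map value RS ++ map value RB
        ≡⟨ cong₂ _++_ (proj₁ smalls-split-filter) (cong₂ _++_
             (trans (proj₁ larges-split-filter) (cong (λ s → range s x) (sym e≡))) (cong₂ _++_
             (proj₁ (proj₂ smalls-split-filter))
             (trans (proj₁ (proj₂ larges-split-filter)) (cong (λ s → range (s + x) w) (sym e≡))))) ⟩
      perm x y z w ∎
      where open ≡-Reasoning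

    -- The descent itself shows that the middle blocks are nonempty: if the values at `d` and `d⁺`
    -- were on the same side of `e`, the inverse would put them in increasing order. Hence the
    -- former is large and the latter small.
    x>0 : 0 < x
    x>0 = ∈⇒0<length (∈-map⁺ value (∈-filter⁺ (∁? small?) (∈-filter⁺ left? (∈-allFin d) ≤-refl)
      λ ωd≤e → contradiction (small-or-large ωd⁺<ωd (inj₁ ωd≤e)) (<⇒≯ d<d⁺)))

    y>0 : 0 < y
    y>0 = ∈⇒0<length (∈-map⁺ value (∈-filter⁺ small? (∈-filter⁺ (∁? left?) (∈-allFin d⁺) (<⇒≱ d<d⁺))
      (≮⇒≥ λ e<ωd⁺ → contradiction (small-or-large ωd⁺<ωd (inj₂ e<ωd⁺)) (<⇒≯ d<d⁺))))

    length-values : ∀ {n m} (v : Vec (Fin n) m) → length (values v) ≡ m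
    length-values []      = refl
    length-values (_ ∷ v) = cong suc (length-values v)

    coordinates : ∀ x y → 0 < x → 0 < y → values ω ≡ perm x y z w → ∃ λ c → total c ≡ m × ω ≡ word m c
    coordinates (suc i) (suc j) _ _ eq = c , c≡m , values-injective ω (word m c) (trans eq (sym (values-word m c c≡m)))
      where
      c = (i , j) , (z , w)
      c≡m : total c ≡ m
      c≡m = +-cancelˡ-≡ 2 _ _ (trans (sym (total-perm i j z w)) (trans (sym (length-perm (suc i) (suc j) z w))
        (trans (sym (cong length eq)) (length-values ω))))

  bigrassmannian⇒word : ∃ λ c → total c ≡ m × ω ≡ word m c
  bigrassmannian⇒word = coordinates x y x>0 y>0 values≡perm

-- Enumerations without repetitions

unique⇒↭ : {xs ys : List A} → Unique xs → Unique ys →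
           (∀ {x} → x ∈ xs → x ∈ ys) → (∀ {x} → x ∈ ys → x ∈ xs) → xs ↭ ys
unique⇒↭ xs! ys! ⊆ ⊇ = ∼bag⇒↭ (unique∧set⇒bag xs! ys! (mk⇔ ⊆ ⊇))

unique-map : (f : A → B) {xs : List A} → (∀ {x y} → x ∈ xs → y ∈ xs → f x ≡ f y → x ≡ y) →
             Unique xs → Unique (map f xs)
unique-map f inj []         = []
unique-map f inj (x∉ ∷ xs!) =
  All.map⁺ (All.tabulate λ y∈ fx≡fy → All.lookup x∉ y∈ (inj (here refl) (there y∈) fx≡fy)) ∷
  unique-map f (λ x∈ y∈ → inj (there x∈) (there y∈)) xs!

-- The function `key` recovers from an entry the `x` that produced it, so the lists for different
-- `x` are disjoint.
unique-concatMap : (f : A → List B) (key : B → A) → (∀ x → Unique (f x)) →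
                   ∀ {xs} → (∀ {x y} → x ∈ xs → y ∈ f x → key y ≡ x) → Unique xs → Unique (concatMap f xs)
unique-concatMap f key f! key≡ []              = []
unique-concatMap f key f! {x ∷ xs} key≡ (x∉ ∷ xs!) =
  Unique.++⁺ (f! x) (unique-concatMap f key f! (key≡ ∘ there) xs!) λ { (y∈fx , y∈) →
    let x′ , x′∈ , y∈fx′ = find (∈-concatMap⁻ f {xs = xs} y∈) in
    All.lookup x∉ x′∈ (trans (sym (key≡ (here refl) y∈fx)) (key≡ (there x′∈) y∈fx′)) }

∑-concatMap : (F : B → ℕ) (f : A → List B) (xs : List A) → ∑ F (concatMap f xs) ≡ ∑ (∑ F ∘ f) xs
∑-concatMap F f []       = refl
∑-concatMap F f (x ∷ xs) = trans (∑-++ F (f x) (concatMap f xs)) (cong (_+_ (∑ F (f x))) (∑-concatMap F f xs))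

-- Antidiagonals

antidiagonal : ℕ → List (ℕ × ℕ)
antidiagonal zero    = [ (0 , 0) ]
antidiagonal (suc n) = (0 , suc n) ∷ map (map₁ suc) (antidiagonal n)

∑-antidiagonal : ∀ (F : ℕ × ℕ → ℕ) n → ∑ F (antidiagonal n) ≡ Diag (λ i j → F (i , j)) n
∑-antidiagonal F zero    = +-identityʳ _
∑-antidiagonal F (suc n) = cong (_+_ (F (0 , suc n)))
  (trans (∑-map F (map₁ suc) (antidiagonal n)) (∑-antidiagonal (F ∘ map₁ suc) n))

∈-antidiagonal⁺ : ∀ i j → (i , j) ∈ antidiagonal (i + j)
∈-antidiagonal⁺ zero    zero    = here refl
∈-antidiagonal⁺ zero    (suc j) = here refl
∈-antidiagonal⁺ (suc i) j       = there (∈-map⁺ (map₁ suc) (∈-antidiagonal⁺ i j))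

∈-antidiagonal⁻ : ∀ n {p} → p ∈ antidiagonal n → proj₁ p + proj₂ p ≡ n
∈-antidiagonal⁻ zero    (here refl) = refl
∈-antidiagonal⁻ (suc n) (here refl) = refl
∈-antidiagonal⁻ (suc n) (there p∈) with _ , q∈ , refl ← ∈-map⁻ (map₁ suc) p∈ = cong suc (∈-antidiagonal⁻ n q∈)

antidiagonal-unique : ∀ n → Unique (antidiagonal n)
antidiagonal-unique zero    = [] ∷ []
antidiagonal-unique (suc n) = All.map⁺ (All.universal (λ _ ()) (antidiagonal n)) ∷
  Unique.map⁺ (λ { refl → refl }) (antidiagonal-unique n)

length-antidiagonal : ∀ n → length (antidiagonal n) ≡ suc n
length-antidiagonal zero    = refl
length-antidiagonal (suc n) = cong suc (trans (length-map (map₁ suc) (antidiagonal n)) (length-antidiagonal n))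

-- Bigrassmannian permutations by coordinates

-- Grouping by s = i + j and t = k + l makes the sum of a product weight a convolution.
coordinates : ℕ → List Coords
coordinates m = concatMap (λ { (s , t) → cartesianProduct (antidiagonal s) (antidiagonal t) }) (antidiagonal m)

∈-coordinates⁺ : ∀ c → c ∈ coordinates (total c)
∈-coordinates⁺ ((i , j) , (k , l)) = ∈-concatMap⁺ _ (lose (∈-antidiagonal⁺ (i + j) (k + l))
  (∈-cartesianProduct⁺ (∈-antidiagonal⁺ i j) (∈-antidiagonal⁺ k l)))

∈-coordinates⁻ : ∀ {m c} → c ∈ coordinates m → total c ≡ m
∈-coordinates⁻ {m} c∈ with (s , t) , st∈ , c∈ ← find (∈-concatMap⁻ _ {xs = antidiagonal m} c∈)
  with ij∈ , kl∈ ← ∈-cartesianProduct⁻ (antidiagonal s) (antidiagonal t) c∈ =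
  trans (cong₂ _+_ (∈-antidiagonal⁻ s ij∈) (∈-antidiagonal⁻ t kl∈)) (∈-antidiagonal⁻ m st∈)

coordinates-unique : ∀ m → Unique (coordinates m)
coordinates-unique m = unique-concatMap _ (λ { ((i , j) , (k , l)) → i + j , k + l })
  (λ { (s , t) → Unique.cartesianProduct⁺ (antidiagonal-unique s) (antidiagonal-unique t) })
  (λ { {s , t} _ c∈ → let ij∈ , kl∈ = ∈-cartesianProduct⁻ (antidiagonal s) (antidiagonal t) c∈ in
       cong₂ _,_ (∈-antidiagonal⁻ s ij∈) (∈-antidiagonal⁻ t kl∈) })
  (antidiagonal-unique m)

∑-coordinates : ∀ (f g : ℕ × ℕ → ℕ) m → ∑ (λ { (ij , kl) → f ij * g kl }) (coordinates m) ≡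
                ((Diag λ i j → f (i , j)) ⋆ (Diag λ k l → g (k , l))) m
∑-coordinates f g m = begin
  ∑ (λ { (ij , kl) → f ij * g kl }) (coordinates m)
    ≡⟨ ∑-concatMap _ _ (antidiagonal m) ⟩
  ∑ (λ { (s , t) → ∑ (λ { (ij , kl) → f ij * g kl }) (cartesianProduct (antidiagonal s) (antidiagonal t)) }) (antidiagonal m)
    ≡⟨ ∑-cong′ (antidiagonal m) (λ { (s , t) → factor s t }) ⟩
  ∑ (λ { (s , t) → Diag (λ i j → f (i , j)) s * Diag (λ k l → g (k , l)) t }) (antidiagonal m)
    ≡⟨ ∑-antidiagonal _ m ⟩
  ((Diag λ i j → f (i , j)) ⋆ (Diag λ k l → g (k , l))) m ∎
  where
  open ≡-Reasoning
  factor : ∀ s t → ∑ (λ { (ij , kl) → f ij * g kl }) (cartesianProduct (antidiagonal s) (antidiagonal t))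
                 ≡ Diag (λ i j → f (i , j)) s * Diag (λ k l → g (k , l)) t
  factor s t = begin
    ∑ (λ { (ij , kl) → f ij * g kl }) (cartesianProduct (antidiagonal s) (antidiagonal t))
      ≡⟨ ∑-cartesianProduct _ (antidiagonal s) (antidiagonal t) ⟩
    ∑ (λ ij → ∑ (λ kl → f ij * g kl) (antidiagonal t)) (antidiagonal s)
      ≡⟨ ∑-cong′ (antidiagonal s) (λ ij → ∑-*ˡ (f ij) g (antidiagonal t)) ⟩
    ∑ (λ ij → f ij * ∑ g (antidiagonal t)) (antidiagonal s)
      ≡⟨ ∑-*ʳ (∑ g (antidiagonal t)) f (antidiagonal s) ⟩
    ∑ f (antidiagonal s) * ∑ g (antidiagonal t)
      ≡⟨ cong₂ _*_ (∑-antidiagonal f s) (∑-antidiagonal g t) ⟩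
    Diag (λ i j → f (i , j)) s * Diag (λ k l → g (k , l)) t ∎

module _ {m : ℕ} where

  words-unique : ∀ {cs} → (∀ {c} → c ∈ cs → total c ≡ m) → Unique cs → Unique (map (word m) cs)
  words-unique valid = unique-map (word m) λ c∈ d∈ → word-injective (valid c∈) (valid d∈)

  word∈𝔅 : ∀ {c} → total c ≡ m → word m c ∈ 𝔅 (2 + m)
  word∈𝔅 {c} c≡m = ∈-𝔅 (word-bigrassmannian c c≡m)

  𝔅⁻ : ∀ {ω} → ω ∈ 𝔅 (2 + m) → ∃ λ c → total c ≡ m × ω ≡ word m c
  𝔅⁻ {ω} ω∈ = bigrassmannian⇒word ω (proj₂ (∈-filter⁻ bigrassmannian? {xs = vectors (2 + m) (2 + m)} ω∈))

  𝔅↭ : 𝔅 (2 + m) ↭ map (word m) (coordinates m)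
  𝔅↭ = unique⇒↭ (𝔅-unique (2 + m)) (words-unique ∈-coordinates⁻ (coordinates-unique m)) ⊆ ⊇
    where
    ⊆ : ∀ {ω} → ω ∈ 𝔅 (2 + m) → ω ∈ map (word m) (coordinates m)
    ⊆ ω∈ = let c , c≡m , ω≡ = 𝔅⁻ ω∈ in subst (_∈ map (word m) (coordinates m)) (sym ω≡)
      (∈-map⁺ (word m) (subst (λ m → c ∈ coordinates m) c≡m (∈-coordinates⁺ c)))
    ⊇ : ∀ {ω} → ω ∈ map (word m) (coordinates m) → ω ∈ 𝔅 (2 + m)
    ⊇ ω∈ = let c , c∈ , ω≡ = ∈-map⁻ (word m) ω∈ in subst (_∈ 𝔅 (2 + m)) (sym ω≡) (word∈𝔅 (∈-coordinates⁻ c∈))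

  ∑-𝔅 : ∀ (F : Word (2 + m) → ℕ) → ∑ F (𝔅 (2 + m)) ≡ ∑ (F ∘ word m) (coordinates m)
  ∑-𝔅 F = trans (sum-↭ (↭.map⁺ F 𝔅↭)) (∑-map F (word m) (coordinates m))

  𝔟≡ : 𝔟 (2 + m) ≡ tetrahedral m
  𝔟≡ = begin
    length (𝔅 (2 + m))                     ≡⟨ ∑-one (𝔅 (2 + m)) ⟨
    ∑ (λ _ → 1) (𝔅 (2 + m))                ≡⟨ ∑-𝔅 (λ _ → 1) ⟩
    ∑ (λ _ → 1) (coordinates m)            ≡⟨ ∑-coordinates (λ _ → 1) (λ _ → 1) m ⟩
    ((Diag λ _ _ → 1) ⋆ (Diag λ _ _ → 1)) m ≡⟨ Diag-cong m (λ s t _ → cong₂ _*_ (size s) (size t)) ⟩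
    tetrahedral m                          ∎
    where
    open ≡-Reasoning
    size : ∀ n → Diag (λ _ _ → 1) n ≡ suc n
    size n = trans (sym (∑-antidiagonal (λ _ → 1) n)) (trans (∑-one (antidiagonal n)) (length-antidiagonal n))

-- Lower and upper sets

-- Here `u` and `v` are the amounts by which the first two coordinates drop; the last two gain
-- `u + v` together, split as `e + f` in `suc (u + v)` ways.
downSet : Coords → List Coords
downSet ((i , j) , (k , l)) = concatMap
  (λ { ((u , i′) , (v , j′)) → map (λ { (e , f) → (i′ , j′) , (e + k , f + l) }) (antidiagonal (u + v)) })
  (cartesianProduct (antidiagonal i) (antidiagonal j))

∈-downSet⁺ : ∀ {c d} → total c ≡ total d → c ⊑ d → c ∈ downSet d
∈-downSet⁺ {(i′ , j′) , (k′ , l′)} {(i , j) , (k , l)} eq ((i′≤i , j′≤j) , (k≤k′ , l≤l′)) =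
  ∈-concatMap⁺ _ (lose
    (∈-cartesianProduct⁺ (subst (λ n → (i ∸ i′ , i′) ∈ antidiagonal n) (m∸n+n≡m i′≤i) (∈-antidiagonal⁺ (i ∸ i′) i′))
                         (subst (λ n → (j ∸ j′ , j′) ∈ antidiagonal n) (m∸n+n≡m j′≤j) (∈-antidiagonal⁺ (j ∸ j′) j′)))
    (subst₂ (λ a b → ((i′ , j′) , (a , b)) ∈ map (λ { (e , f) → (i′ , j′) , (e + k , f + l) }) (antidiagonal (i ∸ i′ + (j ∸ j′))))
      (m∸n+n≡m k≤k′) (m∸n+n≡m l≤l′) (∈-map⁺ _
        (subst (λ n → (k′ ∸ k , l′ ∸ l) ∈ antidiagonal n) (sym (⊑-surplus eq i′≤i j′≤j k≤k′ l≤l′)) (∈-antidiagonal⁺ (k′ ∸ k) (l′ ∸ l))))))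

∈-downSet⁻ : ∀ {c} d → c ∈ downSet d → total c ≡ total d × c ⊑ d
∈-downSet⁻ {c} ((i , j) , (k , l)) c∈
  with ((u , i′) , (v , j′)) , p∈ , c∈ ← find (∈-concatMap⁻ _ {xs = cartesianProduct (antidiagonal i) (antidiagonal j)} c∈)
  with (e , f) , ef∈ , refl ← ∈-map⁻ _ c∈
  with refl ← ∈-antidiagonal⁻ i (proj₁ (∈-cartesianProduct⁻ (antidiagonal i) (antidiagonal j) p∈))
     | refl ← ∈-antidiagonal⁻ j (proj₂ (∈-cartesianProduct⁻ (antidiagonal i) (antidiagonal j) p∈))
  = trans (arrange i′ j′ e f k l) (trans (cong (_+ (i′ + j′ + (k + l))) (∈-antidiagonal⁻ (u + v) ef∈)) (arrange′ u v i′ j′ k l)) ,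
    (m≤n+m i′ u , m≤n+m j′ v) , (m≤n+m k e , m≤n+m l f)
  where
  arrange : ∀ i j e f k l → i + j + (e + k + (f + l)) ≡ e + f + (i + j + (k + l))
  arrange = solve-∀
  arrange′ : ∀ u v i j k l → u + v + (i + j + (k + l)) ≡ u + i + (v + j) + (k + l)
  arrange′ = solve-∀

downSet-unique : ∀ d → Unique (downSet d)
downSet-unique ((i , j) , (k , l)) = unique-concatMap _
  (λ { ((i′ , j′) , _) → (i ∸ i′ , i′) , (j ∸ j′ , j′) })
  (λ { ((u , _) , (v , _)) → Unique.map⁺
    (λ {p} {p′} eq → cong₂ _,_ (+-cancelʳ-≡ k (proj₁ p) (proj₁ p′) (cong (proj₁ ∘ proj₂) eq))
                               (+-cancelʳ-≡ l (proj₂ p) (proj₂ p′) (cong (proj₂ ∘ proj₂) eq)))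
    (antidiagonal-unique (u + v)) })
  key≡
  (Unique.cartesianProduct⁺ (antidiagonal-unique i) (antidiagonal-unique j))
  where
  key≡ : ∀ {p c} → p ∈ cartesianProduct (antidiagonal i) (antidiagonal j) →
         c ∈ map (λ { (e , f) → (proj₂ (proj₁ p) , proj₂ (proj₂ p)) , (e + k , f + l) })
                 (antidiagonal (proj₁ (proj₁ p) + proj₁ (proj₂ p))) →
         ((i ∸ proj₁ (proj₁ c) , proj₁ (proj₁ c)) , (j ∸ proj₂ (proj₁ c) , proj₂ (proj₁ c))) ≡ p
  key≡ {(u , i′) , (v , j′)} p∈ c∈
    with _ , _ , refl ← ∈-map⁻ _ c∈
    with ij∈ , kl∈ ← ∈-cartesianProduct⁻ (antidiagonal i) (antidiagonal j) p∈
    with refl ← ∈-antidiagonal⁻ i ij∈ | refl ← ∈-antidiagonal⁻ j kl∈ =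
    cong₂ _,_ (cong (_, i′) (m+n∸n≡m u i′)) (cong (_, j′) (m+n∸n≡m v j′))

-- A sum over `u ≤ i` and `v ≤ j`, encoded by ignoring the complementary index. Its closed form is
-- recorded in `2*downSize` with the denominator 2 cleared.
downSize : ℕ → ℕ → ℕ
downSize i j = Diag (λ u _ → Diag (λ v _ → suc (u + v)) j) i

length-downSet : ∀ i j k l → length (downSet ((i , j) , (k , l))) ≡ downSize i j
length-downSet i j k l = begin
  length (downSet ((i , j) , (k , l)))
    ≡⟨ ∑-one (downSet ((i , j) , (k , l))) ⟨
  ∑ (λ _ → 1) (downSet ((i , j) , (k , l)))
    ≡⟨ ∑-concatMap (λ _ → 1) _ (cartesianProduct (antidiagonal i) (antidiagonal j)) ⟩
  ∑ (λ { ((u , i′) , (v , j′)) → ∑ (λ _ → 1) (map _ (antidiagonal (u + v))) }) (cartesianProduct (antidiagonal i) (antidiagonal j))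
    ≡⟨ ∑-cong′ (cartesianProduct (antidiagonal i) (antidiagonal j)) (λ { ((u , i′) , (v , j′)) → trans
         (∑-one (map _ (antidiagonal (u + v)))) (trans (length-map _ (antidiagonal (u + v))) (length-antidiagonal (u + v))) }) ⟩
  ∑ (λ { ((u , _) , (v , _)) → suc (u + v) }) (cartesianProduct (antidiagonal i) (antidiagonal j))
    ≡⟨ ∑-cartesianProduct _ (antidiagonal i) (antidiagonal j) ⟩
  ∑ (λ { (u , _) → ∑ (λ { (v , _) → suc (u + v) }) (antidiagonal j) }) (antidiagonal i)
    ≡⟨ ∑-antidiagonal _ i ⟩
  Diag (λ u _ → ∑ (λ { (v , _) → suc (u + v) }) (antidiagonal j)) i
    ≡⟨ Diag-cong i (λ u _ _ → ∑-antidiagonal _ j) ⟩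
  downSize i j ∎
  where open ≡-Reasoning

-- An arithmetic series. The constant `c` is general because peeling off the first term replaces it
-- by `2 + c`.
Diag-linear : ∀ c n → Diag (λ u _ → 2 * u + c) n ≡ suc n * (n + c)
Diag-linear c zero    = sym (+-identityʳ c)
Diag-linear c (suc n) = begin
  c + Diag (λ u _ → 2 * suc u + c) n    ≡⟨ cong (_+_ c) (Diag-cong n λ u _ _ → shift u c) ⟩
  c + Diag (λ u _ → 2 * u + (2 + c)) n  ≡⟨ cong (_+_ c) (Diag-linear (2 + c) n) ⟩
  c + suc n * (n + (2 + c))             ≡⟨ expand n c ⟩
  suc (suc n) * (suc n + c)             ∎
  where
  open ≡-Reasoning
  shift : ∀ u c → 2 * suc u + c ≡ 2 * u + (2 + c)
  shift = solve-∀
  expand : ∀ n c → c + suc n * (n + (2 + c)) ≡ suc (suc n) * (suc n + c)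
  expand = solve-∀

2*downSize : ∀ i j → 2 * downSize i j ≡ suc i * suc j * (2 + (i + j))
2*downSize i j = begin
  2 * downSize i j
    ≡⟨ Diag-*ˡ 2 (λ u _ → Diag (λ v _ → suc (u + v)) j) i ⟨
  Diag (λ u _ → 2 * Diag (λ v _ → suc (u + v)) j) i
    ≡⟨ Diag-cong i (λ u _ _ → inner u) ⟩
  Diag (λ u _ → suc j * (2 * u + (2 + j))) i
    ≡⟨ Diag-*ˡ (suc j) (λ u _ → 2 * u + (2 + j)) i ⟩
  suc j * Diag (λ u _ → 2 * u + (2 + j)) i
    ≡⟨ cong (suc j *_) (Diag-linear (2 + j) i) ⟩
  suc j * (suc i * (i + (2 + j)))
    ≡⟨ arrange i j ⟩
  suc i * suc j * (2 + (i + j)) ∎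
  where
  open ≡-Reasoning
  double : ∀ u v → 2 * suc (u + v) ≡ 2 * v + (2 + 2 * u)
  double = solve-∀
  arrange′ : ∀ u j → suc j * (j + (2 + 2 * u)) ≡ suc j * (2 * u + (2 + j))
  arrange′ = solve-∀
  arrange : ∀ i j → suc j * (suc i * (i + (2 + j))) ≡ suc i * suc j * (2 + (i + j))
  arrange = solve-∀
  inner : ∀ u → 2 * Diag (λ v _ → suc (u + v)) j ≡ suc j * (2 * u + (2 + j))
  inner u = trans (sym (Diag-*ˡ 2 (λ v _ → suc (u + v)) j)) (trans (Diag-cong j λ v _ _ → double u v)
    (trans (Diag-linear (2 + 2 * u) j) (arrange′ u j)))

total-swap : ∀ c → total (swap c) ≡ total c
total-swap ((i , j) , (k , l)) = +-comm (k + l) (i + j)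

⊑-swap : ∀ {c d} → c ⊑ d → swap d ⊑ swap c
⊑-swap (p , q) = q , p

module _ {m : ℕ} where

  β-word : ∀ i j k l → total ((i , j) , (k , l)) ≡ m → β (word m ((i , j) , (k , l))) ≡ downSize i j
  β-word i j k l d≡m = trans (↭.↭-length (unique⇒↭
      (Unique.filter⁺ (λ π → π ≤ᴮ? word m d) (𝔅-unique (2 + m)))
      (words-unique valid (downSet-unique d)) ⊆ ⊇))
    (trans (length-map (word m) (downSet d)) (length-downSet i j k l))
    where
    d = (i , j) , (k , l)
    valid : ∀ {c} → c ∈ downSet d → total c ≡ m
    valid c∈ = trans (proj₁ (∈-downSet⁻ d c∈)) d≡m
    ⊆ : ∀ {π} → π ∈ filter (λ π → π ≤ᴮ? word m d) (𝔅 (2 + m)) → π ∈ map (word m) (downSet d)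
    ⊆ π∈ = let π∈𝔅 , π≤ = ∈-filter⁻ (λ π → π ≤ᴮ? word m d) {xs = 𝔅 (2 + m)} π∈
               c , c≡m , π≡ = 𝔅⁻ π∈𝔅 in
      subst (_∈ map (word m) (downSet d)) (sym π≡) (∈-map⁺ (word m)
        (∈-downSet⁺ {c} {d} (trans c≡m (sym d≡m)) (≤ᴮ⇒⊑ {m} {c} {d} c≡m d≡m (subst (_≤ᴮ word m d) π≡ π≤))))
    ⊇ : ∀ {π} → π ∈ map (word m) (downSet d) → π ∈ filter (λ π → π ≤ᴮ? word m d) (𝔅 (2 + m))
    ⊇ π∈ = let c , c∈ , π≡ = ∈-map⁻ (word m) π∈ in
      subst (_∈ filter (λ π → π ≤ᴮ? word m d) (𝔅 (2 + m))) (sym π≡)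
        (∈-filter⁺ (λ π → π ≤ᴮ? word m d) (word∈𝔅 (valid c∈)) (⊑⇒≤ᴮ {m} {c} {d} (valid c∈) d≡m (proj₂ (∈-downSet⁻ d c∈))))

  -- Exchanging (x , y) with (z + 1 , w + 1) reverses the order.
  α-word : ∀ i j k l → total ((i , j) , (k , l)) ≡ m → α (word m ((i , j) , (k , l))) ≡ downSize k l
  α-word i j k l d≡m = trans (↭.↭-length (unique⇒↭
      (Unique.filter⁺ (λ τ → word m d ≤ᴮ? τ) (𝔅-unique (2 + m)))
      (words-unique valid (Unique.map⁺ (cong swap) (downSet-unique (swap d)))) ⊆ ⊇))
    (trans (length-map (word m) (map swap (downSet (swap d)))) (trans (length-map swap (downSet (swap d)))
      (length-downSet k l i j)))
    where
    d = (i , j) , (k , l)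
    upSet = map swap (downSet (swap d))
    upSet⁻ : ∀ {c} → c ∈ upSet → total c ≡ total d × d ⊑ c
    upSet⁻ {c} c∈ = let c′ , c′∈ , c≡ = ∈-map⁻ swap c∈
                        eq , c′⊑ = ∈-downSet⁻ (swap d) c′∈ in
      trans (cong total c≡) (trans (total-swap c′) (trans eq (total-swap d))) ,
      subst (d ⊑_) (sym c≡) (⊑-swap {c′} {swap d} c′⊑)
    valid : ∀ {c} → c ∈ upSet → total c ≡ m
    valid c∈ = trans (proj₁ (upSet⁻ c∈)) d≡m
    ⊆ : ∀ {τ} → τ ∈ filter (λ τ → word m d ≤ᴮ? τ) (𝔅 (2 + m)) → τ ∈ map (word m) upSet
    ⊆ τ∈ = let τ∈𝔅 , ≤τ = ∈-filter⁻ (λ τ → word m d ≤ᴮ? τ) {xs = 𝔅 (2 + m)} τ∈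
               c , c≡m , τ≡ = 𝔅⁻ τ∈𝔅 in
      subst (_∈ map (word m) upSet) (sym τ≡) (∈-map⁺ (word m) (∈-map⁺ swap
        (∈-downSet⁺ {swap c} {swap d} (trans (total-swap c) (trans c≡m (trans (sym d≡m) (sym (total-swap d)))))
          (⊑-swap {d} {c} (≤ᴮ⇒⊑ {m} {d} {c} d≡m c≡m (subst (word m d ≤ᴮ_) τ≡ ≤τ))))))
    ⊇ : ∀ {τ} → τ ∈ map (word m) upSet → τ ∈ filter (λ τ → word m d ≤ᴮ? τ) (𝔅 (2 + m))
    ⊇ τ∈ = let c , c∈ , τ≡ = ∈-map⁻ (word m) τ∈ in
      subst (_∈ filter (λ τ → word m d ≤ᴮ? τ) (𝔅 (2 + m))) (sym τ≡)
        (∈-filter⁺ (λ τ → word m d ≤ᴮ? τ) (word∈𝔅 (valid c∈)) (⊑⇒≤ᴮ {m} {d} {c} d≡m (valid c∈) (proj₂ (upSet⁻ c∈))))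

-- The number of stars in coordinates

∑-starWeight : ∀ k ℓ m → ∑ (starWeight k ℓ) (𝔅 (2 + m)) ≡ starCount downSize k ℓ m
∑-starWeight k ℓ m = begin
  ∑ (starWeight k ℓ) (𝔅 (2 + m))
    ≡⟨ ∑-𝔅 {m} (starWeight k ℓ) ⟩
  ∑ (λ c → starWeight k ℓ (word m c)) (coordinates m)
    ≡⟨ ∑-cong (All.tabulate weight) ⟩
  ∑ (λ { (ij , kl) → f ij * g kl }) (coordinates m)
    ≡⟨ ∑-coordinates f g m ⟩
  starCount downSize k ℓ m ∎
  where
  open ≡-Reasoning
  f g : ℕ × ℕ → ℕ
  f (i , j) = (downSize i j ∸ 1) C ℓ
  g (i , j) = (downSize i j ∸ 1) C k
  weight : ∀ {c} → c ∈ coordinates m → starWeight k ℓ (word m c) ≡ f (proj₁ c) * g (proj₂ c)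
  weight {(i , j) , (a , b)} c∈ = trans
    (cong₂ (λ x y → ((x ∸ 1) C k) * ((y ∸ 1) C ℓ)) (α-word {m} i j a b (∈-coordinates⁻ {m} c∈)) (β-word {m} i j a b (∈-coordinates⁻ {m} c∈)))
    (*-comm (g (a , b)) (f (i , j)))

theorem5p2 : ∀ (k ℓ : ℕ) →
    (∀ n → 2 ≤ n → k ⊔ ℓ ≤ 𝔟 n →
    q n k ℓ ≡ 𝔼 n (λ ρ → ((α ρ ∸ 1) C k) * ((β ρ ∸ 1) C ℓ)) /₀ ((𝔟 n C k) * (𝔟 n C ℓ)))
    ×
    ((λ n → q n k ℓ) ~
    (λ _ → fromℕ (2 * 3 ^ (k + ℓ)) /₀
    ((k + ℓ + 1) * ((3 * (k + ℓ) + 2) C (3 * k + 1))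
    * (2 * k + 1) * ((2 * k) C k) * (2 * ℓ + 1) * ((2 * ℓ) C ℓ))))
theorem5p2 k ℓ = (λ n _ _ → q≡𝔼 n k ℓ) ,
  ~-intro (λ n → q n k ℓ) (starCount downSize k ℓ) (sampleSize k ℓ)
    -- Since `m < tetrahedral m`, the threshold `k ⊔ ℓ` for `m` already makes every factor of the
    -- sample size positive.
    (numerator k ℓ) (denominator k ℓ) (k ⊔ ℓ)
    (λ m → trans (q≡ratio (2 + m) k ℓ) (cong₂ (λ s b → fromℕ s /₀ ((b C k) * (b * (b C ℓ))))
      (∑-starWeight k ℓ m) (𝔟≡ {m})))
    (sampleSize-pos k ℓ) (numerator-pos k ℓ) (denominator-pos k ℓ) (starCount~ downSize 2*downSize k ℓ)
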